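{- Let $n\ge1$ and $d\ge2$ be integers with $d$-sequence $n=n_0,n_1,\dots,n_k=n_{k+1}$, where $d_i=n_i/n_{i+1}=\gcd(n_i,d)$. Let $\Sigma_0(n,d)$ and $S_0(n,d)$ be the kernels of multiplication by $d^k$ on $\Sigma(n,d)$ and $S(n,d)$. Then $$\Sigma_0(n,d)\cong\bigoplus_{i=0}^{k-1}\mathbb{Z}_{d^{i+1}}^{\,n_i-2n_{i+1}+n_{i+2}}\quad\text{and}\quad S_0(n,d)\cong\bigoplus_{i=0}^{k-1}\Big(\mathbb{Z}_{d^{i+1}/d_i}\oplus\mathbb{Z}_{d^{i+1}}^{\,n_i-2n_{i+1}+n_{i+2}-1}\Big).$$
   Context: The $d$-sequence of $n$: $n_0=n$, $d_i=\gcd(n_i,d)$, $n_{i+1}=n_i/d_i$, with $k\ge0$ the smallest index with $d_k=1$ (so $n_{k+1}=n_k$). In $\mathbb{Q}[x]/(x^n-1)$ (exponents mod $n$) put $e_v=x^v-1$, $\epsilon_v=d\,e_v-e_{dv}$; $\mathcal Z_n$ = $\mathbb{Z}$-span of $e_1,\dots,e_{n-1}$, $\mathcal E_{n,d}$ = $\mathbb{Z}$-span of $\epsilon_1,\dots,\epsilon_{n-1}$, $\Sigma(n,d)=\mathcal Z_n/\mathcal E_{n,d}$; with $f_v=dx^v-\sum_{i=0}^{d-1}x^{dv+i}$, $S(n,d)=\mathcal Z_n/\langle f_1,\dots,f_{n-1}\rangle_{\mathbb{Z}}$ (sandpile group of $\mathrm{DB}(n,d)$). -}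

module Defs where

open import Data.Nat as ℕ using (ℕ; zero; suc; _∸_; _^_; NonZero; _%_; _/_)
open import Data.Nat.GCD using (gcd)
open import Data.Integer as ℤ using (ℤ; +_; _-_)
open import Data.Integer.Divisibility using (_∣_)
open import Data.Fin using (Fin; toℕ)
open import Data.List using (List; []; _∷_; _++_; replicate; length; lookup)
open import Data.Product using (Σ; ∃; _,_; proj₁; proj₂)
open import Data.Bool using (if_then_else_)
open import Relation.Nullary.Decidable.Core using (does)
open import Relation.Binary.PropositionalEquality using (_≡_; refl; cong; cong₂; trans; sym)
import Data.Integer.Properties as ℤP

record SGroup : Set₁ where
  field
    Carrier : Set
    _≈_     : Carrier → Carrier → Set
    _∙_     : Carrier → Carrier → Carrier

open SGroup

record Iso (G H : SGroup) : Set where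
  field
    to         : Carrier G → Carrier H
    to-cong    : ∀ {x y} → _≈_ G x y → _≈_ H (to x) (to y)
    to-hom     : ∀ x y → _≈_ H (to (_∙_ G x y)) (_∙_ H (to x) (to y))
    injective  : ∀ {x y} → _≈_ H (to x) (to y) → _≈_ G x y
    surjective : ∀ y → ∃ λ x → _≈_ H (to x) y

CycSum : List ℕ → SGroup
CycSum L = record
  { Carrier = Fin (length L) → ℤ
  ; _≈_     = λ a b → ∀ j → (+ lookup L j) ∣ (a j - b j)
  ; _∙_     = λ a b j → a j ℤ.+ b j
  }

-- division, only used with nonzero divisor (returns the dividend for divisor 0)
safeDiv : ℕ → ℕ → ℕ
safeDiv m zero    = m
safeDiv m (suc g) = m / suc g

ns : ℕ → ℕ → ℕ → ℕ
ns n d zero    = n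
ns n d (suc i) = safeDiv (ns n d i) (gcd (ns n d i) d)

ds : ℕ → ℕ → ℕ → ℕ
ds n d i = gcd (ns n d i) d

IsDLength : ℕ → ℕ → ℕ → Set
IsDLength n d k = (ds n d k ≡ 1) Data.Product.× (∀ i → i ℕ.< k → ds n d i ≢ 1)
  where open import Relation.Binary.PropositionalEquality using (_≢_)

-- ℤ[x]/(x^n - 1) as coefficient vectors (coefficient of x^j, j < n)

Poly : ℕ → Set
Poly n = Fin n → ℤ

sumFin : (m : ℕ) → (Fin m → ℤ) → ℤ
sumFin zero    f = + 0
sumFin (suc m) f = f Fin.zero ℤ.+ sumFin m (λ i → f (Fin.suc i))
  where import Data.Fin as Fin

mono : (n : ℕ) .{{_ : NonZero n}} → ℕ → Poly n
mono n v j = if does (toℕ j ℕ.≟ v % n) then + 1 else + 0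

e : (n : ℕ) .{{_ : NonZero n}} → ℕ → Poly n
e n v j = mono n v j - mono n 0 j

ε : (n : ℕ) .{{_ : NonZero n}} → ℕ → ℕ → Poly n
ε n d v j = (+ d) ℤ.* e n v j - e n (d ℕ.* v) j

fv : (n : ℕ) .{{_ : NonZero n}} → ℕ → ℕ → Poly n
fv n d v j = (+ d) ℤ.* mono n v j - sumFin d (λ i → mono n (d ℕ.* v ℕ.+ toℕ i) j)

lc : {n m : ℕ} → (Fin m → ℤ) → (Fin m → Poly n) → Poly n
lc {m = m} c g j = sumFin m (λ i → c i ℤ.* g i j)

InSpan : {n m : ℕ} → (Fin m → Poly n) → Poly n → Set
InSpan {n} {m} g p = ∃ λ (c : Fin m → ℤ) → ∀ j → p j ≡ lc c g j

-- generator families indexed by v = 1 … n-1 (i : Fin (n ∸ 1) stands for v = i + 1)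
eGens : (n : ℕ) .{{_ : NonZero n}} → Fin (n ∸ 1) → Poly n
eGens n i = e n (suc (toℕ i))

εGens : (n : ℕ) .{{_ : NonZero n}} → ℕ → Fin (n ∸ 1) → Poly n
εGens n d i = ε n d (suc (toℕ i))

fGens : (n : ℕ) .{{_ : NonZero n}} → ℕ → Fin (n ∸ 1) → Poly n
fGens n d i = fv n d (suc (toℕ i))

elemZ : (n : ℕ) .{{_ : NonZero n}} → (Fin (n ∸ 1) → ℤ) → Poly n
elemZ n a = lc a (eGens n)

open import Algebra.Properties.CommutativeSemigroup ℤP.+-commutativeSemigroup using (interchange)

sumFin-+ : ∀ m (f g : Fin m → ℤ) → sumFin m (λ i → f i ℤ.+ g i) ≡ sumFin m f ℤ.+ sumFin m g
sumFin-+ zero f g = refl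
sumFin-+ (suc m) f g =
  trans (cong (λ t → (f Fin.zero ℤ.+ g Fin.zero) ℤ.+ t) (sumFin-+ m (λ i → f (Fin.suc i)) (λ i → g (Fin.suc i))))
        (interchange (f Fin.zero) (g Fin.zero) _ _)
  where import Data.Fin as Fin

sumFin-cong : ∀ m {f g : Fin m → ℤ} → (∀ i → f i ≡ g i) → sumFin m f ≡ sumFin m g
sumFin-cong zero    eq = refl
sumFin-cong (suc m) eq = cong₂ ℤ._+_ (eq Fin.zero) (sumFin-cong m (λ i → eq (Fin.suc i)))
  where import Data.Fin as Fin

lc-+ : {n m : ℕ} (c c′ : Fin m → ℤ) (g : Fin m → Poly n) (j : Fin n) →
       lc (λ i → c i ℤ.+ c′ i) g j ≡ lc c g j ℤ.+ lc c′ g j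
lc-+ {m = m} c c′ g j =
  trans (sumFin-cong m (λ i → ℤP.*-distribʳ-+ (g i j) (c i) (c′ i)))
        (sumFin-+ m (λ i → c i ℤ.* g i j) (λ i → c′ i ℤ.* g i j))

InSpan-+ : {n m : ℕ} {g : Fin m → Poly n} {p q : Poly n} →
           InSpan g p → InSpan g q → InSpan g (λ j → p j ℤ.+ q j)
InSpan-+ {g = g} (c , eqc) (c′ , eqc′) =
  (λ i → c i ℤ.+ c′ i) , λ j → trans (cong₂ ℤ._+_ (eqc j) (eqc′ j)) (sym (lc-+ c c′ g j))

InSpan-resp : {n m : ℕ} {g : Fin m → Poly n} {p q : Poly n} →
              (∀ j → p j ≡ q j) → InSpan g p → InSpan g q
InSpan-resp eq (c , eqc) = c , λ j → trans (sym (eq j)) (eqc j)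

-- The quotient 𝒵_n / ⟨G⟩ and the kernel of multiplication by D on it.
-- Elements of 𝒵_n are given by coefficient vectors a w.r.t. e_1 … e_{n-1};
-- two are identified iff their difference lies in the ℤ-span of G.

KerMul : (n : ℕ) .{{_ : NonZero n}} → (D : ℕ) → (Fin (n ∸ 1) → Poly n) → SGroup
KerMul n D G = record
  { Carrier = Σ (Fin (n ∸ 1) → ℤ) (λ a → InSpan G (λ j → (+ D) ℤ.* elemZ n a j))
  ; _≈_     = λ x y → InSpan G (λ j → elemZ n (proj₁ x) j - elemZ n (proj₁ y) j)
  ; _∙_     = λ x y → (λ i → proj₁ x i ℤ.+ proj₁ y i) ,
                InSpan-resp (λ j → trans (sym (ℤP.*-distribˡ-+ (+ D) (elemZ n (proj₁ x) j) (elemZ n (proj₁ y) j)))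
                                          (cong ((+ D) ℤ.*_) (sym (lc-+ (proj₁ x) (proj₁ y) (eGens n) j))))
                            (InSpan-+ (proj₂ x) (proj₂ y))
  }

Sigma0 : (n : ℕ) .{{_ : NonZero n}} → ℕ → ℕ → SGroup
Sigma0 n d k = KerMul n (d ^ k) (εGens n d)

S0 : (n : ℕ) .{{_ : NonZero n}} → ℕ → ℕ → SGroup
S0 n d k = KerMul n (d ^ k) (fGens n d)

-- n_i - 2 n_{i+1} + n_{i+2}  (nonnegative for i < k)
rk : ℕ → ℕ → ℕ → ℕ
rk n d i = (ns n d i ℕ.+ ns n d (suc (suc i))) ∸ 2 ℕ.* ns n d (suc i)

sigmaModuli : ℕ → ℕ → ℕ → List ℕ
sigmaModuli n d zero    = []
sigmaModuli n d (suc k) = sigmaModuli n d k ++ replicate (rk n d k) (d ^ suc k)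

sModuli : ℕ → ℕ → ℕ → List ℕ
sModuli n d zero    = []
sModuli n d (suc k) = sModuli n d k ++ (safeDiv (d ^ suc k) (ds n d k) ∷ replicate (rk n d k ∸ 1) (d ^ suc k))

{-# OPTIONS --safe #-}
module Submission where

open import Defs
open import Data.Bool using (if_then_else_)
open import Data.Nat as ℕ using (ℕ; zero; suc; NonZero; _≤_; _<_; z≤n; s≤s; _∸_; _^_)
import Data.Nat.Properties as ℕₚ
import Data.Nat.Divisibility as ℕᵈ
open import Data.Nat.DivMod as ℕ% using (_%_)
open import Data.Nat.GCD
  using (gcd; gcd[m,n]∣m; gcd[m,n]∣n; gcd-greatest; gcd[m,n]≡0⇒n≡0; gcd-GCD; module Bézout)
open import Data.Nat.Tactic.RingSolver using () renaming (solve-∀ to ℕ-solve-∀)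
open import Data.Integer using (ℤ; +_; _+_; _*_; _-_; -_; 0ℤ; 1ℤ; ∣_∣)
import Data.Integer.Properties as ℤₚ
open import Data.Integer.DivMod using (_%ℕ_; _/ℕ_; a≡a%ℕn+[a/ℕn]*n)
import Data.Integer.Divisibility as Unsigned
open import Data.Integer.Divisibility.Signed
open import Data.Integer.Tactic.RingSolver using (solve-∀)
open import Data.Fin using (Fin; zero; suc; toℕ; fromℕ<)
open import Data.Fin.Properties as Fin using (toℕ-fromℕ<; toℕ<n; toℕ-injective; pigeonhole)
open import Data.List using (List; []; _∷_; _++_; map; filter; downFrom; length; lookup; replicate)
open import Data.List.Properties using (map-++; map-∘)
open import Data.List.Membership.Propositional using (_∈_)
open import Data.List.Membership.Propositional.Properties
  using (∈-filter⁺; ∈-filter⁻; ∈-downFrom⁺; ∈-map⁺; ∈-map⁻; ∈-++⁺ˡ; ∈-++⁺ʳ; ∈-++⁻)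
open import Data.List.Relation.Unary.Any using (here; there)
import Data.List.Relation.Unary.All as All
open import Data.List.Relation.Unary.AllPairs using ([]; _∷_)
open import Data.List.Relation.Unary.Unique.Propositional using (Unique)
import Data.List.Relation.Unary.Unique.Propositional.Properties as Unique
open import Data.Product using (_×_; _,_; proj₁; proj₂; ∃; Σ; ∃₂)
open import Data.Product.Properties using (≡-dec)
open import Data.Sum using (_⊎_; inj₁; inj₂)
open import Data.Unit using (⊤; tt)
open import Function using (_∘_)
open import Relation.Nullary using (¬_; yes; no; contradiction; Dec; does)
open import Relation.Nullary.Decidable using (_⊎-dec_; _×-dec_; ¬?; map′)
open import Relation.Unary using (Decidable)
open import Relation.Binary.Bundles using (Setoid)
open import Relation.Binary.PropositionalEquality
  using (_≡_; _≢_; _≗_; refl; sym; trans; cong; cong₂; subst; subst₂; module ≡-Reasoning)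
import Relation.Binary.Reasoning.Setoid as SetoidReasoning

-- Both groups are read off from multiplication by d on ℤ/n. Its i-th image d ^ i ℤ/n is a copy of ℤ/N i, a residue u
-- modulo N i standing for d ^ i * u. Dividing d ^ i * u by d as often as possible, and inverting d on the part of
-- ℤ/n where it is bijective, gives a lift L i u with d ^ i · L i u ≈ E (d ^ i * u) modulo the relations
-- d e_v ≈ e_(dv). Hence b (i , u) = L i u - L (i + 1) u is killed by d ^ (i + 1), and b (i , d v) ≈ d · b (i + 1 , v).
-- The b (i , u) with (i , u) a head (u is not a multiple of d modulo N i, and b (i , u) is not zero for trivial
-- reasons) form a basis of Σ₀: e_v telescopes into the b's up to a multiple of d ^ k e_v, and the functionals
-- π̂ counting how often a head is met on the way of v, v d, v d², … are dual to them.
--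
-- Multiplication by x - 1 maps f_v to ε_(v+1) - ε_v and identifies S with the kernel of θ : Σ → ℤ/n, e_v ↦ v. On the
-- basis, θ (b (i , u)) is a multiple of N (i + 1), and at every level some head attains N (i + 1) itself. Replacing
-- the coordinate p at that special head by T i p / N i, where T i p collects the values of θ from the levels ≥ i,
-- divides its order d ^ (i + 1) by d_i and leaves all other orders unchanged.

-- The second difference in the exponent is a count with one correction: `N i - N (i + 1)` residues
-- modulo `N i` are not multiples of `g i`, and `N (i + 1) - N (i + 2)` of them have the same lift
-- at level `i + 1`, hence give nothing. The dual functionals are integer-valued and pair with the
-- basis in an exact identity matrix, which replaces any computation of determinants or group
-- orders.
--
-- For S the obstacle is that the kernel of `θ` is cut out by one congruence modulo `n` that couples
-- all levels, while the answer is a direct sum. It decouples because level `i` contributes only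
-- multiples of `N (i + 1)`: the single condition on `T 0 p` forces `N i` to divide `T i p` at every
-- level. Conversely, as the special head attains `N (i + 1)`, any multiples of the `N i` can be
-- prescribed for the `T i p` by solving for one coordinate per level. This change of coordinates is
-- triangular over ℤ. A special coordinate `p` enters `T i p` with factor `N (i + 1)`, the new
-- coordinate divides by `N i`, and the quotient of the two is `d_i`.

private variable
  m l : ℕ
  X : Set

+-congˡ : ∀ x {y z} → y ≡ z → x + y ≡ x + z
+-congˡ x = cong (λ y → x + y)

-- Finite sums

sumFin-*ˡ : ∀ m z (f : Fin m → ℤ) → sumFin m (λ i → z * f i) ≡ z * sumFin m f
sumFin-*ˡ zero    z f = sym (ℤₚ.*-zeroʳ z)
sumFin-*ˡ (suc m) z f =
  trans (+-congˡ (z * f zero) (sumFin-*ˡ m z (f ∘ suc)))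
        (sym (ℤₚ.*-distribˡ-+ z (f zero) _))

sumFin-0 : ∀ m {f : Fin m → ℤ} → (∀ i → f i ≡ 0ℤ) → sumFin m f ≡ 0ℤ
sumFin-0 zero    f≡0 = refl
sumFin-0 (suc m) f≡0 = cong₂ _+_ (f≡0 zero) (sumFin-0 m (f≡0 ∘ suc))

sumFin-single : ∀ m (i : Fin m) {f : Fin m → ℤ} → (∀ j → j ≢ i → f j ≡ 0ℤ) → sumFin m f ≡ f i
sumFin-single (suc m) zero {f} f≡0 =
  trans (+-congˡ (f zero) (sumFin-0 m λ j → f≡0 (suc j) λ ())) (ℤₚ.+-identityʳ _)
sumFin-single (suc m) (suc i) {f} f≡0 =
  trans (cong₂ _+_ (f≡0 zero λ ()) (sumFin-single m i λ j j≢i → f≡0 (suc j) λ { refl → j≢i refl }))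
        (ℤₚ.+-identityˡ (f (suc i)))

sumFin-swap : ∀ m l (f : Fin m → Fin l → ℤ) →
  sumFin m (λ i → sumFin l (f i)) ≡ sumFin l (λ j → sumFin m (λ i → f i j))
sumFin-swap zero    l f = sym (sumFin-0 l λ _ → refl)
sumFin-swap (suc m) l f =
  trans (+-congˡ (sumFin l (f zero)) (sumFin-swap m l (f ∘ suc)))
        (sym (sumFin-+ l (f zero) _))

sumL : List X → (X → ℤ) → ℤ
sumL []       f = 0ℤ
sumL (x ∷ xs) f = f x + sumL xs f

sumL-cong : ∀ (xs : List X) {f g : X → ℤ} → (∀ {x} → x ∈ xs → f x ≡ g x) → sumL xs f ≡ sumL xs g
sumL-cong []       eq = refl
sumL-cong (x ∷ xs) eq = cong₂ _+_ (eq (here refl)) (sumL-cong xs (eq ∘ there))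

sumL-0 : ∀ (xs : List X) {f : X → ℤ} → (∀ {x} → x ∈ xs → f x ≡ 0ℤ) → sumL xs f ≡ 0ℤ
sumL-0 []       eq = refl
sumL-0 (x ∷ xs) eq = cong₂ _+_ (eq (here refl)) (sumL-0 xs (eq ∘ there))

sumL-+ : ∀ (xs : List X) (f g : X → ℤ) → sumL xs (λ x → f x + g x) ≡ sumL xs f + sumL xs g
sumL-+ []       f g = refl
sumL-+ (x ∷ xs) f g = trans (+-congˡ (f x + g x) (sumL-+ xs f g)) (lem (f x) (g x) _ _)
  where
  lem : ∀ a b c d → (a + b) + (c + d) ≡ (a + c) + (b + d)
  lem = solve-∀

sumL-*ˡ : ∀ (xs : List X) z (f : X → ℤ) → sumL xs (λ x → z * f x) ≡ z * sumL xs f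
sumL-*ˡ []       z f = sym (ℤₚ.*-zeroʳ z)
sumL-*ˡ (x ∷ xs) z f =
  trans (+-congˡ (z * f x) (sumL-*ˡ xs z f)) (sym (ℤₚ.*-distribˡ-+ z (f x) _))

sumL-single : ∀ {xs : List X} {y} → Unique xs → y ∈ xs → (f : X → ℤ) →
  (∀ {x} → x ∈ xs → x ≢ y → f x ≡ 0ℤ) → sumL xs f ≡ f y
sumL-single {xs = x ∷ xs} (x∉ ∷ u) (here refl) f f≡0 =
  trans (+-congˡ (f x) (sumL-0 xs λ y∈ → f≡0 (there y∈) (All.lookup x∉ y∈ ∘ sym))) (ℤₚ.+-identityʳ _)
sumL-single {xs = x ∷ xs} (x∉ ∷ u) (there y∈) f f≡0 =
  trans (cong₂ _+_ (f≡0 (here refl) (All.lookup x∉ y∈)) (sumL-single u y∈ f (f≡0 ∘ there)))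
        (ℤₚ.+-identityˡ _)

∣-sumL : ∀ {z} (xs : List X) {f : X → ℤ} → (∀ {x} → x ∈ xs → z ∣ f x) → z ∣ sumL xs f
∣-sumL []       h = divides 0ℤ refl
∣-sumL (x ∷ xs) h = ∣m∣n⇒∣m+n (h (here refl)) (∣-sumL xs (h ∘ there))

∣-sumFin : ∀ {z} m {f : Fin m → ℤ} → (∀ i → z ∣ f i) → z ∣ sumFin m f
∣-sumFin zero    h = divides 0ℤ refl
∣-sumFin (suc m) h = ∣m∣n⇒∣m+n (h zero) (∣-sumFin m (h ∘ suc))

sumL-sumFin : ∀ (xs : List X) m (f : X → Fin m → ℤ) →
  sumL xs (λ x → sumFin m (f x)) ≡ sumFin m (λ i → sumL xs (λ x → f x i))
sumL-sumFin []       m f = sym (sumFin-0 m λ _ → refl)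
sumL-sumFin (x ∷ xs) m f =
  trans (+-congˡ (sumFin m (f x)) (sumL-sumFin xs m f)) (sym (sumFin-+ m (f x) _))

-- range i l f is the sum of f over [i, i + l)

range : ℕ → ℕ → (ℕ → ℤ) → ℤ
range i zero    f = 0ℤ
range i (suc l) f = f i + range (suc i) l f

range-cong : ∀ i l {f g : ℕ → ℤ} → (∀ j → i ℕ.≤ j → j ℕ.< i ℕ.+ l → f j ≡ g j) → range i l f ≡ range i l g
range-cong i zero    eq = refl
range-cong i (suc l) eq = cong₂ _+_ (eq i ℕₚ.≤-refl (ℕₚ.m<m+n i (ℕ.s≤s ℕ.z≤n)))
  (range-cong (suc i) l λ j i<j j< → eq j (ℕₚ.<⇒≤ i<j) (subst (j ℕ.<_) (sym (ℕₚ.+-suc i l)) j<))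

range-*ˡ : ∀ i l z (f : ℕ → ℤ) → range i l (λ j → z * f j) ≡ z * range i l f
range-*ˡ i zero    z f = sym (ℤₚ.*-zeroʳ z)
range-*ˡ i (suc l) z f =
  trans (+-congˡ (z * f i) (range-*ˡ (suc i) l z f)) (sym (ℤₚ.*-distribˡ-+ z (f i) _))

range-minus : ∀ i l (f g : ℕ → ℤ) → range i l f - range i l g ≡ range i l (λ j → f j - g j)
range-minus i zero    f g = refl
range-minus i (suc l) f g = trans (lem (f i) (g i) _ _) (+-congˡ (f i - g i) (range-minus (suc i) l f g))
  where
  lem : ∀ a b c d → (a + c) - (b + d) ≡ (a - b) + (c - d)
  lem = solve-∀

range-telescope : ∀ i l (f : ℕ → ℤ) → range i l (λ j → f j - f (suc j)) ≡ f i - f (i ℕ.+ l)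
range-telescope i zero    f rewrite ℕₚ.+-identityʳ i = sym (ℤₚ.+-inverseʳ (f i))
range-telescope i (suc l) f rewrite ℕₚ.+-suc i l =
  trans (+-congˡ (f i - f (suc i)) (range-telescope (suc i) l f)) (lem (f i) (f (suc i)) _)
  where
  lem : ∀ a b c → (a - b) + (b - c) ≡ a - c
  lem = solve-∀

range-0 : ∀ i l {f : ℕ → ℤ} → (∀ j → i ℕ.≤ j → j ℕ.< i ℕ.+ l → f j ≡ 0ℤ) → range i l f ≡ 0ℤ
range-0 i zero    eq = refl
range-0 i (suc l) eq = cong₂ _+_ (eq i ℕₚ.≤-refl (ℕₚ.m<m+n i (ℕ.s≤s ℕ.z≤n)))
  (range-0 (suc i) l λ j i<j j< → eq j (ℕₚ.<⇒≤ i<j) (subst (j ℕ.<_) (sym (ℕₚ.+-suc i l)) j<))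

range-split : ∀ i l l′ (f : ℕ → ℤ) → range i (l ℕ.+ l′) f ≡ range i l f + range (i ℕ.+ l) l′ f
range-split i zero    l′ f rewrite ℕₚ.+-identityʳ i = sym (ℤₚ.+-identityˡ _)
range-split i (suc l) l′ f rewrite ℕₚ.+-suc i l =
  trans (+-congˡ (f i) (range-split (suc i) l l′ f)) (sym (ℤₚ.+-assoc (f i) _ _))

range-last : ∀ i l (f : ℕ → ℤ) → range i (suc l) f ≡ range i l f + f (i ℕ.+ l)
range-last i l f = trans (cong (λ t → range i t f) (ℕₚ.+-comm 1 l))
  (trans (range-split i l 1 f) (+-congˡ (range i l f) (ℤₚ.+-identityʳ _)))

range-shift : ∀ i l (f : ℕ → ℤ) → range i l (f ∘ suc) ≡ range (suc i) l f
range-shift i zero    f = refl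
range-shift i (suc l) f = +-congˡ (f (suc i)) (range-shift (suc i) l f)

range-sumL : ∀ i l (xs : List X) (f : ℕ → X → ℤ) →
  range i l (λ j → sumL xs (f j)) ≡ sumL xs (λ x → range i l (λ j → f j x))
range-sumL i zero    xs f = sym (sumL-0 xs λ _ → refl)
range-sumL i (suc l) xs f =
  trans (+-congˡ (sumL xs (f i)) (range-sumL (suc i) l xs f)) (sym (sumL-+ xs (f i) _))

range-const : ∀ i l c → range i l (λ _ → c) ≡ + l * c
range-const i zero    c = refl
range-const i (suc l) c = trans (+-congˡ c (range-const (suc i) l c)) (sym (lem (+ l) c))
  where
  lem : ∀ x c → (1ℤ + x) * c ≡ c + x * c
  lem = solve-∀

range-telescope′ : ∀ i l (f : ℕ → ℤ) → range i l (λ j → f (suc j) - f j) ≡ f (i ℕ.+ l) - f i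
range-telescope′ i l f = begin
  range i l (λ j → f (suc j) - f j)            ≡⟨ range-cong i l (λ j _ _ → lem (f (suc j)) (f j)) ⟩
  range i l (λ j → (- 1ℤ) * (f j - f (suc j))) ≡⟨ range-*ˡ i l (- 1ℤ) (λ j → f j - f (suc j)) ⟩
  (- 1ℤ) * range i l (λ j → f j - f (suc j))   ≡⟨ cong ((- 1ℤ) *_) (range-telescope i l f) ⟩
  (- 1ℤ) * (f i - f (i ℕ.+ l))                 ≡⟨ lem (f (i ℕ.+ l)) (f i) ⟨
  f (i ℕ.+ l) - f i                            ∎
  where
  open ≡-Reasoning
  lem : ∀ x y → x - y ≡ (- 1ℤ) * (y - x)
  lem = solve-∀

sumFin-range : ∀ l (f : ℕ → ℤ) → sumFin l (f ∘ toℕ) ≡ range 0 l f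
sumFin-range zero    f = refl
sumFin-range (suc l) f = +-congˡ (f 0) (trans (sumFin-range l (f ∘ suc)) (range-shift 0 l f))

-- Vectors, linear functionals and linear maps

infixl 6 _⊞_ _⊟_
infixl 7 _·_

_⊞_ _⊟_ : Poly m → Poly m → Poly m
(a ⊞ b) j = a j + b j
(a ⊟ b) j = a j - b j

_·_ : ℤ → Poly m → Poly m
(z · a) j = z * a j

𝟎 : Poly m
𝟎 _ = 0ℤ

⟨_,_⟩ : Poly m → (Fin m → ℤ) → ℤ
⟨_,_⟩ {m} a w = sumFin m (λ i → a i * w i)

⟨⟩-cong : ∀ {a b : Poly m} (w : Fin m → ℤ) → a ≗ b → ⟨ a , w ⟩ ≡ ⟨ b , w ⟩
⟨⟩-cong {m} w eq = sumFin-cong m λ i → cong (_* w i) (eq i)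

⟨⟩-⊞ : ∀ (a b w : Poly m) → ⟨ a ⊞ b , w ⟩ ≡ ⟨ a , w ⟩ + ⟨ b , w ⟩
⟨⟩-⊞ {m} a b w = trans (sumFin-cong m λ i → ℤₚ.*-distribʳ-+ (w i) (a i) (b i)) (sumFin-+ m _ _)

⟨⟩-· : ∀ z (a w : Poly m) → ⟨ z · a , w ⟩ ≡ z * ⟨ a , w ⟩
⟨⟩-· {m} z a w = trans (sumFin-cong m λ i → ℤₚ.*-assoc z (a i) (w i)) (sumFin-*ˡ m z _)

⟨⟩-⊟ : ∀ (a b w : Poly m) → ⟨ a ⊟ b , w ⟩ ≡ ⟨ a , w ⟩ - ⟨ b , w ⟩
⟨⟩-⊟ a b w = begin
  ⟨ a ⊟ b , w ⟩                   ≡⟨ ⟨⟩-cong w (λ i → lem (a i) (b i)) ⟩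
  ⟨ a ⊞ (- 1ℤ) · b , w ⟩          ≡⟨ ⟨⟩-⊞ a _ w ⟩
  ⟨ a , w ⟩ + ⟨ (- 1ℤ) · b , w ⟩  ≡⟨ +-congˡ (⟨ a , w ⟩) (⟨⟩-· (- 1ℤ) b w) ⟩
  ⟨ a , w ⟩ + (- 1ℤ) * ⟨ b , w ⟩  ≡⟨ lem ⟨ a , w ⟩ ⟨ b , w ⟩ ⟨
  ⟨ a , w ⟩ - ⟨ b , w ⟩           ∎
  where
  open ≡-Reasoning
  lem : ∀ x y → x - y ≡ x + (- 1ℤ) * y
  lem = solve-∀

⟨⟩-sumL : ∀ (xs : List X) (f : X → Poly m) w →
  ⟨ (λ j → sumL xs (λ x → f x j)) , w ⟩ ≡ sumL xs (λ x → ⟨ f x , w ⟩)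
⟨⟩-sumL {m = m} []       f w = sumFin-0 m λ i → refl
⟨⟩-sumL         (x ∷ xs) f w = trans (⟨⟩-⊞ (f x) _ w) (+-congˡ (⟨ f x , w ⟩) (⟨⟩-sumL xs f w))

⟨⟩-range : ∀ {m} i l (f : ℕ → Poly m) w → ⟨ (λ j → range i l (λ t → f t j)) , w ⟩ ≡ range i l (λ t → ⟨ f t , w ⟩)
⟨⟩-range {m} i zero    f w = sumFin-0 m λ _ → refl
⟨⟩-range     i (suc l) f w = trans (⟨⟩-⊞ (f i) _ w) (+-congˡ ⟨ f i , w ⟩ (⟨⟩-range (suc i) l f w))

⟨⟩-lc : ∀ (c : Fin l → ℤ) (g : Fin l → Poly m) w → ⟨ lc c g , w ⟩ ≡ sumFin l (λ i → c i * ⟨ g i , w ⟩)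
⟨⟩-lc {l} {m} c g w = begin
  sumFin m (λ j → sumFin l (λ i → c i * g i j) * w j)
    ≡⟨ sumFin-cong m (λ j → trans (ℤₚ.*-comm _ (w j)) (trans (sym (sumFin-*ˡ l (w j) _))
         (sumFin-cong l λ i → lem (w j) (c i) (g i j)))) ⟩
  sumFin m (λ j → sumFin l (λ i → c i * (g i j * w j)))
    ≡⟨ sumFin-swap m l _ ⟩
  sumFin l (λ i → sumFin m (λ j → c i * (g i j * w j)))
    ≡⟨ sumFin-cong l (λ i → sumFin-*ˡ m (c i) _) ⟩
  sumFin l (λ i → c i * ⟨ g i , w ⟩) ∎
  where
  open ≡-Reasoning
  lem : ∀ x y z → x * (y * z) ≡ y * (z * x)
  lem = solve-∀

lc-cong : ∀ {c c′ : Fin l → ℤ} (g : Fin l → Poly m) → c ≗ c′ → lc c g ≗ lc c′ g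
lc-cong g eq j = ⟨⟩-cong (λ i → g i j) eq

lc-congʳ : ∀ (c : Fin l → ℤ) {g h : Fin l → Poly m} → (∀ i → g i ≗ h i) → lc c g ≗ lc c h
lc-congʳ {l} c eq j = sumFin-cong l λ i → cong (c i *_) (eq i j)

lc-· : ∀ z (c : Fin l → ℤ) (g : Fin l → Poly m) → lc (z · c) g ≗ z · lc c g
lc-· z c g j = ⟨⟩-· z c (λ i → g i j)

lc-⊟ : ∀ (c c′ : Fin l → ℤ) (g : Fin l → Poly m) → lc (c ⊟ c′) g ≗ lc c g ⊟ lc c′ g
lc-⊟ c c′ g j = ⟨⟩-⊟ c c′ (λ i → g i j)

lc-lc : ∀ {p} (c : Fin l → ℤ) (g : Fin l → Poly m) (h : Fin m → Poly p) →
  lc (lc c g) h ≗ lc c (λ i → lc (g i) h)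
lc-lc c g h j = ⟨⟩-lc c g (λ i → h i j)

-- Congruence modulo the span of a family

module Span {m l} (G : Fin l → Poly m) where

  infix 4 _≈_

  -- A record, so that `a` and `b` can be inferred from the type; the span condition alone only
  -- exposes their difference.
  record _≈_ (a b : Poly m) : Set where
    constructor mk
    field span : InSpan G (a ⊟ b)

  open _≈_ public

  ≗⇒≈ : ∀ {a b} → a ≗ b → a ≈ b
  ≗⇒≈ {a} {b} eq = mk (𝟎 , λ j → trans (trans (cong (_- b j) (eq j)) (ℤₚ.+-inverseʳ (b j)))
                                         (sym (sumFin-0 l λ i → refl)))

  ≈-refl : ∀ {a} → a ≈ a
  ≈-refl = ≗⇒≈ λ _ → refl

  InSpan-· : ∀ z {a} → InSpan G a → InSpan G (z · a)
  InSpan-· z (c , eq) = z · c , λ j → trans (cong (z *_) (eq j)) (sym (lc-· z c G j))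

  ·-cong : ∀ z {a b} → a ≈ b → z · a ≈ z · b
  ·-cong z {a} {b} (mk s) = mk (InSpan-resp (λ j → lem z (a j) (b j)) (InSpan-· z s))
    where
    lem : ∀ z x y → z * (x - y) ≡ z * x - z * y
    lem = solve-∀

  ⊞-cong : ∀ {a b a′ b′} → a ≈ b → a′ ≈ b′ → a ⊞ a′ ≈ b ⊞ b′
  ⊞-cong {a} {b} {a′} {b′} (mk s) (mk t) =
    mk (InSpan-resp (λ j → lem (a j) (b j) (a′ j) (b′ j)) (InSpan-+ s t))
    where
    lem : ∀ x y x′ y′ → (x - y) + (x′ - y′) ≡ (x + x′) - (y + y′)
    lem = solve-∀

  ≈-sym : ∀ {a b} → a ≈ b → b ≈ a
  ≈-sym {a} {b} (mk s) = mk (InSpan-resp (λ j → lem (a j) (b j)) (InSpan-· (- 1ℤ) s))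
    where
    lem : ∀ x y → (- 1ℤ) * (x - y) ≡ y - x
    lem = solve-∀

  ≈-trans : ∀ {a b c} → a ≈ b → b ≈ c → a ≈ c
  ≈-trans {a} {b} {c} (mk s) (mk t) = mk (InSpan-resp (λ j → lem (a j) (b j) (c j)) (InSpan-+ s t))
    where
    lem : ∀ x y z → (x - y) + (y - z) ≡ x - z
    lem = solve-∀

  ⊟-cong : ∀ {a b a′ b′} → a ≈ b → a′ ≈ b′ → a ⊟ a′ ≈ b ⊟ b′
  ⊟-cong {a} {b} {a′} {b′} p q =
    ≈-trans (≗⇒≈ λ j → lem (a j) (a′ j))
      (≈-trans (⊞-cong p (·-cong (- 1ℤ) q)) (≗⇒≈ λ j → sym (lem (b j) (b′ j))))
    where
    lem : ∀ x y → x - y ≡ x + (- 1ℤ) * y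
    lem = solve-∀

  setoid : Setoid _ _
  setoid = record { Carrier = Poly m ; _≈_ = _≈_
                  ; isEquivalence = record { refl = ≈-refl ; sym = ≈-sym ; trans = ≈-trans } }

  sumL-≈ : ∀ (xs : List X) {f g : X → Poly m} → (∀ {x} → x ∈ xs → f x ≈ g x) →
           (λ j → sumL xs (λ x → f x j)) ≈ (λ j → sumL xs (λ x → g x j))
  sumL-≈ []       eq = ≈-refl
  sumL-≈ (x ∷ xs) eq = ⊞-cong (eq (here refl)) (sumL-≈ xs (eq ∘ there))

  range-≈ : ∀ i l {f h : ℕ → Poly m} → (∀ j → f j ≈ h j) →
            (λ t → range i l (λ j → f j t)) ≈ (λ t → range i l (λ j → h j t))
  range-≈ i zero    eq = ≈-refl
  range-≈ i (suc l) eq = ⊞-cong (eq i) (range-≈ (suc i) l eq)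

  lc-≈ : ∀ {p} (c : Fin p → ℤ) {g h : Fin p → Poly m} → (∀ i → g i ≈ h i) → lc c g ≈ lc c h
  lc-≈ {zero}  c eq = ≈-refl
  lc-≈ {suc p} c eq = ⊞-cong (·-cong (c zero) (eq zero)) (lc-≈ (c ∘ suc) (eq ∘ suc))

  -- A functional that is divisible by `z` on the generators descends to the quotient with values in
  -- ℤ/z. Both the functionals `π̂` and the map `θ` descend in this way.
  ⟨⟩-≈ : ∀ {z} w → (∀ i → z ∣ ⟨ G i , w ⟩) → ∀ {a b} → a ≈ b → z ∣ ⟨ a , w ⟩ - ⟨ b , w ⟩
  ⟨⟩-≈ {z} w h {a} {b} (mk (c , eq)) =
    subst (z ∣_) (trans (sym (trans (⟨⟩-cong w eq) (⟨⟩-lc c G w))) (⟨⟩-⊟ a b w))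
      (∣-sumFin l λ i → ∣n⇒∣m*n (c i) (h i))

  ≈𝟎⇒InSpan : ∀ {a} → a ≈ 𝟎 → InSpan G a
  ≈𝟎⇒InSpan (mk s) = InSpan-resp (λ j → ℤₚ.+-identityʳ _) s

  InSpan⇒≈𝟎 : ∀ {a} → InSpan G a → a ≈ 𝟎
  InSpan⇒≈𝟎 s = mk (InSpan-resp (λ j → sym (ℤₚ.+-identityʳ _)) s)

-- Congruences of natural numbers and Bézout's identity

*-distribˡ-minus : ∀ x y z → x * (y - z) ≡ x * y - x * z
*-distribˡ-minus = solve-∀

infix 4 _≡_[mod_]

record _≡_[mod_] (u v M : ℕ) : Set where
  constructor mod
  field diff : + M ∣ + u - + v

open _≡_[mod_] public

module _ {M : ℕ} where

  mod-refl : ∀ {u} → u ≡ u [mod M ]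
  mod-refl {u} = mod (divides 0ℤ (ℤₚ.+-inverseʳ (+ u)))

  mod-reflexive : ∀ {u v} → u ≡ v → u ≡ v [mod M ]
  mod-reflexive refl = mod-refl

  mod-sym : ∀ {u v} → u ≡ v [mod M ] → v ≡ u [mod M ]
  mod-sym {u} {v} (mod p) = mod (subst (+ M ∣_) (lem (+ u) (+ v)) (∣m⇒∣-m p))
    where
    lem : ∀ x y → - (x - y) ≡ y - x
    lem = solve-∀

  mod-trans : ∀ {u v w} → u ≡ v [mod M ] → v ≡ w [mod M ] → u ≡ w [mod M ]
  mod-trans {u} {v} {w} (mod p) (mod q) =
    mod (subst (+ M ∣_) (lem (+ u) (+ v) (+ w)) (∣m∣n⇒∣m+n p q))
    where
    lem : ∀ x y z → (x - y) + (y - z) ≡ x - z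
    lem = solve-∀

  mod-* : ∀ z {u v} → u ≡ v [mod M ] → z ℕ.* u ≡ z ℕ.* v [mod M ]
  mod-* z {u} {v} (mod p) = mod (subst (+ M ∣_)
    (trans (*-distribˡ-minus (+ z) (+ u) (+ v)) (sym (cong₂ _-_ (ℤₚ.pos-* z u) (ℤₚ.pos-* z v))))
    (∣n⇒∣m*n (+ z) p))

  module _ .{{_ : NonZero M}} where

    mod-% : ∀ u → u % M ≡ u [mod M ]
    mod-% u = mod (divides (- + (u ℕ./ M)) (trans
      (cong (λ t → + (u % M) - t) (trans (cong +_ (ℕ%.m≡m%n+[m/n]*n u M)) (trans (ℤₚ.pos-+ (u % M) _)
        (+-congˡ (+ (u % M)) (ℤₚ.pos-* (u ℕ./ M) M)))))
      (lem (+ (u % M)) (+ (u ℕ./ M)) (+ M))))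
      where
      lem : ∀ x q m → x - (x + q * m) ≡ (- q) * m
      lem = solve-∀

    mod⇒≡ : ∀ {u v} → u ≡ v [mod M ] → u < M → v < M → u ≡ v
    mod⇒≡ {u} {v} (mod p) u< v< =
      ℤₚ.+-injective (ℤₚ.i-j≡0⇒i≡j (+ u) (+ v) (ℤₚ.∣i∣≡0⇒i≡0 (small (∣⇒∣ᵤ p) bound)))
      where
      small : ∀ {x} → M ℕᵈ.∣ x → x < M → x ≡ 0
      small {zero}  _ _ = refl
      small {suc x} q r = contradiction (ℕᵈ.∣⇒≤ q) (ℕₚ.<⇒≱ r)
      bound : ∣ + u - + v ∣ < M
      bound = ℕₚ.≤-<-trans (ℕₚ.≤-reflexive (cong ∣_∣ (ℤₚ.m-n≡m⊖n u v)))
                (ℕₚ.≤-<-trans (ℤₚ.∣m⊝n∣≤m⊔n u v) (ℕₚ.⊔-lub u< v<))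

    mod⇒%≡ : ∀ {u v} → u ≡ v [mod M ] → u % M ≡ v % M
    mod⇒%≡ {u} {v} p = mod⇒≡ (mod-trans (mod-% u) (mod-trans p (mod-sym (mod-% v))))
                         (ℕ%.m%n<n u M) (ℕ%.m%n<n v M)

    %≡⇒mod : ∀ {u v} → u % M ≡ v % M → u ≡ v [mod M ]
    %≡⇒mod {u} {v} p = mod-trans (mod-sym (mod-% u)) (subst (λ t → t ≡ v [mod M ]) (sym p) (mod-% v))

mod-+ : ∀ {M u v} t → u ≡ v [mod M ] → u ℕ.+ t ≡ v ℕ.+ t [mod M ]
mod-+ {M} {u} {v} t (mod p) = mod (subst (+ M ∣_) (sym
  (trans (cong₂ _-_ (ℤₚ.pos-+ u t) (ℤₚ.pos-+ v t)) (lem (+ u) (+ v) (+ t)))) p)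
  where
  lem : ∀ x y z → (x + z) - (y + z) ≡ x - y
  lem = solve-∀

mod-∣ : ∀ {M M′ u v} → M′ ℕᵈ.∣ M → u ≡ v [mod M ] → u ≡ v [mod M′ ]
mod-∣ M′∣M (mod p) = mod (∣-trans (∣ᵤ⇒∣ M′∣M) p)

∣-mod : ∀ {M t u v} → t ℕᵈ.∣ M → u ≡ v [mod M ] → t ℕᵈ.∣ u → t ℕᵈ.∣ v
∣-mod {u = u} {v} t∣M p t∣u =
  ∣⇒∣ᵤ (subst (_ ∣_) (lem (+ u) (+ v)) (∣m∣n⇒∣m-n (∣ᵤ⇒∣ {i = + u} t∣u) (diff (mod-∣ t∣M p))))
  where
  lem : ∀ x y → x - (x - y) ≡ y
  lem = solve-∀

bézout : ∀ m n → ∃₂ λ x y → + gcd m n ≡ x * + m + y * + n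
bézout m n with Bézout.identity (gcd-GCD m n)
... | Bézout.+- x y eq = + x , - + y , (begin
    + gcd m n                                          ≡⟨ lem (+ gcd m n) (+ y) (+ n) ⟩
    (+ gcd m n + + y * + n) - + y * + n                ≡⟨ cong (λ t → t - + y * + n) eqn ⟩
    + x * + m - + y * + n                              ≡⟨ lem′ (+ x * + m) (+ y) (+ n) ⟩
    + x * + m + (- + y) * + n                          ∎)
  where
  open ≡-Reasoning
  eqn : + gcd m n + + y * + n ≡ + x * + m
  eqn = trans (trans (+-congˡ (+ gcd m n) (sym (ℤₚ.pos-* y n))) (sym (ℤₚ.pos-+ (gcd m n) (y ℕ.* n))))
    (trans (cong +_ eq) (ℤₚ.pos-* x m))
  lem : ∀ g y n → g ≡ (g + y * n) - y * n
  lem = solve-∀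
  lem′ : ∀ a y n → a - y * n ≡ a + (- y) * n
  lem′ = solve-∀
... | Bézout.-+ x y eq = - + x , + y , (begin
    + gcd m n                                          ≡⟨ lem (+ gcd m n) (+ x) (+ m) ⟩
    (- + x) * + m + (+ gcd m n + + x * + m)            ≡⟨ +-congˡ ((- + x) * + m) eqn ⟩
    (- + x) * + m + + y * + n                          ∎)
  where
  open ≡-Reasoning
  eqn : + gcd m n + + x * + m ≡ + y * + n
  eqn = trans (trans (+-congˡ (+ gcd m n) (sym (ℤₚ.pos-* x m))) (sym (ℤₚ.pos-+ (gcd m n) (x ℕ.* m))))
    (trans (cong +_ eq) (ℤₚ.pos-* y n))
  lem : ∀ g x m → g ≡ (- x) * m + (g + x * m)
  lem = solve-∀

safeDiv-exact : ∀ {m g} .{{_ : NonZero g}} → g ℕᵈ.∣ m → m ≡ safeDiv m g ℕ.* g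
safeDiv-exact {m} {suc g} g∣m = sym (ℕ%.m/n*n≡m g∣m)

pos-^ : ∀ b i → + (b ^ suc i) ≡ + b * + (b ^ i)
pos-^ b i = ℤₚ.pos-* b (b ^ i)

pos-^-+ : ∀ b i j → + (b ^ (i ℕ.+ j)) ≡ + (b ^ i) * + (b ^ j)
pos-^-+ b i j = trans (cong +_ (ℕₚ.^-distribˡ-+-* b i j)) (ℤₚ.pos-* (b ^ i) (b ^ j))

^-∣-^ : ∀ b {i j} → i ≤ j → + (b ^ i) ∣ + (b ^ j)
^-∣-^ b {i} {j} i≤j = divides (+ (b ^ (j ∸ i)))
  (trans (cong (λ t → + (b ^ t)) (sym (ℕₚ.m∸n+n≡m i≤j))) (pos-^-+ b (j ∸ i) i))

pos-*-minus : ∀ c u v → + c * (+ u - + v) ≡ + (c ℕ.* u) - + (c ℕ.* v)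
pos-*-minus c u v = trans (*-distribˡ-minus (+ c) (+ u) (+ v)) (sym (cong₂ _-_ (ℤₚ.pos-* c u) (ℤₚ.pos-* c v)))

-- For the remaining u < N i with g i ∤ u, namely u < N (i + 1) with g (i + 1) ∤ u, the lifts L i u and L (i + 1) u
-- below are both E u.
record Head (N g : ℕ → ℕ) (i u : ℕ) : Set where
  field
    <N   : u < N i
    g∤   : ¬ g i ℕᵈ.∣ u
    fork : N (suc i) ≤ u ⊎ g (suc i) ℕᵈ.∣ u

-- Arithmetic of the d-sequence

module DSequence (n d : ℕ) .{{n≢0 : NonZero n}} .{{d≢0 : NonZero d}} (N g : ℕ → ℕ)
  (N-zero : N 0 ≡ n) (g-gcd : ∀ i → g i ≡ gcd (N i) d) (N-step : ∀ i → N i ≡ N (suc i) ℕ.* g i) where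

  instance
    g≢0 : ∀ {i} → NonZero (g i)
    g≢0 {i} = ℕ.≢-nonZero λ g≡0 → ℕ.≢-nonZero⁻¹ d (gcd[m,n]≡0⇒n≡0 (N i) (trans (sym (g-gcd i)) g≡0))

    N≢0 : ∀ {i} → NonZero (N i)
    N≢0 {zero}  = ℕ.≢-nonZero λ eq → ℕ.≢-nonZero⁻¹ n (trans (sym N-zero) eq)
    N≢0 {suc i} = ℕ.≢-nonZero λ eq →
      ℕ.≢-nonZero⁻¹ (N i) {{N≢0 {i}}} (trans (N-step i) (cong (ℕ._* g i) eq))

  g∣d : ∀ i → g i ℕᵈ.∣ d
  g∣d i = subst (ℕᵈ._∣ d) (sym (g-gcd i)) (gcd[m,n]∣n (N i) d)

  g∣N : ∀ i → g i ℕᵈ.∣ N i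
  g∣N i = ℕᵈ.divides (N (suc i)) (N-step i)

  N-∣-suc : ∀ i → N (suc i) ℕᵈ.∣ N i
  N-∣-suc i = ℕᵈ.divides (g i) (trans (N-step i) (ℕₚ.*-comm (N (suc i)) (g i)))

  N-∣ : ∀ {i j} → i ≤ j → N j ℕᵈ.∣ N i
  N-∣ {j = zero}  z≤n = ℕᵈ.∣-refl
  N-∣ {i} {suc j} i≤sj with i ℕ.≟ suc j
  ... | yes refl = ℕᵈ.∣-refl
  ... | no i≢ = ℕᵈ.∣-trans (N-∣-suc j) (N-∣ (ℕₚ.≤-pred (ℕₚ.≤∧≢⇒< i≤sj i≢)))

  g-∣ : ∀ {i j} → i ≤ j → g j ℕᵈ.∣ g i
  g-∣ {i} {j} i≤j = subst (g j ℕᵈ.∣_) (sym (g-gcd i)) (gcd-greatest (ℕᵈ.∣-trans (g∣N j) (N-∣ i≤j)) (g∣d j))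

  +N-step : ∀ i → + N i ≡ + N (suc i) * + g i
  +N-step i = trans (cong +_ (N-step i)) (ℤₚ.pos-* (N (suc i)) (g i))

  g-bézout : ∀ i → ∃₂ λ x y → + g i ≡ x * + N i + y * + d
  g-bézout i with x , y , eq ← bézout (N i) d = x , y , trans (cong +_ (g-gcd i)) eq

  -- Bézout writes `g i` through `N i` and `d`, so `N i` divides `z * g i`, and `g i` cancels from
  -- `N i = N (i + 1) * g i`. With the converse below, multiplication by `d` embeds ℤ/N (i + 1) into
  -- ℤ/N i.
  N∣d*⇒ : ∀ i z → + N i ∣ + d * z → + N (suc i) ∣ z
  N∣d*⇒ i z N∣dz with g-bézout i
  ... | x , y , eq = *-cancelʳ-∣ (+ g i) (subst₂ _∣_ (+N-step i)
      (trans (lem x y z (+ N i) (+ d)) (cong (z *_) (sym eq)))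
      (∣m∣n⇒∣m+n (∣n⇒∣m*n (x * z) ∣-refl) (∣n⇒∣m*n y N∣dz)))
    where
    lem : ∀ x y z a b → (x * z) * a + y * (b * z) ≡ z * (x * a + y * b)
    lem = solve-∀

  ⇒N∣d* : ∀ i z → + N (suc i) ∣ z → + N i ∣ + d * z
  ⇒N∣d* i z N∣z with g∣d i
  ... | ℕᵈ.divides q eq = subst₂ _∣_ (trans (ℤₚ.*-comm (+ g i) (+ N (suc i))) (sym (+N-step i)))
      (trans (lem (+ q) (+ g i) z) (cong (_* z) (trans (sym (ℤₚ.pos-* q (g i))) (cong +_ (sym eq)))))
      (∣n⇒∣m*n (+ q) (*-monoʳ-∣ (+ g i) N∣z))
    where
    lem : ∀ q g z → q * (g * z) ≡ (q * g) * z
    lem = solve-∀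

  n∣d^*⇒ : ∀ i z → + n ∣ + (d ^ i) * z → + N i ∣ z
  n∣d^*⇒ zero    z h = subst₂ _∣_ (cong +_ (sym N-zero)) (ℤₚ.*-identityˡ z) h
  n∣d^*⇒ (suc i) z h = N∣d*⇒ i z (n∣d^*⇒ i (+ d * z) (subst (+ n ∣_)
    (trans (cong (_* z) (pos-^ d i)) (lem (+ d) (+ (d ^ i)) z)) h))
    where
    lem : ∀ a b z → a * b * z ≡ b * (a * z)
    lem = solve-∀

  ⇒n∣d^* : ∀ i z → + N i ∣ z → + n ∣ + (d ^ i) * z
  ⇒n∣d^* zero    z h = subst₂ _∣_ (cong +_ N-zero) (sym (ℤₚ.*-identityˡ z)) h
  ⇒n∣d^* (suc i) z h = subst (+ n ∣_)
    (sym (trans (cong (_* z) (pos-^ d i)) (lem (+ d) (+ (d ^ i)) z))) (⇒n∣d^* i (+ d * z) (⇒N∣d* i z h))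
    where
    lem : ∀ a b z → a * b * z ≡ b * (a * z)
    lem = solve-∀

  -- Uniqueness of the quotient found by `÷d`; it makes everything computed along a descent
  -- independent of the chosen quotients.
  *-mod⁻¹ : ∀ i {u v} → d ℕ.* u ≡ d ℕ.* v [mod N i ] → u ≡ v [mod N (suc i) ]
  *-mod⁻¹ i {u} {v} (mod p) = mod (N∣d*⇒ i _ (subst (+ N i ∣_) (sym (pos-*-minus d u v)) p))

  ^*-mod : ∀ i {u v} → u ≡ v [mod N i ] → d ^ i ℕ.* u ≡ d ^ i ℕ.* v [mod n ]
  ^*-mod i {u} {v} (mod p) = mod (subst (+ n ∣_) (pos-*-minus (d ^ i) u v) (⇒n∣d^* i _ p))

  abstract

    ÷d : ∀ i u → g i ℕᵈ.∣ u → ∃ λ v → d ℕ.* v ≡ u [mod N i ]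
    ÷d i u (ℕᵈ.divides q eq) with g-bézout i
    ... | x , y , eqn = v , mod (subst (+ N i ∣_) eq₂ (∣n⇒∣m*n w ∣-refl))
      where
      -- With `u = q * g i` and `g i = x * N i + y * d`, the quotient is `y * q`; it is reduced
      -- modulo `N i` because `y` may be negative.
      v : ℕ
      v = (y * + q) %ℕ N i
      r : ℤ
      r = (y * + q) /ℕ N i
      w : ℤ
      w = - (+ d * r + + q * x)
      lem : ∀ w d r q x y a v g → v ≡ y * q - r * a → g ≡ x * a + y * d →
        w ≡ - (d * r + q * x) → w * a ≡ d * v - q * g
      lem _ d r q x y a _ _ refl refl refl = lem′ d r q x y a
        where
        lem′ : ∀ d r q x y a → (- (d * r + q * x)) * a ≡ d * (y * q - r * a) - q * (x * a + y * d)
        lem′ = solve-∀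
      eq₁ : + v ≡ y * + q - r * + N i
      eq₁ = trans (lem₁ (+ v) (r * + N i)) (cong (_- r * + N i) (sym (a≡a%ℕn+[a/ℕn]*n (y * + q) (N i))))
        where
        lem₁ : ∀ a b → a ≡ a + b - b
        lem₁ = solve-∀
      eq₂ : w * + N i ≡ + (d ℕ.* v) - + u
      eq₂ = trans (lem w (+ d) r (+ q) x y (+ N i) (+ v) (+ g i) eq₁ eqn refl)
        (sym (cong₂ _-_ (ℤₚ.pos-* d v) (trans (cong +_ eq) (ℤₚ.pos-* q (g i)))))

  N-stable : ∀ {k} → g k ≡ 1 → ∀ {i} → k ≤ i → N i ≡ N k
  N-stable {k} gk≡1 {zero} z≤n = refl
  N-stable {k} gk≡1 {suc i} k≤si with k ℕ.≟ suc i
  ... | yes refl = refl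
  ... | no k≢ = trans (trans (sym (ℕₚ.*-identityʳ _)) (trans (cong (N (suc i) ℕ.*_) (sym g≡1)) (sym (N-step i))))
                  (N-stable gk≡1 k≤i)
    where
    k≤i = ℕₚ.≤-pred (ℕₚ.≤∧≢⇒< k≤si k≢)
    g≡1 : g i ≡ 1
    g≡1 = ℕᵈ.∣1⇒≡1 (subst (g i ℕᵈ.∣_) gk≡1 (g-∣ k≤i))

  abstract

    -- Two powers of `d` agree modulo `n`; if `p` is the difference of their exponents, then `d ^ p`
    -- is 1 modulo `N k`, and `d ^ (k + l * p)` agrees with `d ^ k` modulo `n` for all `l`. The
    -- choice `l = k` makes `l * p` at least `k`, which leaves room for `R = k * (p - 1)`.
    period : ∀ {k} → g k ≡ 1 → ∃ λ R → d ^ (k ℕ.+ (k ℕ.+ R)) ≡ d ^ k [mod n ]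
    period {k} gk≡1 with pigeonhole {n} {suc n} ℕₚ.≤-refl (λ i → fromℕ< (ℕ%.m%n<n (d ^ toℕ i) n))
    ... | i , j , i<j , eq = k ℕ.* (p ∸ 1) , subst (λ t → d ^ (k ℕ.+ t) ≡ d ^ k [mod n ]) k*p≡ (powers k)
      where
      p : ℕ
      p = toℕ j ∸ toℕ i
      instance
        p≢0 : NonZero p
        p≢0 = ℕ.>-nonZero (ℕₚ.m<n⇒0<n∸m i<j)
      k*p≡ : k ℕ.* p ≡ k ℕ.+ k ℕ.* (p ∸ 1)
      k*p≡ = trans (cong (k ℕ.*_) (sym (ℕₚ.suc-pred p))) (ℕₚ.*-suc k (ℕ.pred p))
      %≡ : d ^ toℕ i % n ≡ d ^ toℕ j % n
      %≡ = trans (sym (toℕ-fromℕ< _)) (trans (cong toℕ eq) (toℕ-fromℕ< _))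
      d^p-1 : + N k ∣ + (d ^ p) - 1ℤ
      d^p-1 = N∣ (n∣d^*⇒ (toℕ i) _ (subst (+ n ∣_) eqn (diff (mod-sym (%≡⇒mod %≡)))))
        where
        eqn : + (d ^ toℕ j) - + (d ^ toℕ i) ≡ + (d ^ toℕ i) * (+ (d ^ p) - 1ℤ)
        eqn = trans (cong (λ t → + (d ^ t) - + (d ^ toℕ i)) (sym (ℕₚ.m+[n∸m]≡n (ℕₚ.<⇒≤ i<j))))
              (trans (cong (_- + (d ^ toℕ i)) (pos-^-+ d (toℕ i) p)) (lem (+ (d ^ toℕ i)) (+ (d ^ p))))
          where
          lem : ∀ a b → a * b - a ≡ a * (b - 1ℤ)
          lem = solve-∀
        -- The coincidence of powers may occur before or after level `k`; in the second case the
        -- sequence `N` is already constant.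
        N∣ : ∀ {z} → + N (toℕ i) ∣ z → + N k ∣ z
        N∣ {z} h with ℕₚ.≤-total k (toℕ i)
        ... | inj₁ k≤i = subst (λ t → + t ∣ z) (N-stable gk≡1 k≤i) h
        ... | inj₂ i≤k = ∣-trans (∣ᵤ⇒∣ (N-∣ i≤k)) h
      powers : ∀ l → d ^ (k ℕ.+ l ℕ.* p) ≡ d ^ k [mod n ]
      powers l = mod (subst (+ n ∣_) eqn (⇒n∣d^* k _ (pow l)))
        where
        eqn : + (d ^ k) * (+ (d ^ (l ℕ.* p)) - 1ℤ) ≡ + (d ^ (k ℕ.+ l ℕ.* p)) - + (d ^ k)
        eqn = trans (lem (+ (d ^ k)) _) (cong (_- + (d ^ k)) (sym (pos-^-+ d k (l ℕ.* p))))
          where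
          lem : ∀ a b → a * (b - 1ℤ) ≡ a * b - a
          lem = solve-∀
        pow : ∀ l → + N k ∣ + (d ^ (l ℕ.* p)) - 1ℤ
        pow zero    = divides 0ℤ refl
        pow (suc l) = subst (+ N k ∣_) (trans (lem (+ (d ^ p)) (+ (d ^ (l ℕ.* p))))
          (cong (_- 1ℤ) (sym (pos-^-+ d p (l ℕ.* p)))))
                        (∣m∣n⇒∣m+n (∣n⇒∣m*n (+ (d ^ p)) (pow l)) d^p-1)
          where
          lem : ∀ a b → a * (b - 1ℤ) + (a - 1ℤ) ≡ a * b - 1ℤ
          lem = solve-∀

-- Indicators and case distinctions

𝟙 : ∀ {P : Set} → Dec P → ℤ
𝟙 P? = if does P? then 1ℤ else 0ℤ

𝟙-yes : ∀ {P : Set} (P? : Dec P) → P → 𝟙 P? ≡ 1ℤ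
𝟙-yes (yes _) p = refl
𝟙-yes (no ¬p) p = contradiction p ¬p

𝟙-no : ∀ {P : Set} (P? : Dec P) → ¬ P → 𝟙 P? ≡ 0ℤ
𝟙-no (yes p) ¬p = contradiction p ¬p
𝟙-no (no _)  ¬p = refl

choose : ∀ {A P : Set} → Dec P → A → A → A
choose (yes _) a b = a
choose (no _)  a b = b

choose-yes : ∀ {A P : Set} (P? : Dec P) {a b : A} → P → choose P? a b ≡ a
choose-yes (yes _) p = refl
choose-yes (no ¬p) p = contradiction p ¬p

choose-no : ∀ {A P : Set} (P? : Dec P) {a b : A} → ¬ P → choose P? a b ≡ b
choose-no (yes p) ¬p = contradiction p ¬p
choose-no (no _)  ¬p = refl

module _ {m l} (G : Fin l → Poly m) where

  open Span G

  generator≈𝟎 : ∀ i → G i ≈ 𝟎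
  generator≈𝟎 i = InSpan⇒≈𝟎 ((λ j → 𝟙 (j Fin.≟ i)) , λ t → sym (trans
    (sumFin-single l i λ j j≢i → cong (_* G j t) (𝟙-no (j Fin.≟ i) j≢i))
    (trans (cong (_* G i t) (𝟙-yes (i Fin.≟ i) refl)) (ℤₚ.*-identityˡ (G i t)))))

-- Coordinates with respect to e₁, …, eₘ, where n = suc m

module Basis (m : ℕ) where

  -- The element e_v for arbitrary `v`, with exponents modulo `n`; multiples of `n` give zero
  -- because e_0 = 0.
  E : ℕ → Poly m
  E v i = 𝟙 (suc (toℕ i) ℕ.≟ v % suc m)

  E-cong : ∀ {u v} → u ≡ v [mod suc m ] → E u ≗ E v
  E-cong p i = cong (λ t → 𝟙 (suc (toℕ i) ℕ.≟ t)) (mod⇒%≡ p)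

  E-zero : E 0 ≗ 𝟎
  E-zero i = 𝟙-no (suc (toℕ i) ℕ.≟ 0 % suc m) λ ()

  residue : ∀ v → v ≡ 0 [mod suc m ] ⊎ ∃ λ (i : Fin m) → v ≡ suc (toℕ i) [mod suc m ]
  residue v with v % suc m in eq | ℕ%.m%n<n v (suc m)
  ... | zero  | _       = inj₁ (subst (v ≡_[mod suc m ]) eq (mod-sym (mod-% v)))
  ... | suc t | s≤s t<m = inj₂ (fromℕ< t<m , subst (v ≡_[mod suc m ])
                            (trans eq (cong suc (sym (toℕ-fromℕ< t<m)))) (mod-sym (mod-% v)))

  E-toℕ : ∀ (i j : Fin m) → j ≢ i → E (suc (toℕ i)) j ≡ 0ℤ
  E-toℕ i j j≢i = 𝟙-no (suc (toℕ j) ℕ.≟ suc (toℕ i) % suc m) λ eq →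
    j≢i (toℕ-injective (ℕₚ.suc-injective (trans eq (ℕ%.m<n⇒m%n≡m (s≤s (toℕ<n i))))))

  E-diag : ∀ (i : Fin m) → E (suc (toℕ i)) i ≡ 1ℤ
  E-diag i = 𝟙-yes (suc (toℕ i) ℕ.≟ suc (toℕ i) % suc m) (sym (ℕ%.m<n⇒m%n≡m (s≤s (toℕ<n i))))

  -- These are the conditions under which the linear functional with values `f 1`, ..., `f m` on the
  -- basis takes the value `f v` at `E v` for every `v`.
  record Periodic (f : ℕ → ℤ) : Set where
    field
      at-0     : f 0 ≡ 0ℤ
      periodic : ∀ {u v} → u ≡ v [mod suc m ] → f u ≡ f v

  open Periodic public

  on-basis : (ℕ → ℤ) → Fin m → ℤ
  on-basis f i = f (suc (toℕ i))

  ⟨E⟩ : ∀ {f} → Periodic f → ∀ v → ⟨ E v , on-basis f ⟩ ≡ f v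
  ⟨E⟩ {f} P v with residue v
  ... | inj₁ v≡0 = trans (sumFin-0 m λ i → cong (_* f (suc (toℕ i))) (trans (E-cong v≡0 i) (E-zero i)))
                     (sym (trans (periodic P v≡0) (at-0 P)))
  ... | inj₂ (i , v≡i) = begin
      ⟨ E v , on-basis f ⟩                 ≡⟨ ⟨⟩-cong (on-basis f) (E-cong v≡i) ⟩
      ⟨ E (suc (toℕ i)) , on-basis f ⟩
        ≡⟨ sumFin-single m i (λ j j≢i → cong (_* f (suc (toℕ j))) (E-toℕ i j j≢i)) ⟩
      E (suc (toℕ i)) i * f (suc (toℕ i))  ≡⟨ cong (_* f (suc (toℕ i))) (E-diag i) ⟩
      1ℤ * f (suc (toℕ i))                 ≡⟨ ℤₚ.*-identityˡ _ ⟩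
      f (suc (toℕ i))                      ≡⟨ periodic P v≡i ⟨
      f v                                  ∎
    where open ≡-Reasoning

  E-expand : ∀ a → lc a (λ i → E (suc (toℕ i))) ≗ a
  E-expand a j = begin
    sumFin m (λ i → a i * E (suc (toℕ i)) j)  ≡⟨ sumFin-single m j (λ i i≢j →
         trans (cong (a i *_) (E-toℕ i j (i≢j ∘ sym))) (ℤₚ.*-zeroʳ (a i))) ⟩
    a j * E (suc (toℕ j)) j                   ≡⟨ cong (a j *_) (E-diag j) ⟩
    a j * 1ℤ                                  ≡⟨ ℤₚ.*-identityʳ (a j) ⟩
    a j                                       ∎
    where open ≡-Reasoning

  extend : ∀ {p} → (ℕ → Poly p) → Poly m → Poly p
  extend h a = lc a (λ i → h (suc (toℕ i)))

  extend-E : ∀ {p} {h : ℕ → Poly p} → (∀ j → Periodic (λ v → h v j)) → ∀ v → extend h (E v) ≗ h v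
  extend-E P v j = ⟨E⟩ (P j) v

_≟×_ : (x y : ℕ × ℕ) → Dec (x ≡ y)
_≟×_ = ≡-dec ℕ._≟_ ℕ._≟_

-- The remaining terms are selected by an indicator instead of deleting `y`, so that all sums keep
-- the same index list.
sumL-extract : ∀ {I : List (ℕ × ℕ)} {y} → Unique I → y ∈ I → (f : ℕ × ℕ → ℤ) →
  sumL I f ≡ f y + sumL I (λ x → 𝟙 (¬? (x ≟× y)) * f x)
sumL-extract {I} {y} u y∈ f = trans (sumL-cong I λ {x} _ → split x)
  (trans (sumL-+ I (λ x → 𝟙 (x ≟× y) * f x) _) (cong (λ t → t + sumL I (λ x → 𝟙 (¬? (x ≟× y)) * f x))
    (trans (sumL-single u y∈ _ λ {x} _ x≢y → cong (_* f x) (𝟙-no (x ≟× y) x≢y))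
      (trans (cong (_* f y) (𝟙-yes (y ≟× y) refl)) (ℤₚ.*-identityˡ (f y))))))
  where
  split : ∀ x → f x ≡ 𝟙 (x ≟× y) * f x + 𝟙 (¬? (x ≟× y)) * f x
  split x with x ≟× y
  ... | yes _ = sym (trans (ℤₚ.+-identityʳ (1ℤ * f x)) (ℤₚ.*-identityˡ (f x)))
  ... | no  _ = sym (trans (ℤₚ.+-identityˡ (1ℤ * f x)) (ℤₚ.*-identityˡ (f x)))

-- Descents: repeated division by d

module Descent (n d : ℕ) .{{n≢0 : NonZero n}} .{{d≢0 : NonZero d}} (N g : ℕ → ℕ)
  (N-zero : N 0 ≡ n) (g-gcd : ∀ i → g i ≡ gcd (N i) d) (N-step : ∀ i → N i ≡ N (suc i) ℕ.* g i)
  (k : ℕ) (gk≡1 : g k ≡ 1) where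

  open DSequence n d N g N-zero g-gcd N-step

  -- The residue u modulo N i stands for the element d ^ i * u of ℤ/n; it is divided by d as often as possible.
  data Desc : ℕ → ℕ → Set where
    base : ∀ {i u} → k ≤ i → Desc i u
    leaf : ∀ {i u} → i < k → ¬ g i ℕᵈ.∣ u → Desc i u
    step : ∀ {i u} → i < k → ∀ v → d ℕ.* v ≡ u [mod N i ] → Desc (suc i) v → Desc i u

  desc : ∀ i u → Desc i u
  desc i u = go k i u (ℕₚ.m≤n+m k i)
    where
    -- `f` bounds the number of levels left before `k`; the recursion is on it.
    go : ∀ f i u → k ≤ i ℕ.+ f → Desc i u
    go zero    i u k≤ = base (subst (k ≤_) (ℕₚ.+-identityʳ i) k≤)
    go (suc f) i u k≤ with k ℕ.≤? i | g i ℕᵈ.∣? u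
    ... | yes k≤i | _       = base k≤i
    ... | no  k≰i | no  g∤u = leaf (ℕₚ.≰⇒> k≰i) g∤u
    ... | no  k≰i | yes g∣u = let v , p = ÷d i u g∣u in
      step (ℕₚ.≰⇒> k≰i) v p (go f (suc i) v (subst (k ≤_) (ℕₚ.+-suc i f) k≤))

  step⇒∣ : ∀ i {u v} → d ℕ.* v ≡ u [mod N i ] → g i ℕᵈ.∣ u
  step⇒∣ i {v = v} p = ∣-mod (g∣N i) p (ℕᵈ.∣m⇒∣m*n v (g∣d i))

  -- Shared by the lifts `L`, which are vectors compared pointwise, and the coefficients `χ`, which
  -- are integers; hence the relation `_~_` is a parameter. A leaf is evaluated at the reduced
  -- residue so that only the class of `u` matters.
  module Fold {A : Set} (leafᵛ : ℕ → ℕ → A) (baseᵛ : ℕ → A) (scale : A → A) where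

    fold : ∀ {i u} → Desc i u → A
    fold {i} {u} (base _)       = baseᵛ u
    fold {i} {u} (leaf _ _)     = leafᵛ i (u % N i)
    fold         (step _ _ _ D) = scale (fold D)

    value : ℕ → ℕ → A
    value i u = fold (desc i u)

    module _ (_~_ : A → A → Set) (~-refl : ∀ {a} → a ~ a) (scale-cong : ∀ {a b} → a ~ b → scale a ~ scale b)
      (base-cong : ∀ {i u v} → k ≤ i → u ≡ v [mod N i ] → baseᵛ u ~ baseᵛ v) where

      -- The class of `u` modulo `N i` determines which constructor applies, so all mixed cases are
      -- contradictory. In two steps the quotients are congruent modulo `N (i + 1)` by `*-mod⁻¹`.
      fold-cong : ∀ {i u v} (D : Desc i u) (D′ : Desc i v) → u ≡ v [mod N i ] → fold D ~ fold D′
      fold-cong     (base k≤i)      (base _)         u≡v = base-cong k≤i u≡v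
      fold-cong     (base k≤i)      (leaf i<k _)     u≡v = contradiction k≤i (ℕₚ.<⇒≱ i<k)
      fold-cong     (base k≤i)      (step i<k _ _ _) u≡v = contradiction k≤i (ℕₚ.<⇒≱ i<k)
      fold-cong     (leaf i<k _)    (base k≤i)       u≡v = contradiction k≤i (ℕₚ.<⇒≱ i<k)
      fold-cong {i} (leaf _ _)      (leaf _ _)       u≡v = subst (λ t → leafᵛ i _ ~ leafᵛ i t) (mod⇒%≡ u≡v) ~-refl
      fold-cong {i} (leaf _ ∤u)     (step _ _ p _)   u≡v = contradiction (step⇒∣ i (mod-trans p (mod-sym u≡v))) ∤u
      fold-cong     (step i<k _ _ _) (base k≤i)      u≡v = contradiction k≤i (ℕₚ.<⇒≱ i<k)
      fold-cong {i} (step _ _ p _)  (leaf _ ∤v)      u≡v = contradiction (step⇒∣ i (mod-trans p u≡v)) ∤v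
      fold-cong {i} (step _ _ p D)  (step _ _ q D′)  u≡v =
        scale-cong (fold-cong D D′ (*-mod⁻¹ i (mod-trans p (mod-trans u≡v (mod-sym q)))))

      value-cong : ∀ {i u v} → u ≡ v [mod N i ] → value i u ~ value i v
      value-cong {i} {u} {v} = fold-cong (desc i u) (desc i v)

      value-* : ∀ {i} v → i < k → value i (d ℕ.* v) ~ scale (value (suc i) v)
      value-* {i} v i<k = fold-cong (desc i (d ℕ.* v)) (step i<k v mod-refl (desc (suc i) v)) mod-refl

      value-leaf : ∀ {i u} → i < k → ¬ g i ℕᵈ.∣ u → value i u ~ leafᵛ i (u % N i)
      value-leaf {i} {u} i<k ∤u = fold-cong (desc i u) (leaf i<k ∤u) mod-refl

      value-base : ∀ {i u} → k ≤ i → value i u ~ baseᵛ u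
      value-base {i} {u} k≤i = fold-cong (desc i u) (base k≤i) mod-refl

-- Torsion elements, their expansions and the dual functionals

module Chains (m d : ℕ) .{{d≢0 : NonZero d}} (N g : ℕ → ℕ)
  (N-zero : N 0 ≡ suc m) (g-gcd : ∀ i → g i ≡ gcd (N i) d) (N-step : ∀ i → N i ≡ N (suc i) ℕ.* g i)
  (k : ℕ) (gk≡1 : g k ≡ 1)
  (I : List (ℕ × ℕ)) (I-unique : Unique I)
  (∈I⇒< : ∀ {i u} → (i , u) ∈ I → i < k) (∈I⇒Head : ∀ {i u} → (i , u) ∈ I → Head N g i u)
  (Head⇒∈I : ∀ {i u} → i < k → Head N g i u → (i , u) ∈ I) where

  open DSequence (suc m) d N g N-zero g-gcd N-step
  open Basis m
  open Descent (suc m) d N g N-zero g-gcd N-step k gk≡1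

  private
    n = suc m
    R = proj₁ (period gk≡1)

  relation : Fin m → Poly m
  relation i = + d · E (suc (toℕ i)) ⊟ E (d ℕ.* suc (toℕ i))

  open Span relation
  open SetoidReasoning setoid

  E-* : ∀ v → + d · E v ≈ E (d ℕ.* v)
  E-* v with residue v
  ... | inj₁ v≡0 = ≗⇒≈ λ j → trans (cong (+ d *_) (trans (E-cong v≡0 j) (E-zero j)))
      (trans (ℤₚ.*-zeroʳ (+ d)) (sym (trans (E-cong (mod-* d v≡0) j)
        (trans (cong (λ t → E t j) (ℕₚ.*-zeroʳ d)) (E-zero j)))))
  ... | inj₂ (i , v≡i) = begin
    + d · E v               ≈⟨ ≗⇒≈ (λ j → cong (+ d *_) (E-cong v≡i j)) ⟩
    + d · E (suc (toℕ i))   ≈⟨ mk (≈𝟎⇒InSpan (generator≈𝟎 relation i)) ⟩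
    E (d ℕ.* suc (toℕ i))   ≈⟨ ≗⇒≈ (E-cong (mod-* d (mod-sym v≡i))) ⟩
    E (d ℕ.* v)             ∎

  ·-assoc : ∀ x y (a : Poly m) → x · (y · a) ≗ (x * y) · a
  ·-assoc x y a j = sym (ℤₚ.*-assoc x y (a j))

  E-^ : ∀ i v → + (d ^ i) · E v ≈ E (d ^ i ℕ.* v)
  E-^ zero    v = ≗⇒≈ λ j → trans (ℤₚ.*-identityˡ _) (cong (λ t → E t j) (sym (ℕₚ.*-identityˡ v)))
  E-^ (suc i) v = begin
    + (d ^ suc i) · E v
      ≈⟨ ≗⇒≈ (λ j → trans (cong (_* E v j) (pos-^ d i)) (ℤₚ.*-assoc (+ d) (+ (d ^ i)) (E v j))) ⟩
    + d · (+ (d ^ i) · E v)    ≈⟨ ·-cong (+ d) (E-^ i v) ⟩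
    + d · E (d ^ i ℕ.* v)      ≈⟨ E-* (d ^ i ℕ.* v) ⟩
    E (d ℕ.* (d ^ i ℕ.* v))    ≈⟨ ≗⇒≈ (λ j → cong (λ t → E t j) (sym (ℕₚ.*-assoc d (d ^ i) v))) ⟩
    E (d ^ suc i ℕ.* v)        ∎

  -- Lifts of d ^ i * u: d ^ i · L i u ≈ E (d ^ i * u) (see d^·L). At the end of a descent d ^ (k + R) acts as the
  -- identity on d ^ k * u, so d ^ R is the inverse of d ^ k there.
  module Lift = Fold (λ _ u → E u) (λ u → + (d ^ R) · E (d ^ k ℕ.* u)) (+ d ·_)

  L : ℕ → ℕ → Poly m
  L = Lift.value

  private
    ≗-refl : ∀ {a : Poly m} → a ≗ a
    ≗-refl _ = refl

    L-scale : ∀ {a b : Poly m} → a ≗ b → + d · a ≗ + d · b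
    L-scale eq j = cong (+ d *_) (eq j)

    L-base-cong : ∀ {i u v} → k ≤ i → u ≡ v [mod N i ] →
                  + (d ^ R) · E (d ^ k ℕ.* u) ≗ + (d ^ R) · E (d ^ k ℕ.* v)
    L-base-cong k≤i u≡v j =
      cong (+ (d ^ R) *_) (E-cong (^*-mod k (subst (_ ≡ _ [mod_]) (N-stable gk≡1 k≤i) u≡v)) j)

  L-cong : ∀ {i u v} → u ≡ v [mod N i ] → L i u ≗ L i v
  L-cong = Lift.value-cong _≗_ ≗-refl L-scale L-base-cong

  L-leaf : ∀ {i u} → i < k → ¬ g i ℕᵈ.∣ u → L i u ≗ E (u % N i)
  L-leaf = Lift.value-leaf _≗_ ≗-refl L-scale L-base-cong

  L-base : ∀ {i u} → k ≤ i → L i u ≗ + (d ^ R) · E (d ^ k ℕ.* u)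
  L-base = Lift.value-base _≗_ ≗-refl L-scale L-base-cong

  L-step : ∀ {i} v → i < k → L i (d ℕ.* v) ≗ + d · L (suc i) v
  L-step = Lift.value-* _≗_ ≗-refl L-scale L-base-cong

  -- Below level `k` this is a step of the descent and holds exactly; from `k` on the relations are
  -- used. `b-expand` needs the second case for the upper lift when `i + 1 = k`.
  L-* : ∀ i v → L i (d ℕ.* v) ≈ + d · L (suc i) v
  L-* i v with k ℕ.≤? i
  ... | no k≰i = ≗⇒≈ (L-step v (ℕₚ.≰⇒> k≰i))
  ... | yes k≤i = begin
    L i (d ℕ.* v)                            ≈⟨ ≗⇒≈ (L-base k≤i) ⟩
    + (d ^ R) · E (d ^ k ℕ.* (d ℕ.* v))
      ≈⟨ ·-cong (+ (d ^ R)) (≈-trans (≗⇒≈ λ j → cong (λ t → E t j) (lem (d ^ k) d v))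
         (≈-sym (E-* (d ^ k ℕ.* v)))) ⟩
    + (d ^ R) · (+ d · E (d ^ k ℕ.* v))      ≈⟨ ≗⇒≈ (λ j → swap (+ (d ^ R)) (+ d) (E (d ^ k ℕ.* v) j)) ⟩
    + d · (+ (d ^ R) · E (d ^ k ℕ.* v))      ≈⟨ ·-cong (+ d) (≗⇒≈ λ j → sym (L-base (ℕₚ.m≤n⇒m≤1+n k≤i) j)) ⟩
    + d · L (suc i) v                        ∎
    where
    lem : ∀ a b c → a ℕ.* (b ℕ.* c) ≡ b ℕ.* (a ℕ.* c)
    lem a b c = trans (sym (ℕₚ.*-assoc a b c)) (trans (cong (ℕ._* c) (ℕₚ.*-comm a b)) (ℕₚ.*-assoc b a c))
    swap : ∀ x y z → x * (y * z) ≡ y * (x * z)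
    swap = solve-∀

  d^-period : ∀ {i} u → k ≤ i → d ^ i ℕ.* (d ^ R ℕ.* (d ^ k ℕ.* u)) ≡ d ^ i ℕ.* u [mod n ]
  d^-period {i} u k≤i = subst₂ (_≡_[mod n ]) eq₁ eq₂ (mod-* (u ℕ.* d ^ (i ∸ k)) (proj₂ (period gk≡1)))
    where
    c = d ^ (i ∸ k)
    i≡ : d ^ i ≡ c ℕ.* d ^ k
    i≡ = trans (cong (d ^_) (sym (ℕₚ.m∸n+n≡m k≤i))) (ℕₚ.^-distribˡ-+-* d (i ∸ k) k)
    comm : ∀ u c x → (u ℕ.* c) ℕ.* x ≡ (c ℕ.* x) ℕ.* u
    comm u c x = trans (ℕₚ.*-assoc u c x) (ℕₚ.*-comm u (c ℕ.* x))
    eq₂ : (u ℕ.* c) ℕ.* d ^ k ≡ d ^ i ℕ.* u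
    eq₂ = trans (comm u c (d ^ k)) (cong (ℕ._* u) (sym i≡))
    powers : d ^ (k ℕ.+ (k ℕ.+ R)) ≡ d ^ k ℕ.* (d ^ R ℕ.* d ^ k)
    powers = trans (ℕₚ.^-distribˡ-+-* d k (k ℕ.+ R)) (cong (d ^ k ℕ.*_)
      (trans (ℕₚ.^-distribˡ-+-* d k R) (ℕₚ.*-comm (d ^ k) (d ^ R))))
    eq₁ : (u ℕ.* c) ℕ.* d ^ (k ℕ.+ (k ℕ.+ R)) ≡ d ^ i ℕ.* (d ^ R ℕ.* (d ^ k ℕ.* u))
    eq₁ = trans (comm u c _) (trans (cong (λ t → (c ℕ.* t) ℕ.* u) powers)
      (trans (cong (ℕ._* u) (trans (sym (ℕₚ.*-assoc c (d ^ k) (d ^ R ℕ.* d ^ k)))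
        (cong (ℕ._* (d ^ R ℕ.* d ^ k)) (sym i≡))))
        (trans (ℕₚ.*-assoc (d ^ i) _ u) (cong (d ^ i ℕ.*_) (ℕₚ.*-assoc (d ^ R) (d ^ k) u)))))

  d^·L : ∀ {i u} (D : Desc i u) → + (d ^ i) · Lift.fold D ≈ E (d ^ i ℕ.* u)
  d^·L {i} {u} (base k≤i) = begin
    + (d ^ i) · (+ (d ^ R) · E (d ^ k ℕ.* u))  ≈⟨ ·-cong (+ (d ^ i)) (E-^ R _) ⟩
    + (d ^ i) · E (d ^ R ℕ.* (d ^ k ℕ.* u))    ≈⟨ E-^ i _ ⟩
    E (d ^ i ℕ.* (d ^ R ℕ.* (d ^ k ℕ.* u)))    ≈⟨ ≗⇒≈ (E-cong (d^-period u k≤i)) ⟩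
    E (d ^ i ℕ.* u)                            ∎
  d^·L {i} {u} (leaf _ _) = begin
    + (d ^ i) · E (u % N i)    ≈⟨ E-^ i _ ⟩
    E (d ^ i ℕ.* (u % N i))    ≈⟨ ≗⇒≈ (E-cong (^*-mod i (mod-% u))) ⟩
    E (d ^ i ℕ.* u)            ∎
  d^·L {i} {u} (step _ v p D) = begin
    + (d ^ i) · (+ d · Lift.fold D)
      ≈⟨ ≗⇒≈ (λ j → trans (lem (+ (d ^ i)) (+ d) (Lift.fold D j)) (cong (_* Lift.fold D j) (sym (pos-^ d i)))) ⟩
    + (d ^ suc i) · Lift.fold D      ≈⟨ d^·L D ⟩
    E (d ^ suc i ℕ.* v)
      ≈⟨ ≗⇒≈ (E-cong (mod-trans (mod-reflexive (trans (cong (ℕ._* v) (ℕₚ.*-comm d (d ^ i)))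
                                          (ℕₚ.*-assoc (d ^ i) d v))) (^*-mod i p))) ⟩
    E (d ^ i ℕ.* u)                  ∎
    where
    lem : ∀ x y z → x * (y * z) ≡ (y * x) * z
    lem = solve-∀

  b : ℕ × ℕ → Poly m
  b (i , u) = L i u ⊟ L (suc i) u

  b-cong : ∀ {i u v} → u ≡ v [mod N i ] → b (i , u) ≗ b (i , v)
  b-cong {i} u≡v j = cong₂ _-_ (L-cong u≡v j) (L-cong (mod-∣ (N-∣-suc i) u≡v) j)

  -- Both `d · (d ^ i · L i u)` and `d ^ (i + 1) · L (i + 1) u` are congruent to
  -- `E (d ^ (i + 1) * u)`.
  b-torsion : ∀ i u → + (d ^ suc i) · b (i , u) ≈ 𝟎
  b-torsion i u = begin
    + (d ^ suc i) · b (i , u)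
      ≈⟨ ≗⇒≈ (λ j → trans (cong (_* b (i , u) j) (pos-^ d i))
         (trans (lem (+ d) (+ (d ^ i)) (L i u j) (L (suc i) u j))
           (cong (λ t → + d * (+ (d ^ i) * L i u j) - t * L (suc i) u j) (sym (pos-^ d i))))) ⟩
    + d · (+ (d ^ i) · L i u) ⊟ + (d ^ suc i) · L (suc i) u
      ≈⟨ ⊟-cong (·-cong (+ d) (d^·L (desc i u))) (d^·L (desc (suc i) u)) ⟩
    + d · E (d ^ i ℕ.* u) ⊟ E (d ^ suc i ℕ.* u)                 ≈⟨ ⊟-cong (E-* (d ^ i ℕ.* u)) ≈-refl ⟩
    E (d ℕ.* (d ^ i ℕ.* u)) ⊟ E (d ^ suc i ℕ.* u)
      ≈⟨ ≗⇒≈ (λ j → trans (cong (λ t → E t j - E (d ^ suc i ℕ.* u) j) (sym (ℕₚ.*-assoc d (d ^ i) u)))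
         (ℤₚ.+-inverseʳ (E (d ^ suc i ℕ.* u) j))) ⟩
    𝟎                                                           ∎
    where
    lem : ∀ x y a b → (x * y) * (a - b) ≡ x * (y * a) - (x * y) * b
    lem = solve-∀

  -- The value at `(i , u)` is the coefficient of `b x` in `b (i , u)`: every division by `d`
  -- contributes a factor `d`, and the final leaf either is `x` or contributes nothing.
  module Coefficient (x : ℕ × ℕ) = Fold (λ i u → 𝟙 (x ≟× (i , u))) (λ _ → 0ℤ) (+ d *_)

  χ : ℕ × ℕ → ℕ → ℕ → ℤ
  χ x = Coefficient.value x

  χ-cong : ∀ x {i u v} → u ≡ v [mod N i ] → χ x i u ≡ χ x i v
  χ-cong x = Coefficient.value-cong x _≡_ refl (cong (+ d *_)) (λ _ _ → refl)

  χ-leaf : ∀ x {i u} → i < k → ¬ g i ℕᵈ.∣ u → χ x i u ≡ 𝟙 (x ≟× (i , u % N i))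
  χ-leaf x = Coefficient.value-leaf x _≡_ refl (cong (+ d *_)) (λ _ _ → refl)

  χ-base : ∀ x {i u} → k ≤ i → χ x i u ≡ 0ℤ
  χ-base x = Coefficient.value-base x _≡_ refl (cong (+ d *_)) (λ _ _ → refl)

  χ-* : ∀ x {i} v → i < k → χ x i (d ℕ.* v) ≡ + d * χ x (suc i) v
  χ-* x = Coefficient.value-* x _≡_ refl (cong (+ d *_)) (λ _ _ → refl)

  comb : (ℕ × ℕ → ℤ) → Poly m
  comb c j = sumL I (λ x → c x * b x j)

  head? : ∀ i u → Dec (N (suc i) ≤ u ⊎ g (suc i) ℕᵈ.∣ u)
  head? i u = (N (suc i) ℕ.≤? u) ⊎-dec (g (suc i) ℕᵈ.∣? u)

  -- From level `k` on both lifts have the same base value, so their difference is zero. At a leaf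
  -- the reduced residue is a head, or both lifts are the same `E`. A step pulls out a factor `d`.
  b-expand : ∀ {i u} → Desc i u → b (i , u) ≈ comb (λ x → χ x i u)
  b-expand {i} {u} (base k≤i) = ≗⇒≈ λ j → trans
    (trans (cong₂ _-_ (L-base {i} {u} k≤i j) (L-base {suc i} {u} (ℕₚ.m≤n⇒m≤1+n k≤i) j))
      (ℤₚ.+-inverseʳ ((+ (d ^ R) · E (d ^ k ℕ.* u)) j)))
    (sym (sumL-0 I λ {x} _ → cong (_* b x j) (χ-base x k≤i)))
  b-expand {i} {u} (leaf i<k g∤u) with head? i (u % N i)
  ... | yes fork = ≗⇒≈ λ j → trans (b-cong (mod-sym (mod-% u)) j) (sym (trans
      (sumL-single I-unique y∈I (λ x → χ x i u * b x j)
        (λ {x} _ x≢y → cong (_* b x j) (trans (χ-leaf x i<k g∤u) (𝟙-no (x ≟× y) x≢y))))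
      (trans (cong (_* b y j) (trans (χ-leaf y i<k g∤u) (𝟙-yes (y ≟× y) refl))) (ℤₚ.*-identityˡ (b y j)))))
    where
    y = (i , u % N i)
    y∈I : y ∈ I
    y∈I = Head⇒∈I i<k (record { <N = ℕ%.m%n<n u (N i) ; g∤ = g∤u ∘ ∣-mod (g∣N i) (mod-% u) ; fork = fork })
  ... | no ¬fork = ≗⇒≈ λ j → trans (trans (cong₂ _-_ (L-leaf i<k g∤u j) (L≡E j)) (ℤₚ.+-inverseʳ (E (u % N i) j)))
      (sym (sumL-0 I λ {x} x∈ → cong (_* b x j) (trans (χ-leaf x i<k g∤u)
        (𝟙-no (x ≟× (i , u % N i)) λ { refl → ¬fork (Head.fork (∈I⇒Head x∈)) }))))
    where
    w≡u : u % N i ≡ u [mod N (suc i) ]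
    w≡u = mod-∣ (N-∣-suc i) (mod-% u)
    g∤ : ¬ g (suc i) ℕᵈ.∣ u
    g∤ = ¬fork ∘ inj₂ ∘ ∣-mod (g∣N (suc i)) (mod-sym w≡u)
    -- At `i + 1 = k` the fork condition would hold, since `g k = 1` divides everything.
    i+1<k : suc i < k
    i+1<k = ℕₚ.≤∧≢⇒< i<k λ { refl → g∤ (subst (ℕᵈ._∣ u) (sym gk≡1) (ℕᵈ.1∣ u)) }
    L≡E : L (suc i) u ≗ E (u % N i)
    L≡E j = trans (L-leaf i+1<k g∤ j) (cong (λ t → E t j)
      (trans (sym (mod⇒%≡ w≡u)) (ℕ%.m<n⇒m%n≡m (ℕₚ.≰⇒> (¬fork ∘ inj₁)))))
  b-expand {i} {u} (step i<k v p D) = begin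
    b (i , u)                                      ≈⟨ ≗⇒≈ (b-cong (mod-sym p)) ⟩
    b (i , d ℕ.* v)                                ≈⟨ ⊟-cong (L-* i v) (L-* (suc i) v) ⟩
    + d · L (suc i) v ⊟ + d · L (suc (suc i)) v    ≈⟨ ≗⇒≈ (λ j → sym (*-distribˡ-minus (+ d) _ _)) ⟩
    + d · b (suc i , v)                            ≈⟨ ·-cong (+ d) (b-expand D) ⟩
    + d · comb (λ x → χ x (suc i) v)
      ≈⟨ ≗⇒≈ (λ j → trans (sym (sumL-*ˡ I (+ d) _)) (sumL-cong I λ {x} _ →
         trans (sym (ℤₚ.*-assoc (+ d) (χ x (suc i) v) (b x j)))
           (cong (_* b x j) (sym (trans (χ-cong x (mod-sym p)) (χ-* x v i<k)))))) ⟩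
    comb (λ x → χ x i u)                           ∎

  π : ℕ × ℕ → ℕ → ℤ
  π x v = range 0 k (λ i → χ x i v)

  -- `E v` is `L 0 v`, which telescopes into the sum of the `b (i , v)` with `i < k` plus `L k v`.
  -- The latter is a multiple of `d ^ k · E v`, so the remainder will disappear on the kernel of
  -- `d ^ k`.
  E-expand-chains : ∀ v → E v ≈ comb (λ x → π x v) ⊞ + (d ^ (k ℕ.+ R)) · E v
  E-expand-chains v = begin
    E v                                                          ≈⟨ E≈L ⟩
    L 0 v                                                        ≈⟨ ≗⇒≈ (λ j → trans (lem (L 0 v j) (L k v j))
         (cong (_+ L k v j) (sym (range-telescope 0 k (λ i → L i v j))))) ⟩
    (λ j → range 0 k (λ i → b (i , v) j)) ⊞ L k v
      ≈⟨ ⊞-cong (range-≈ 0 k λ i → b-expand (desc i v)) Lk ⟩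
    (λ j → range 0 k (λ i → comb (λ x → χ x i v) j)) ⊞ + (d ^ (k ℕ.+ R)) · E v
      ≈⟨ ⊞-cong (≗⇒≈ λ j → trans (range-sumL 0 k I _) (sumL-cong I λ {x} _ → factor x j)) ≈-refl ⟩
    comb (λ x → π x v) ⊞ + (d ^ (k ℕ.+ R)) · E v                 ∎
    where
    lem : ∀ a b → a ≡ (a - b) + b
    lem = solve-∀
    factor : ∀ x j → range 0 k (λ i → χ x i v * b x j) ≡ π x v * b x j
    factor x j = trans (range-cong 0 k λ i _ _ → ℤₚ.*-comm (χ x i v) (b x j))
                   (trans (range-*ˡ 0 k (b x j) _) (ℤₚ.*-comm (b x j) (π x v)))
    E≈L : E v ≈ L 0 v
    E≈L = ≈-sym (≈-trans (≗⇒≈ λ j → sym (ℤₚ.*-identityˡ (L 0 v j)))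
      (≈-trans (d^·L (desc 0 v)) (≗⇒≈ λ j → cong (λ t → E t j) (ℕₚ.*-identityˡ v))))
    Lk : L k v ≈ + (d ^ (k ℕ.+ R)) · E v
    Lk = ≈-trans (≗⇒≈ (L-base ℕₚ.≤-refl)) (≈-trans (·-cong (+ (d ^ R)) (≈-sym (E-^ k v)))
      (≗⇒≈ λ j → trans (·-assoc (+ (d ^ R)) (+ (d ^ k)) (E v) j) (cong (_* E v j)
        (trans (ℤₚ.*-comm (+ (d ^ R)) (+ (d ^ k))) (sym (pos-^-+ d k R))))))

  π̂ : ℕ × ℕ → Fin m → ℤ
  π̂ x = on-basis (π x)

  expand-chains : ∀ a → a ≈ comb (λ x → ⟨ a , π̂ x ⟩) ⊞ + (d ^ (k ℕ.+ R)) · a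
  expand-chains a = begin
    a                                             ≈⟨ ≗⇒≈ (λ j → sym (E-expand a j)) ⟩
    lc a (λ i → E (suc (toℕ i)))                  ≈⟨ lc-≈ a (λ i → E-expand-chains (suc (toℕ i))) ⟩
    lc a (λ i → comb (λ x → π x (suc (toℕ i))) ⊞ D · E (suc (toℕ i)))
      ≈⟨ ≗⇒≈ rearrange ⟩
    comb (λ x → ⟨ a , π̂ x ⟩) ⊞ D · a              ∎
    where
    D = + (d ^ (k ℕ.+ R))
    lem₁ : ∀ a c D e → a * (c + D * e) ≡ a * c + D * (a * e)
    lem₁ = solve-∀
    lem₂ : ∀ a p b → a * (p * b) ≡ b * (a * p)
    lem₂ = solve-∀
    rearrange : ∀ j → lc a (λ i → comb (λ x → π x (suc (toℕ i))) ⊞ D · E (suc (toℕ i))) j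
                    ≡ comb (λ x → ⟨ a , π̂ x ⟩) j + D * a j
    rearrange j =
      trans (sumFin-cong m (λ i → lem₁ (a i) (comb (λ x → π x (suc (toℕ i))) j) D (E (suc (toℕ i)) j)))
      (trans (sumFin-+ m (λ i → a i * comb (λ x → π x (suc (toℕ i))) j) (λ i → D * (a i * E (suc (toℕ i)) j)))
        (cong₂ _+_
          (trans (sumFin-cong m λ i → trans (sym (sumL-*ˡ I (a i) _))
            (sumL-cong I λ {x} _ → lem₂ (a i) (π̂ x i) (b x j)))
            (trans (sym (sumL-sumFin I m _)) (sumL-cong I λ {x} _ →
              trans (sumFin-*ˡ m (b x j) _) (ℤₚ.*-comm (b x j) ⟨ a , π̂ x ⟩))))
          (trans (sumFin-*ˡ m D _) (cong (D *_) (E-expand a j)))))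

  -- Zero can be divided by `d` at every level, so its descent never ends in a leaf.
  χ-0 : ∀ x {i u} (D : Desc i u) → u ≡ 0 [mod N i ] → Coefficient.fold x D ≡ 0ℤ
  χ-0 x     (base _)       u≡0 = refl
  χ-0 x {i} (leaf _ g∤u)   u≡0 = contradiction (∣-mod (g∣N i) (mod-sym u≡0) (g i ℕᵈ.∣0)) g∤u
  χ-0 x {i} (step _ v p D) u≡0 = trans (cong (+ d *_) (χ-0 x D (*-mod⁻¹ i
    (mod-trans p (mod-trans u≡0 (mod-reflexive (sym (ℕₚ.*-zeroʳ d)))))))) (ℤₚ.*-zeroʳ (+ d))

  N∣n : ∀ i → N i ℕᵈ.∣ n
  N∣n i = subst (N i ℕᵈ.∣_) N-zero (N-∣ z≤n)

  π-periodic : ∀ x → Periodic (π x)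
  π-periodic x = record
    { at-0     = range-0 0 k λ i _ _ → χ-0 x (desc i 0) mod-refl
    ; periodic = λ p → range-cong 0 k λ i _ _ → χ-cong x (mod-∣ (N∣n i) p)
    }

  -- A descent from level `i` meets the head only after `i₀ - i` steps, each of which multiplies by
  -- `d`.
  χ-divisible : ∀ i₀ u₀ {i u} (D : Desc i u) → + (d ^ (i₀ ∸ i)) ∣ Coefficient.fold (i₀ , u₀) D
  χ-divisible i₀ u₀ (base _) = divides 0ℤ refl
  χ-divisible i₀ u₀ {i} {u} (leaf _ _) with (i₀ , u₀) ≟× (i , u % N i)
  ... | yes refl = subst (λ t → + (d ^ t) ∣ 1ℤ) (sym (ℕₚ.n∸n≡0 i)) ∣-refl
  ... | no  _    = divides 0ℤ refl
  χ-divisible i₀ u₀ {i} (step _ _ _ D) = ∣-trans (^-∣-^ d i₀∸i≤)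
    (subst (_∣ + d * Coefficient.fold (i₀ , u₀) D) (sym (pos-^ d (i₀ ∸ suc i)))
      (*-monoʳ-∣ (+ d) (χ-divisible i₀ u₀ D)))
    where
    i₀∸i≤ : i₀ ∸ i ≤ suc (i₀ ∸ suc i)
    i₀∸i≤ = subst (i₀ ∸ i ≤_) (cong suc (trans (ℕₚ.∸-+-assoc i₀ i 1) (cong (i₀ ∸_) (ℕₚ.+-comm i 1))))
      (ℕₚ.m≤n+m∸n (i₀ ∸ i) 1)

  -- On ε_v the functional is `d * π x v - π x (d * v)`. As `χ x i (d * v)` is `d * χ x (i + 1) v`,
  -- this telescopes to `d * χ x 0 v`, and `χ-divisible` supplies the factor `d ^ i`.
  π-relation : ∀ {i u} → (i , u) ∈ I → ∀ j → + (d ^ suc i) ∣ ⟨ relation j , π̂ (i , u) ⟩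
  π-relation {i} {u} x∈ j = subst₂ _∣_ (sym (pos-^ d i)) (sym eq) (*-monoʳ-∣ (+ d) (χ-divisible i u (desc 0 v)))
    where
    x = (i , u)
    v = suc (toℕ j)
    eq : ⟨ relation j , π̂ x ⟩ ≡ + d * χ x 0 v
    eq = trans (⟨⟩-⊟ (+ d · E v) (E (d ℕ.* v)) (π̂ x))
      (trans (cong₂ _-_ (trans (⟨⟩-· (+ d) (E v) (π̂ x)) (cong (+ d *_) (⟨E⟩ (π-periodic x) v)))
        (⟨E⟩ (π-periodic x) (d ℕ.* v)))
      (trans (cong₂ _-_ (sym (range-*ˡ 0 k (+ d) _)) (range-cong 0 k λ i _ i<k → χ-* x v i<k))
      (trans (range-minus 0 k _ _)
      (trans (range-telescope 0 k (λ i → + d * χ x i v))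
        (trans (cong (λ t → + d * χ x 0 v - + d * t) (χ-base x ℕₚ.≤-refl)) (lem (+ d) (χ x 0 v)))))))
      where
      lem : ∀ a b → a * b - a * 0ℤ ≡ a * b
      lem = solve-∀

  tail : ℕ → (ℕ → ℤ) → ℤ
  tail i = range i (k ∸ i)

  χ-vanish : ∀ x a i u → k ≤ i ℕ.+ a → χ x i (d ^ a ℕ.* u) ≡ 0ℤ
  χ-vanish x zero    i u k≤ = χ-base x (subst (k ≤_) (ℕₚ.+-identityʳ i) k≤)
  χ-vanish x (suc a) i u k≤ with k ℕ.≤? i
  ... | yes k≤i = χ-base x k≤i
  ... | no  k≰i = trans (cong (χ x i) (ℕₚ.*-assoc d (d ^ a) u)) (trans (χ-* x _ (ℕₚ.≰⇒> k≰i))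
      (trans (cong (+ d *_) (χ-vanish x a (suc i) u (subst (k ≤_) (ℕₚ.+-suc i a) k≤))) (ℤₚ.*-zeroʳ (+ d))))

  -- A lift from level `i` is seen only by the levels from `i` on, so in the difference of two
  -- consecutive lifts of `u` exactly the contribution of level `i` survives.
  ⟨L,π⟩ : ∀ {x} → x ∈ I → ∀ {i u} (D : Desc i u) → ⟨ Lift.fold D , π̂ x ⟩ ≡ tail i (λ j → χ x j u)
  ⟨L,π⟩ {x} x∈ {i} {u} (base k≤i) = trans
    (trans (⟨⟩-· (+ (d ^ R)) (E (d ^ k ℕ.* u)) (π̂ x))
      (trans (cong (+ (d ^ R) *_) (trans (⟨E⟩ (π-periodic x) (d ^ k ℕ.* u))
      (range-0 0 k λ j _ _ → χ-vanish x k j u (ℕₚ.m≤n+m k j)))) (ℤₚ.*-zeroʳ (+ (d ^ R)))))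
    (sym (cong (λ t → range i t (λ j → χ x j u)) (ℕₚ.m≤n⇒m∸n≡0 k≤i)))
  ⟨L,π⟩ {x} x∈ {i} {u} (leaf i<k g∤u) = begin-≡
    where
    w = u % N i
    w<N : w < N i
    w<N = ℕ%.m%n<n u (N i)
    g∤w : ¬ g i ℕᵈ.∣ w
    g∤w = g∤u ∘ ∣-mod (g∣N i) (mod-% u)
    -- At a level `j < i` the residue `w` is a leaf, but `w < N (j + 1)` and `g (j + 1)` does not
    -- divide it, so it is not a head.
    χ≡0 : ∀ j → j < i → χ x j w ≡ 0ℤ
    χ≡0 j j<i = trans (χ-leaf x (ℕₚ.<-trans j<i i<k) (g∤w ∘ ℕᵈ.∣-trans (g-∣ (ℕₚ.<⇒≤ j<i))))
      (𝟙-no (x ≟× (j , w % N j)) λ { refl → not-head (subst (Head N g j) (ℕ%.m<n⇒m%n≡m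
        (ℕₚ.<-≤-trans w<N (ℕᵈ.∣⇒≤ (N-∣ (ℕₚ.<⇒≤ j<i))))) (∈I⇒Head x∈)) })
      where
      not-head : ¬ Head N g j w
      not-head h with Head.fork h
      ... | inj₁ N≤w = ℕₚ.<⇒≱ (ℕₚ.<-≤-trans w<N (ℕᵈ.∣⇒≤ (N-∣ j<i))) N≤w
      ... | inj₂ g∣w = g∤w (ℕᵈ.∣-trans (g-∣ j<i) g∣w)
    begin-≡ : ⟨ E w , π̂ x ⟩ ≡ tail i (λ j → χ x j u)
    begin-≡ = trans (⟨E⟩ (π-periodic x) w)
      (trans (cong (λ t → range 0 t (λ j → χ x j w)) (sym (ℕₚ.m+[n∸m]≡n (ℕₚ.<⇒≤ i<k))))
      (trans (range-split 0 i (k ∸ i) _)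
      (trans (cong₂ _+_ (range-0 0 i λ j _ j<i → χ≡0 j j<i)
        (range-cong i (k ∸ i) λ j i≤j _ → χ-cong x (mod-∣ (N-∣ i≤j) (mod-% u))))
      (ℤₚ.+-identityˡ _))))
  ⟨L,π⟩ {x} x∈ {i} {u} (step i<k v p D) =
    trans (⟨⟩-· (+ d) (Lift.fold D) (π̂ x)) (trans (cong (+ d *_) (⟨L,π⟩ x∈ D)) (sym tail-step))
    where
    r = k ∸ suc i
    k∸i : k ∸ i ≡ r ℕ.+ 1
    k∸i = trans (ℕₚ.+-∸-assoc 1 i<k) (ℕₚ.+-comm 1 r)
    -- Division by `d` shifts the levels up by one; the additional top level `k` contributes zero.
    tail-step : tail i (λ j → χ x j u) ≡ + d * tail (suc i) (λ j → χ x j v)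
    tail-step =
      trans (range-cong i (k ∸ i) λ j i≤j j< → trans (χ-cong x (mod-∣ (N-∣ i≤j) (mod-sym p)))
               (χ-* x v (subst (j <_) (ℕₚ.m+[n∸m]≡n (ℕₚ.<⇒≤ i<k)) j<)))
      (trans (range-*ˡ i (k ∸ i) (+ d) _) (cong (+ d *_)
      (trans (range-shift i (k ∸ i) (λ j → χ x j v))
      (trans (cong (λ t → range (suc i) t (λ j → χ x j v)) k∸i)
      (trans (range-split (suc i) r 1 _)
      (trans (+-congˡ (tail (suc i) (λ j → χ x j v))
        (cong (_+ 0ℤ) (χ-base x {u = v} (ℕₚ.≤-reflexive (sym (ℕₚ.m+[n∸m]≡n i<k))))))
        (ℤₚ.+-identityʳ _)))))))

  ⟨b,π⟩ : ∀ {x y} → x ∈ I → y ∈ I → ⟨ b y , π̂ x ⟩ ≡ 𝟙 (x ≟× y)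
  ⟨b,π⟩ {x} {y = i , u} x∈ y∈ =
    trans (⟨⟩-⊟ (L i u) (L (suc i) u) (π̂ x))
    (trans (cong₂ _-_ (⟨L,π⟩ x∈ (desc i u)) (⟨L,π⟩ x∈ (desc (suc i) u)))
    (trans (cong (λ t → range i t (λ j → χ x j u) - tail (suc i) (λ j → χ x j u)) (ℕₚ.+-∸-assoc 1 i<k))
    (trans (lem (χ x i u) (tail (suc i) (λ j → χ x j u)))
    (trans (χ-leaf x i<k (Head.g∤ h)) (cong (λ t → 𝟙 (x ≟× (i , t))) (ℕ%.m<n⇒m%n≡m (Head.<N h)))))))
    where
    i<k = ∈I⇒< y∈
    h = ∈I⇒Head y∈
    lem : ∀ a b → a + b - b ≡ a
    lem = solve-∀

-- Counting residues

count : ∀ {P : ℕ → Set} → Decidable P → ℕ → ℕ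
count P? M = length (filter P? (downFrom M))

count-split : ∀ {P Q R : ℕ → Set} (P? : Decidable P) (Q? : Decidable Q) (R? : Decidable R) M →
  (∀ {u} → u < M → P u → Q u ⊎ R u) → (∀ {u} → u < M → Q u → P u × ¬ R u) → (∀ {u} → u < M → R u → P u) →
  count P? M ≡ count Q? M ℕ.+ count R? M
count-split P? Q? R? zero    P⇒ Q⇒ R⇒ = refl
count-split P? Q? R? (suc M) P⇒ Q⇒ R⇒
  with P? M | Q? M | R? M | count-split P? Q? R? M (P⇒ ∘ ℕₚ.m≤n⇒m≤1+n) (Q⇒ ∘ ℕₚ.m≤n⇒m≤1+n) (R⇒ ∘ ℕₚ.m≤n⇒m≤1+n)
... | yes p | yes q | yes r | _  = contradiction r (proj₂ (Q⇒ ℕₚ.≤-refl q))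
... | yes p | yes q | no ¬r | eq = cong suc eq
... | yes p | no ¬q | yes r | eq = trans (cong suc eq) (sym (ℕₚ.+-suc _ _))
... | yes p | no ¬q | no ¬r | _  with P⇒ ℕₚ.≤-refl p
...   | inj₁ q = contradiction q ¬q
...   | inj₂ r = contradiction r ¬r
count-split P? Q? R? (suc M) P⇒ Q⇒ R⇒ | no ¬p | yes q | _ | _ = contradiction (proj₁ (Q⇒ ℕₚ.≤-refl q)) ¬p
count-split P? Q? R? (suc M) P⇒ Q⇒ R⇒ | no ¬p | no ¬q | yes r | _ = contradiction (R⇒ ℕₚ.≤-refl r) ¬p
count-split P? Q? R? (suc M) P⇒ Q⇒ R⇒ | no ¬p | no ¬q | no ¬r | eq = eq

count-yes : ∀ {P : ℕ → Set} (P? : Decidable P) {M} → P M → count P? (suc M) ≡ suc (count P? M)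
count-yes P? {M} p with P? M
... | yes _ = refl
... | no ¬p = contradiction p ¬p

count-no : ∀ {P : ℕ → Set} (P? : Decidable P) {M} → ¬ P M → count P? (suc M) ≡ count P? M
count-no P? {M} ¬p with P? M
... | yes p = contradiction p ¬p
... | no _  = refl

count-all : ∀ {P : ℕ → Set} (P? : Decidable P) M → (∀ u → P u) → count P? M ≡ M
count-all P? zero    all = refl
count-all P? (suc M) all = trans (count-yes P? (all M)) (cong suc (count-all P? M all))

count-≡ : ∀ s M → s < M → count (ℕ._≟ s) M ≡ 1
count-≡ s (suc M) s<1+M with M ℕ.≟ s
... | yes refl = trans (count-yes (ℕ._≟ s) refl) (cong suc (none s ℕₚ.≤-refl))
  where
  none : ∀ M → M ≤ s → count (ℕ._≟ s) M ≡ 0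
  none zero    _   = refl
  none (suc M) M<s = trans (count-no (ℕ._≟ s) (ℕₚ.<⇒≢ M<s)) (none M (ℕₚ.<⇒≤ M<s))
... | no M≢s = trans (count-no (ℕ._≟ s) M≢s) (count-≡ s M (ℕₚ.≤∧≢⇒< (ℕₚ.≤-pred s<1+M) (M≢s ∘ sym)))

count-cong : ∀ {P Q : ℕ → Set} (P? : Decidable P) (Q? : Decidable Q) M →
  (∀ {u} → u < M → P u → Q u) → (∀ {u} → u < M → Q u → P u) → count P? M ≡ count Q? M
count-cong P? Q? zero    P⇒Q Q⇒P = refl
count-cong P? Q? (suc M) P⇒Q Q⇒P
  with P? M | Q? M | count-cong P? Q? M (P⇒Q ∘ ℕₚ.m≤n⇒m≤1+n) (Q⇒P ∘ ℕₚ.m≤n⇒m≤1+n)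
... | yes p | yes q | eq = cong suc eq
... | yes p | no ¬q | _  = contradiction (P⇒Q ℕₚ.≤-refl p) ¬q
... | no ¬p | yes q | _  = contradiction (Q⇒P ℕₚ.≤-refl q) ¬p
... | no ¬p | no ¬q | eq = eq

count-truncate : ∀ {P : ℕ → Set} (P? : Decidable P) {M} M′ → M ≤ M′ →
  count (λ u → (u ℕ.<? M) ×-dec P? u) M′ ≡ count P? M
count-truncate P? {M} M′ M≤M′ with M ℕ.≟ M′
... | yes refl = count-cong (λ u → (u ℕ.<? M) ×-dec P? u) P? M (λ _ → proj₂) _,_
count-truncate P? zero z≤n | no M≢M′ = refl
count-truncate P? {M} (suc M′) M≤ | no M≢ =
  trans (count-no (λ u → (u ℕ.<? M) ×-dec P? u) (ℕₚ.≤⇒≯ M≤M′ ∘ proj₁)) (count-truncate P? M′ M≤M′)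
  where M≤M′ = ℕₚ.≤-pred (ℕₚ.≤∧≢⇒< M≤ M≢)

count-∣ : ∀ g .{{_ : NonZero g}} q → count (g ℕᵈ.∣?_) (q ℕ.* g) ≡ q
count-∣ g@(suc g′) zero    = refl
count-∣ g@(suc g′) (suc q) = trans (block g′ ℕₚ.≤-refl) (cong suc (count-∣ g q))
  where
  block : ∀ j → j < g → count (g ℕᵈ.∣?_) (suc j ℕ.+ q ℕ.* g) ≡ suc (count (g ℕᵈ.∣?_) (q ℕ.* g))
  block zero    _   = count-yes (g ℕᵈ.∣?_) (ℕᵈ.n∣m*n q)
  block (suc j) j<g = trans (count-no (g ℕᵈ.∣?_) λ g∣ →
    ℕᵈ.>⇒∤ j<g (ℕᵈ.∣m+n∣m⇒∣n (subst (g ℕᵈ.∣_) (ℕₚ.+-comm (suc j) (q ℕ.* g)) g∣) (ℕᵈ.n∣m*n q)))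
    (block j (ℕₚ.<-trans (ℕₚ.n<1+n j) j<g))

map-const-on : ∀ {A B : Set} {f : A → B} {c} xs → (∀ {x} → x ∈ xs → f x ≡ c) → map f xs ≡ replicate (length xs) c
map-const-on []       eq = refl
map-const-on (x ∷ xs) eq = cong₂ _∷_ (eq (here refl)) (map-const-on xs (eq ∘ there))

-- The heads at each level and their number

module Heads (n d : ℕ) .{{n≢0 : NonZero n}} .{{d≢0 : NonZero d}} (N g : ℕ → ℕ)
  (N-zero : N 0 ≡ n) (g-gcd : ∀ i → g i ≡ gcd (N i) d) (N-step : ∀ i → N i ≡ N (suc i) ℕ.* g i)
  (k : ℕ) (gk≡1 : g k ≡ 1) (g≢1 : ∀ {i} → i < k → g i ≢ 1) where

  open DSequence n d N g N-zero g-gcd N-step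
  open Head

  -- Chosen so that θ takes exactly the value N (i + 1) on the generator b (i , special i), see θb-special.
  -- The summand is 1 for i + 1 < k and 0 for i + 1 = k.
  special : ℕ → ℕ
  special i = N (suc i) ℕ.+ 1 % g (suc i)

  1<g : ∀ {i} → i < k → 1 < g i
  1<g {i} i<k = ℕₚ.≤∧≢⇒< (ℕ.>-nonZero⁻¹ (g i)) (g≢1 i<k ∘ sym)

  special-< : ∀ {i} → suc i < k → special i ≡ suc (N (suc i))
  special-< {i} i<k = trans (cong (λ t → N (suc i) ℕ.+ t) (ℕ%.m<n⇒m%n≡m (1<g i<k))) (ℕₚ.+-comm (N (suc i)) 1)

  special-≡ : ∀ {i} → suc i ≡ k → special i ≡ N (suc i)
  special-≡ {i} i≡k = trans (cong (λ t → N (suc i) ℕ.+ t)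
    (ℕₚ.n<1⇒n≡0 (subst (1 % g (suc i) <_) g≡1 (ℕ%.m%n<n 1 (g (suc i))))))
                        (ℕₚ.+-identityʳ (N (suc i)))
    where
    g≡1 : g (suc i) ≡ 1
    g≡1 = trans (cong g i≡k) gk≡1

  2N≤N : ∀ {i} → i < k → N (suc i) ℕ.+ N (suc i) ≤ N i
  2N≤N {i} i<k = begin
    N (suc i) ℕ.+ N (suc i)  ≡⟨ cong (λ t → N (suc i) ℕ.+ t) (ℕₚ.+-identityʳ (N (suc i))) ⟨
    2 ℕ.* N (suc i)          ≡⟨ ℕₚ.*-comm 2 (N (suc i)) ⟩
    N (suc i) ℕ.* 2          ≤⟨ ℕₚ.*-monoʳ-≤ (N (suc i)) (1<g i<k) ⟩
    N (suc i) ℕ.* g i        ≡⟨ N-step i ⟨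
    N i                    ∎
    where open ℕₚ.≤-Reasoning

  special-Head : ∀ {i} → i < k → Head N g i (special i)
  special-Head {i} i<k with suc i ℕ.≟ k
  ... | no i≢k = record
    { <N   = subst (_< N i) (sym (special-< i+1<k)) (ℕₚ.<-≤-trans (ℕₚ.+-monoˡ-< (N (suc i)) 1<N) (2N≤N i<k))
    ; g∤   = g∤suc ∘ ℕᵈ.∣-trans (g-∣ (ℕₚ.n≤1+n i)) ∘ subst (g i ℕᵈ.∣_) (special-< i+1<k)
    ; fork = inj₁ (ℕₚ.m≤m+n (N (suc i)) _)
    }
    where
    i+1<k = ℕₚ.≤∧≢⇒< i<k i≢k
    1<N : 1 < N (suc i)
    1<N = ℕₚ.<-≤-trans (1<g i+1<k) (ℕᵈ.∣⇒≤ (g∣N (suc i)))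
    g∤suc : ¬ g (suc i) ℕᵈ.∣ suc (N (suc i))
    g∤suc g∣ = g≢1 i+1<k (ℕᵈ.∣1⇒≡1 (ℕᵈ.∣m+n∣m⇒∣n (subst (g (suc i) ℕᵈ.∣_) (ℕₚ.+-comm 1 (N (suc i))) g∣)
      (g∣N (suc i))))
  ... | yes i≡k = record
    { <N   = subst (_< N i) (sym (special-≡ i≡k)) (ℕₚ.<-≤-trans
      (ℕₚ.m<m+n (N (suc i)) (ℕ.>-nonZero⁻¹ (N (suc i)))) (2N≤N i<k))
    ; g∤   = λ g∣ → g≢1 i<k (ℕᵈ.∣1⇒≡1 (subst (g i ℕᵈ.∣_) g≡1 (g∣g g∣)))
    ; fork = inj₁ (ℕₚ.m≤m+n (N (suc i)) _)
    }
    where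
    g≡1 : g (suc i) ≡ 1
    g≡1 = trans (cong g i≡k) gk≡1
    -- Here `special i` is `N k`; a common divisor of `N k` and `d` divides `g k = 1`.
    g∣g : g i ℕᵈ.∣ special i → g i ℕᵈ.∣ g (suc i)
    g∣g g∣ = subst (g i ℕᵈ.∣_) (sym (g-gcd (suc i)))
      (gcd-greatest (subst (g i ℕᵈ.∣_) (special-≡ i≡k) g∣) (g∣d i))

  other? : ∀ i → Decidable (λ u → Head N g i u × u ≢ special i)
  other? i u = head? ×-dec ¬? (u ℕ.≟ special i)
    where
    head? : Dec (Head N g i u)
    head? = map′ (λ { (p , q , r) → record { <N = p ; g∤ = q ; fork = r } }) (λ h → <N h , g∤ h , fork h)
      ((u ℕ.<? N i) ×-dec ¬? (g i ℕᵈ.∣? u) ×-dec ((N (suc i) ℕ.≤? u) ⊎-dec (g (suc i) ℕᵈ.∣? u)))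

  -- The special head comes first because the exceptional modulus opens each level in the list of
  -- moduli for S.
  others heads : ℕ → List ℕ
  others i = filter (other? i) (downFrom (N i))
  heads i = special i ∷ others i

  ∈heads⇒Head : ∀ {i u} → i < k → u ∈ heads i → Head N g i u
  ∈heads⇒Head {i} i<k (here refl) = special-Head i<k
  ∈heads⇒Head {i} i<k (there u∈)  = proj₁ (proj₂ (∈-filter⁻ (other? i) {xs = downFrom (N i)} u∈))

  Head⇒∈heads : ∀ {i u} → Head N g i u → u ∈ heads i
  Head⇒∈heads {i} {u} h with u ℕ.≟ special i
  ... | yes refl = here refl
  ... | no u≢ = there (∈-filter⁺ (other? i) (∈-downFrom⁺ (<N h)) (h , u≢))

  others-≢ : ∀ {i u} → u ∈ others i → u ≢ special i
  others-≢ {i} u∈ = proj₂ (proj₂ (∈-filter⁻ (other? i) {xs = downFrom (N i)} u∈))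

  heads-unique : ∀ i → Unique (heads i)
  heads-unique i = All.tabulate (λ u∈ eq → others-≢ u∈ (sym eq))
                 ∷ Unique.filter⁺ (other? i) (Unique.downFrom⁺ (N i))

  index : ℕ → List (ℕ × ℕ)
  index zero    = []
  index (suc l) = index l ++ map (l ,_) (heads l)

  ∈index⇒ : ∀ l {i u} → (i , u) ∈ index l → i < l × u ∈ heads i
  ∈index⇒ (suc l) x∈ with ∈-++⁻ (index l) x∈
  ... | inj₁ x∈l = let i<l , u∈ = ∈index⇒ l x∈l in ℕₚ.m≤n⇒m≤1+n i<l , u∈
  ... | inj₂ x∈  with _ , u∈ , refl ← ∈-map⁻ (l ,_) x∈ = ℕₚ.≤-refl , u∈

  ⇒∈index : ∀ l {i u} → i < l → u ∈ heads i → (i , u) ∈ index l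
  ⇒∈index (suc l) {i} i<1+l u∈ with i ℕ.≟ l
  ... | yes refl = ∈-++⁺ʳ (index l) (∈-map⁺ (l ,_) u∈)
  ... | no i≢l = ∈-++⁺ˡ (⇒∈index l (ℕₚ.≤∧≢⇒< (ℕₚ.≤-pred i<1+l) i≢l) u∈)

  index-unique : ∀ l → Unique (index l)
  index-unique zero    = []
  index-unique (suc l) = Unique.++⁺ (index-unique l) (Unique.map⁺ (λ { refl → refl }) (heads-unique l))
    λ { (x∈l , x∈) → case x∈l x∈ }
    where
    case : ∀ {x} → x ∈ index l → ¬ x ∈ map (l ,_) (heads l)
    case x∈l x∈ with _ , _ , refl ← ∈-map⁻ (l ,_) x∈ = ℕₚ.n≮n l (proj₁ (∈index⇒ l x∈l))

  -- The non-multiples of `g i` below `N i` number `N i - N (i + 1)`. They split into the heads and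
  -- the `u < N (i + 1)` not divisible by `g (i + 1)`, of which there are `N (i + 1) - N (i + 2)`.
  -- The successor accounts for the special head.
  length-others : ∀ {i} → i < k → suc (length (others i)) ≡ (N i ℕ.+ N (suc (suc i))) ∸ 2 ℕ.* N (suc i)
  length-others {i} i<k = sym (trans (cong (_∸ 2 ℕ.* M) total) (ℕₚ.m+n∸n≡m (suc h) (2 ℕ.* M)))
    where
    M = N (suc i)
    h = length (others i)
    c = count (λ u → ¬? (g (suc i) ℕᵈ.∣? u)) M
    ∣∤? : ∀ t → Decidable (λ u → ¬ t ℕᵈ.∣ u)
    ∣∤? t u = ¬? (t ℕᵈ.∣? u)
    complement : ∀ t .{{_ : NonZero t}} q → q ℕ.* t ≡ q ℕ.+ count (∣∤? t) (q ℕ.* t)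
    complement t q = trans (sym (count-all ⊤? (q ℕ.* t) _))
      (trans (count-split ⊤? (t ℕᵈ.∣?_) (∣∤? t) (q ℕ.* t)
        (λ {u} _ _ → dec u) (λ _ t∣u → tt , λ t∤u → t∤u t∣u) (λ _ _ → tt))
      (cong (ℕ._+ count (∣∤? t) (q ℕ.* t)) (count-∣ t q)))
      where
      ⊤? : Decidable (λ (_ : ℕ) → ⊤)
      ⊤? u = yes tt
      dec : ∀ u → t ℕᵈ.∣ u ⊎ ¬ t ℕᵈ.∣ u
      dec u with t ℕᵈ.∣? u
      ... | yes p = inj₁ p
      ... | no ¬p = inj₂ ¬p
    M≡ : M ≡ N (suc (suc i)) ℕ.+ c
    M≡ = subst (λ t → t ≡ N (suc (suc i)) ℕ.+ count (∣∤? (g (suc i))) t) (sym (N-step (suc i)))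
           (complement (g (suc i)) (N (suc (suc i))))
    Low : ℕ → Set
    Low u = u < M × ¬ g (suc i) ℕᵈ.∣ u
    low? : Decidable Low
    low? u = (u ℕ.<? M) ×-dec ∣∤? (g (suc i)) u
    Special⊎Other : ℕ → Set
    Special⊎Other u = u ≡ special i ⊎ (Head N g i u × u ≢ special i)
    all? : Decidable Special⊎Other
    all? u = (u ℕ.≟ special i) ⊎-dec other? i u
    Head⇒ : ∀ {u} → Head N g i u → Special⊎Other u
    Head⇒ {u} hd with u ℕ.≟ special i
    ... | yes p = inj₁ p
    ... | no ¬p = inj₂ (hd , ¬p)
    ⇒Head : ∀ {u} → Special⊎Other u → Head N g i u
    ⇒Head (inj₁ refl)     = special-Head i<k
    ⇒Head (inj₂ (hd , _)) = hd
    non-multiples : count (∣∤? (g i)) (N i) ≡ suc h ℕ.+ c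
    non-multiples = trans
      (count-split (∣∤? (g i)) all? low? (N i)
        (λ {u} u<N g∤u → split u u<N g∤u)
        (λ _ so → g∤ (⇒Head so) , λ { (u<M , g∤u) → not-low (⇒Head so) u<M g∤u })
        (λ _ low g∣u → proj₂ low (ℕᵈ.∣-trans (g-∣ (ℕₚ.n≤1+n i)) g∣u)))
      (cong₂ ℕ._+_
        (trans (count-split all? (ℕ._≟ special i) (other? i) (N i)
            (λ _ so → so) (λ _ p → inj₁ p , λ q → proj₂ q p) (λ _ → inj₂))
          (cong (ℕ._+ h) (count-≡ (special i) (N i) (<N (special-Head i<k)))))
        (count-truncate (∣∤? (g (suc i))) (N i) (ℕᵈ.∣⇒≤ (N-∣-suc i))))
      where
      not-low : ∀ {u} → Head N g i u → u < M → ¬ ¬ g (suc i) ℕᵈ.∣ u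
      not-low hd u<M g∤u with fork hd
      ... | inj₁ M≤u = ℕₚ.<⇒≱ u<M M≤u
      ... | inj₂ g∣u = g∤u g∣u
      split : ∀ u → u < N i → ¬ g i ℕᵈ.∣ u → Special⊎Other u ⊎ Low u
      split u u<N g∤u with low? u
      ... | yes low = inj₂ low
      ... | no ¬low = inj₁ (Head⇒ (record { <N = u<N ; g∤ = g∤u ; fork = fork′ }))
        where
        fork′ : M ≤ u ⊎ g (suc i) ℕᵈ.∣ u
        fork′ with M ℕ.≤? u | g (suc i) ℕᵈ.∣? u
        ... | yes p | _     = inj₁ p
        ... | no ¬p | yes q = inj₂ q
        ... | no ¬p | no ¬q = contradiction (ℕₚ.≰⇒> ¬p , ¬q) ¬low
    N≡ : N i ≡ M ℕ.+ (suc h ℕ.+ c)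
    N≡ = trans (subst (λ t → t ≡ M ℕ.+ count (∣∤? (g i)) t) (sym (N-step i)) (complement (g i) M))
           (cong (λ t → M ℕ.+ t) non-multiples)
    total : N i ℕ.+ N (suc (suc i)) ≡ suc h ℕ.+ 2 ℕ.* M
    total = begin
      N i ℕ.+ N₂                      ≡⟨ cong (ℕ._+ N₂) N≡ ⟩
      (M ℕ.+ (suc h ℕ.+ c)) ℕ.+ N₂        ≡⟨ lem M (suc h) c N₂ ⟩
      suc h ℕ.+ (M ℕ.+ (N₂ ℕ.+ c))        ≡⟨ cong (λ t → suc h ℕ.+ (M ℕ.+ t)) M≡ ⟨
      suc h ℕ.+ (M ℕ.+ M)               ≡⟨ cong (λ t → suc h ℕ.+ (M ℕ.+ t)) (ℕₚ.+-identityʳ M) ⟨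
      suc h ℕ.+ 2 ℕ.* M                 ∎
      where
      open ≡-Reasoning
      N₂ = N (suc (suc i))
      lem : ∀ a b c e → (a ℕ.+ (b ℕ.+ c)) ℕ.+ e ≡ b ℕ.+ (a ℕ.+ (e ℕ.+ c))
      lem = ℕ-solve-∀

-- Isomorphisms and sums of cyclic groups

open Iso

Iso-trans : ∀ {G H K} → (∀ {x y z} → SGroup._≈_ K x y → SGroup._≈_ K y z → SGroup._≈_ K x z) → Iso G H → Iso H K → Iso G K
Iso-trans tr f g = record
  { to         = to g ∘ to f
  ; to-cong    = to-cong g ∘ to-cong f
  ; to-hom     = λ x y → tr (to-cong g (to-hom f x y)) (to-hom g (to f x) (to f y))
  ; injective  = injective f ∘ injective g
  ; surjective = λ z → let y , gy≈z = surjective g z ; x , fx≈y = surjective f y in x , tr (to-cong g fx≈y) gy≈z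
  }

CycSum-trans : ∀ L {a b c} → SGroup._≈_ (CycSum L) a b → SGroup._≈_ (CycSum L) b c → SGroup._≈_ (CycSum L) a c
CycSum-trans L {a} {b} {c} a≈b b≈c j = ∣⇒∣ᵤ {z} (subst (z ∣_) (lem (a j) (b j) (c j))
  (∣m∣n⇒∣m+n (∣ᵤ⇒∣ {z} {a j - b j} (a≈b j)) (∣ᵤ⇒∣ {z} {b j - c j} (b≈c j))))
  where
  z = + lookup L j
  lem : ∀ x y z → (x - y) + (y - z) ≡ x - z
  lem = solve-∀

-- A direct sum of cyclic groups indexed by pairs of level and residue: coordinates are defined on
-- all pairs and compared only on `I`.
CycFam : List (ℕ × ℕ) → (ℕ × ℕ → ℕ) → SGroup
CycFam I md = record
  { Carrier = ℕ × ℕ → ℤ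
  ; _≈_     = λ a b → ∀ {x} → x ∈ I → + md x ∣ a x - b x
  ; _∙_     = λ a b x → a x + b x
  }

module _ (md : ℕ × ℕ → ℕ) where

  read : ∀ I → (ℕ × ℕ → ℤ) → Fin (length (map md I)) → ℤ
  read (x ∷ I) a zero    = a x
  read (x ∷ I) a (suc j) = read I a j

  write : ∀ I → (Fin (length (map md I)) → ℤ) → ℕ × ℕ → ℤ
  write []      c y = 0ℤ
  write (x ∷ I) c y with y ≟× x
  ... | yes _ = c zero
  ... | no  _ = write I (c ∘ suc) y

  read-cong : ∀ I a b → (∀ {x} → x ∈ I → a x ≡ b x) → ∀ j → read I a j ≡ read I b j
  read-cong (x ∷ I) a b eq zero    = eq (here refl)
  read-cong (x ∷ I) a b eq (suc j) = read-cong I a b (eq ∘ there) j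

  read-write : ∀ {I} → Unique I → ∀ c j → read I (write I c) j ≡ c j
  read-write {x ∷ I} (x∉ ∷ u) c zero with x ≟× x
  ... | yes _   = refl
  ... | no  x≢x = contradiction refl x≢x
  read-write {x ∷ I} (x∉ ∷ u) c (suc j) = trans (read-cong I _ _ skip j) (read-write u (c ∘ suc) j)
    where
    skip : ∀ {y} → y ∈ I → write (x ∷ I) c y ≡ write I (c ∘ suc) y
    skip {y} y∈ with y ≟× x
    ... | yes refl = contradiction refl (All.lookup x∉ y∈)
    ... | no  _    = refl

  read-∙ : ∀ I a b j → read I (λ x → a x + b x) j ≡ read I a j + read I b j
  read-∙ (x ∷ I) a b zero    = refl
  read-∙ (x ∷ I) a b (suc j) = read-∙ I a b j

  read-∣ : ∀ I {a b} → (∀ {x} → x ∈ I → + md x ∣ a x - b x) →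
           ∀ j → + lookup (map md I) j Unsigned.∣ read I a j - read I b j
  read-∣ (x ∷ I) h zero    = ∣⇒∣ᵤ (h (here refl))
  read-∣ (x ∷ I) h (suc j) = read-∣ I (h ∘ there) j

  ∣-read : ∀ I {a b} → (∀ j → + lookup (map md I) j Unsigned.∣ read I a j - read I b j) →
           ∀ {x} → x ∈ I → + md x ∣ a x - b x
  ∣-read (x ∷ I) h (here refl) = ∣ᵤ⇒∣ (h zero)
  ∣-read (x ∷ I) h (there x∈)  = ∣-read I (h ∘ suc) x∈

  ∣-refl-difference : ∀ {z x y} → x ≡ y → z Unsigned.∣ x - y
  ∣-refl-difference {z} {x} refl = ∣⇒∣ᵤ {z} (divides 0ℤ (ℤₚ.+-inverseʳ x))

  CycFam≅CycSum : ∀ I → Unique I → Iso (CycFam I md) (CycSum (map md I))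
  CycFam≅CycSum I u = record
    { to         = read I
    ; to-cong    = read-∣ I
    ; to-hom     = λ a b j → ∣-refl-difference {+ lookup (map md I) j} (read-∙ I a b j)
    ; injective  = λ h x∈ → ∣-read I h x∈
    ; surjective = λ c → write I c , λ j → ∣-refl-difference {+ lookup (map md I) j} (read-write u c j)
    }

-- From polynomials to coordinates

module Embedding (m : ℕ) where

  open Basis m

  private
    n = suc m

  mono-cong : ∀ {u v} → u ≡ v [mod n ] → mono n u ≗ mono n v
  mono-cong p j = cong (λ t → if does (toℕ j ℕ.≟ t) then + 1 else + 0) (mod⇒%≡ p)

  e-periodic : ∀ j → Periodic (λ v → e n v j)
  e-periodic j = record
    { at-0     = ℤₚ.+-inverseʳ (mono n 0 j)
    ; periodic = λ p → cong (_- mono n 0 j) (mono-cong p j)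
    }

  elemZ-E : ∀ v → elemZ n (E v) ≗ e n v
  elemZ-E v = extend-E {h = e n} e-periodic v

  -- The summand -1 of each e_v affects only the constant coefficient, so the other coefficients
  -- recover `a`. Spans can therefore be compared in coordinates.
  elemZ-suc : ∀ a j → elemZ n a (suc j) ≡ a j
  elemZ-suc a j = trans (sumFin-cong m λ i → cong (a i *_) (ℤₚ.+-identityʳ (E (suc (toℕ i)) j))) (E-expand a j)

  module _ {l} {G : Fin l → Poly n} {h : Fin l → Poly m} (G≗h : ∀ i → G i ≗ elemZ n (h i)) where

    lc-elemZ : ∀ c → lc c G ≗ elemZ n (lc c h)
    lc-elemZ c j = trans (lc-congʳ c G≗h j) (sym (lc-lc c h (eGens n) j))

    InSpan⇒ : ∀ {p a} → p ≗ elemZ n a → InSpan G p → InSpan h a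
    InSpan⇒ {p} {a} p≗a (c , eq) = c , λ j → trans (sym (elemZ-suc a j))
      (trans (sym (p≗a (suc j))) (trans (eq (suc j)) (trans (lc-elemZ c (suc j)) (elemZ-suc (lc c h) j))))

    InSpan⇐ : ∀ {p a} → p ≗ elemZ n a → InSpan h a → InSpan G p
    InSpan⇐ {p} {a} p≗a (c , eq) = c , λ j → trans (p≗a j)
      (trans (lc-cong (eGens n) eq j) (sym (lc-elemZ c j)))

-- The structure of Σ₀

module Sigma (m d : ℕ) .{{d≢0 : NonZero d}} (N g : ℕ → ℕ)
  (N-zero : N 0 ≡ suc m) (g-gcd : ∀ i → g i ≡ gcd (N i) d) (N-step : ∀ i → N i ≡ N (suc i) ℕ.* g i)
  (k : ℕ) (gk≡1 : g k ≡ 1) (g≢1 : ∀ {i} → i < k → g i ≢ 1) where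

  open DSequence (suc m) d N g N-zero g-gcd N-step public
  open Heads (suc m) d N g N-zero g-gcd N-step k gk≡1 g≢1 public

  I : List (ℕ × ℕ)
  I = index k

  ∈I⇒< : ∀ {i u} → (i , u) ∈ I → i < k
  ∈I⇒< x∈ = proj₁ (∈index⇒ k x∈)

  ∈I⇒Head : ∀ {i u} → (i , u) ∈ I → Head N g i u
  ∈I⇒Head x∈ = ∈heads⇒Head (∈I⇒< x∈) (proj₂ (∈index⇒ k x∈))

  Head⇒∈I : ∀ {i u} → i < k → Head N g i u → (i , u) ∈ I
  Head⇒∈I i<k h = ⇒∈index k i<k (Head⇒∈heads h)

  open Basis m public
  open Chains m d N g N-zero g-gcd N-step k gk≡1 I (index-unique k) ∈I⇒< ∈I⇒Head Head⇒∈I public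
  open Span relation public
  open Embedding m public

  private
    n = suc m

  εGens≗ : ∀ i → εGens n d i ≗ elemZ n (relation i)
  εGens≗ i j = sym (trans (lc-⊟ (+ d · E v) (E (d ℕ.* v)) (eGens n) j)
    (cong₂ _-_ (trans (lc-· (+ d) (E v) (eGens n) j) (cong (+ d *_) (elemZ-E v j))) (elemZ-E (d ℕ.* v) j)))
    where v = suc (toℕ i)

  level-order : ℕ × ℕ → ℕ
  level-order (i , _) = d ^ suc i

  p≈0⇒ : ∀ {z a} → InSpan (εGens n d) (λ j → z * elemZ n a j) → z · a ≈ 𝟎
  p≈0⇒ {z} {a} s = InSpan⇒≈𝟎 (InSpan⇒ {G = εGens n d} {relation} εGens≗ (λ j → sym (lc-· z a (eGens n) j)) s)

  comb-π : ∀ {x} c → x ∈ I → ⟨ comb c , π̂ x ⟩ ≡ c x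
  comb-π {x} c x∈ = begin
    ⟨ comb c , π̂ x ⟩                       ≡⟨ ⟨⟩-sumL I (λ y → c y · b y) (π̂ x) ⟩
    sumL I (λ y → ⟨ c y · b y , π̂ x ⟩)
      ≡⟨ sumL-cong I (λ {y} y∈ → trans (⟨⟩-· (c y) (b y) (π̂ x)) (cong (c y *_) (⟨b,π⟩ x∈ y∈))) ⟩
    sumL I (λ y → c y * 𝟙 (x ≟× y))        ≡⟨ sumL-single (index-unique k) x∈ _ (λ {y} _ y≢x →
         trans (cong (c y *_) (𝟙-no (x ≟× y) (y≢x ∘ sym))) (ℤₚ.*-zeroʳ (c y))) ⟩
    c x * 𝟙 (x ≟× x)                       ≡⟨ trans (cong (c x *_) (𝟙-yes (x ≟× x) refl)) (ℤₚ.*-identityʳ (c x)) ⟩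
    c x                                    ∎
    where open ≡-Reasoning

  π-cong : ∀ {x a a′} → x ∈ I → a ≈ a′ → + level-order x ∣ ⟨ a , π̂ x ⟩ - ⟨ a′ , π̂ x ⟩
  π-cong {x} x∈ = ⟨⟩-≈ (π̂ x) (π-relation x∈)

  d^k : ℤ
  d^k = + (d ^ k)

  comb-torsion : ∀ c → d^k · comb c ≈ 𝟎
  comb-torsion c = ≈-trans (≗⇒≈ λ j → trans (sym (sumL-*ˡ I d^k _)) (sumL-cong I λ {x} _ → lem d^k (c x) (b x j)))
    (≈-trans (sumL-≈ I {g = λ _ → 𝟎} λ {x} x∈ → ≈-trans (·-cong (c x) (torsion x∈)) (≗⇒≈ λ _ → ℤₚ.*-zeroʳ (c x)))
      (≗⇒≈ λ _ → sumL-0 I λ _ → refl))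
    where
    lem : ∀ x y z → x * (y * z) ≡ y * (x * z)
    lem = solve-∀
    torsion : ∀ {x} → x ∈ I → d^k · b x ≈ 𝟎
    torsion {i , u} x∈ with ^-∣-^ d (∈I⇒< x∈)
    ... | divides q eq = ≈-trans (≗⇒≈ λ j → trans (cong (_* b (i , u) j) eq) (ℤₚ.*-assoc q _ (b (i , u) j)))
          (≈-trans (·-cong q (b-torsion i u)) (≗⇒≈ λ _ → ℤₚ.*-zeroʳ q))

  expand-torsion : ∀ {a} → d^k · a ≈ 𝟎 → a ≈ comb (λ x → ⟨ a , π̂ x ⟩)
  expand-torsion {a} tors = ≈-trans (expand-chains a) (≈-trans (⊞-cong (≈-refl {c}) vanish)
    (≗⇒≈ λ j → ℤₚ.+-identityʳ (c j)))
    where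
    R = proj₁ (period gk≡1)
    c = comb (λ x → ⟨ a , π̂ x ⟩)
    vanish : + (d ^ (k ℕ.+ R)) · a ≈ 𝟎
    vanish = ≈-trans (≗⇒≈ λ j → trans (cong (_* a j) (trans (pos-^-+ d k R) (ℤₚ.*-comm d^k (+ (d ^ R)))))
                                  (ℤₚ.*-assoc (+ (d ^ R)) d^k (a j)))
               (≈-trans (·-cong (+ (d ^ R)) tors) (≗⇒≈ λ _ → ℤₚ.*-zeroʳ (+ (d ^ R))))

  comb≈𝟎 : ∀ {c} → (∀ {x} → x ∈ I → + level-order x ∣ c x) → comb c ≈ 𝟎
  comb≈𝟎 {c} h = ≈-trans (sumL-≈ I {g = λ _ → 𝟎} λ x∈ → term x∈ (h x∈)) (≗⇒≈ λ _ → sumL-0 I λ _ → refl)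
    where
    term : ∀ {x} → x ∈ I → + level-order x ∣ c x → c x · b x ≈ 𝟎
    term {x@(i , u)} _ (divides q eq) =
      ≈-trans (≗⇒≈ λ j → trans (cong (_* b x j) eq) (ℤₚ.*-assoc q _ (b x j)))
        (≈-trans (·-cong q (b-torsion i u)) (≗⇒≈ λ _ → ℤₚ.*-zeroʳ q))

  π-injective : ∀ {a} → d^k · a ≈ 𝟎 → (∀ {x} → x ∈ I → + level-order x ∣ ⟨ a , π̂ x ⟩) → a ≈ 𝟎
  π-injective tors h = ≈-trans (expand-torsion tors) (comb≈𝟎 h)

  ⊟-torsion : ∀ {z a a′} → z · a ≈ 𝟎 → z · a′ ≈ 𝟎 → z · (a ⊟ a′) ≈ 𝟎
  ⊟-torsion {z} {a} {a′} p q = ≈-trans (≗⇒≈ λ j → *-distribˡ-minus z (a j) (a′ j)) (⊟-cong p q)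

  ⊟≈𝟎 : ∀ {a a′} → a ⊟ a′ ≈ 𝟎 → a ≈ a′
  ⊟≈𝟎 p = mk (≈𝟎⇒InSpan p)

  InSpan⇒≈ : ∀ {l} {G : Fin l → Poly n} {h : Fin l → Poly m} (G≗h : ∀ i → G i ≗ elemZ n (h i)) a a′ →
    InSpan G (λ j → elemZ n a j - elemZ n a′ j) → InSpan h (a ⊟ a′)
  InSpan⇒≈ G≗h a a′ = InSpan⇒ G≗h (λ j → sym (lc-⊟ a a′ (eGens n) j))

  ≈⇒InSpan : ∀ {l} {G : Fin l → Poly n} {h : Fin l → Poly m} (G≗h : ∀ i → G i ≗ elemZ n (h i)) a a′ →
    InSpan h (a ⊟ a′) → InSpan G (λ j → elemZ n a j - elemZ n a′ j)
  ≈⇒InSpan G≗h a a′ = InSpan⇐ G≗h (λ j → sym (lc-⊟ a a′ (eGens n) j))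

  -- The functionals `π̂` are the coordinates: `π-relation` makes them well defined, the expansion
  -- of torsion elements makes them injective, and duality with the `b x` makes them surjective.
  Sigma0≅CycFam : Iso (Sigma0 n d k) (CycFam I level-order)
  Sigma0≅CycFam = record
    { to         = λ (a , _) x → ⟨ a , π̂ x ⟩
    ; to-cong    = λ {(a , _)} {(a′ , _)} s {x} x∈ → π-cong {x} {a} {a′} x∈ (mk (InSpan⇒≈ εGens≗ a a′ s))
    ; to-hom     = λ (a , _) (a′ , _) {x} x∈ → divides 0ℤ (ℤₚ.i≡j⇒i-j≡0 (⟨⟩-⊞ a a′ (π̂ x)))
    ; injective  = λ {(a , s)} {(a′ , s′)} h → ≈⇒InSpan εGens≗ a a′
        (span (⊟≈𝟎 {a} {a′} (π-injective {a ⊟ a′} (⊟-torsion {d^k} {a} {a′} (p≈0⇒ {d^k} {a} s) (p≈0⇒ {d^k} {a′} s′))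
          λ {x} x∈ → subst (+ level-order x ∣_) (sym (⟨⟩-⊟ a a′ (π̂ x))) (h x∈))))
    ; surjective = λ c → (comb c , InSpan⇐ εGens≗ (λ j → sym (lc-· d^k (comb c) (eGens n) j))
      (≈𝟎⇒InSpan (comb-torsion c)))
        , λ {x} x∈ → divides 0ℤ (ℤₚ.i≡j⇒i-j≡0 (comb-π c x∈))
    }

-- Multiplication by x - 1 on the augmentation ideal

module Difference (m : ℕ) where

  open Basis m

  private
    n = suc m

  E-n : E n ≗ 𝟎
  E-n j = trans (E-cong n≡0 j) (E-zero j)
    where
    n≡0 : n ≡ 0 [mod n ]
    n≡0 = mod (divides 1ℤ (trans (ℤₚ.+-identityʳ (+ n)) (sym (ℤₚ.*-identityˡ (+ n)))))

  -- This is (x - 1) e_v, written in the basis of the augmentation ideal.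
  δ : ℕ → Poly m
  δ v = E (suc v) ⊟ E v ⊟ E 1

  Δ : Poly m → Poly m
  Δ = extend δ

  Δ-E : ∀ v → Δ (E v) ≗ δ v
  Δ-E = extend-E {h = δ} λ j → record
    { at-0     = trans (cong (λ t → E 1 j - t - E 1 j) (E-zero j)) (lem (E 1 j))
    ; periodic = λ {u} {v} p → cong₂ (λ s t → s - t - E 1 j)
        (E-cong (subst₂ _≡_[mod n ] (ℕₚ.+-comm u 1) (ℕₚ.+-comm v 1) (mod-+ 1 p)) j) (E-cong p j)
    }
    where
    lem : ∀ x → x - 0ℤ - x ≡ 0ℤ
    lem = solve-∀

  Δ-⊟ : ∀ a a′ → Δ (a ⊟ a′) ≗ Δ a ⊟ Δ a′
  Δ-⊟ a a′ = lc-⊟ a a′ (δ ∘ suc ∘ toℕ)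

  Δ-⊞ : ∀ a a′ → Δ (a ⊞ a′) ≗ Δ a ⊞ Δ a′
  Δ-⊞ a a′ = lc-+ a a′ (δ ∘ suc ∘ toℕ)

  Δ-· : ∀ z a → Δ (z · a) ≗ z · Δ a
  Δ-· z a = lc-· z a (δ ∘ suc ∘ toℕ)

  Δ-cong : ∀ {a a′} → a ≗ a′ → Δ a ≗ Δ a′
  Δ-cong = lc-cong (δ ∘ suc ∘ toℕ)

  Δ-lc : ∀ {l} (c : Fin l → ℤ) (h : Fin l → Poly m) → Δ (lc c h) ≗ lc c (Δ ∘ h)
  Δ-lc c h = lc-lc c h (δ ∘ suc ∘ toℕ)

  Δ-range : ∀ i l (f : ℕ → Poly m) → Δ (λ j → range i l (λ t → f t j)) ≗ λ j → range i l (λ t → Δ (f t) j)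
  Δ-range i l f j = ⟨⟩-range i l f (λ i → δ (suc (toℕ i)) j)

  block : ℕ → ℕ → Poly m
  block w l j = range 0 l (λ t → E (w ℕ.+ t) j)

  Δ-block : ∀ w l → Δ (block w l) ≗ E (w ℕ.+ l) ⊟ E w ⊟ (+ l) · E 1
  Δ-block w l j =
    trans (Δ-range 0 l (λ t → E (w ℕ.+ t)) j)
    (trans (range-cong 0 l λ t _ _ → trans (Δ-E (w ℕ.+ t) j)
      (cong (λ s → E s j - E (w ℕ.+ t) j - E 1 j) (sym (ℕₚ.+-suc w t))))
    (trans (sym (range-minus 0 l (λ t → f (suc t) - f t) (λ _ → E 1 j)))
      (cong₂ _-_ (trans (range-telescope′ 0 l f) (cong (λ t → f l - E t j) (ℕₚ.+-identityʳ w)))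
        (range-const 0 l (E 1 j)))))
    where
    f : ℕ → ℤ
    f t = E (w ℕ.+ t) j

  -- As a polynomial this is 1 + x + ... + x^(v-1) minus the constant `v`.
  prefix : ℕ → Poly m
  prefix = block 0

  Δ-prefix : ∀ v → Δ (prefix v) ≗ E v ⊟ (+ v) · E 1
  Δ-prefix v j = trans (Δ-block 0 v j)
    (cong (_- + v * E 1 j) (trans (cong (λ t → E v j - t) (E-zero j)) (ℤₚ.+-identityʳ (E v j))))

  -- (x ^ v - 1) / (x - 1) = 1 + x + … + x ^ (v - 1); subtracting v / n times 1 + x + … + x ^ (n - 1) moves this
  -- quotient into the augmentation ideal, and n clears the denominator.
  γ : ℕ → Poly m
  γ v = (+ n) · prefix v ⊟ (+ v) · prefix n

  γ-n : γ n ≗ 𝟎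
  γ-n j = ℤₚ.+-inverseʳ (+ n * prefix n j)

  Γ : Poly m → Poly m
  Γ = extend (λ v → γ (v % n))

  -- The endpoint `v = n` is included because `γ n` and `γ 0` both vanish; `Γ-Δ` meets it in `δ m`.
  Γ-E : ∀ v → v ≤ n → Γ (E v) ≗ γ v
  Γ-E v v≤n j = trans (extend-E {h = λ v → γ (v % n)} (λ j → record
      { at-0 = lem (+ n) (prefix n j) ; periodic = λ p → cong (λ t → γ t j) (mod⇒%≡ p) }) v j) eq
    where
    lem : ∀ x y → x * 0ℤ - 0ℤ * y ≡ 0ℤ
    lem = solve-∀
    eq : γ (v % n) j ≡ γ v j
    eq with v ℕ.≟ n
    ... | yes refl = trans (cong (λ t → γ t j) (ℕ%.n%n≡0 n)) (trans (lem (+ n) (prefix n j)) (sym (γ-n j)))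
    ... | no  v≢n  = cong (λ t → γ t j) (ℕ%.m<n⇒m%n≡m (ℕₚ.≤∧≢⇒< v≤n v≢n))

  Γ-Δ : ∀ a → Γ (Δ a) ≗ (+ n) · a
  Γ-Δ a j =
    trans (lc-lc a (δ ∘ suc ∘ toℕ) (λ i → γ (suc (toℕ i) % n)) j)
    (trans (lc-congʳ a {h = λ i → (+ n) · E (suc (toℕ i))} (λ i → on-E (suc (toℕ i)) (toℕ<n i)) j)
    (trans (sumFin-cong m λ i → lem (a i) (+ n) (E (suc (toℕ i)) j))
    (trans (sumFin-*ˡ m (+ n) _) (cong (+ n *_) (E-expand a j)))))
    where
    γ̂ : Fin m → Poly m
    γ̂ i = γ (suc (toℕ i) % n)
    lem : ∀ a n e → a * (n * e) ≡ n * (a * e)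
    lem = solve-∀
    lem′ : ∀ n p e v q p₁ → (n * (p + e) - (1ℤ + v) * q) - (n * p - v * q) - (n * (0ℤ + 0ℤ) - 1ℤ * q) ≡ n * e
    lem′ = solve-∀
    on-E : ∀ v → v ≤ m → Γ (δ v) ≗ (+ n) · E v
    on-E v v≤m j =
      trans (lc-⊟ (E (suc v) ⊟ E v) (E 1) γ̂ j)
      (trans (cong₂ _-_ (trans (lc-⊟ (E (suc v)) (E v) γ̂ j)
        (cong₂ _-_ (Γ-E (suc v) (s≤s v≤m) j) (Γ-E v (ℕₚ.m≤n⇒m≤1+n v≤m) j))) (Γ-E 1 (s≤s z≤n) j))
      (trans (cong₂ (λ s t → (+ n * s - + suc v * prefix n j) - γ v j - (+ n * (t + 0ℤ) - 1ℤ * prefix n j))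
        (range-last 0 v (λ t → E t j)) (E-zero j))
      (lem′ (+ n) (prefix v j) (E v j) (+ v) (prefix n j) 0ℤ)))

  Δ-injective : ∀ {a} → Δ a ≗ 𝟎 → a ≗ 𝟎
  Δ-injective {a} Δa≡0 j = ℤₚ.*-cancelˡ-≡ (+ n) (a j) 0ℤ (trans (sym (Γ-Δ a j))
    (trans (lc-cong (λ i → γ (suc (toℕ i) % n)) Δa≡0 j)
    (trans (sumFin-0 m λ _ → refl) (sym (ℤₚ.*-zeroʳ (+ n))))))

  Δ-injective′ : ∀ {a a′} → Δ a ≗ Δ a′ → a ≗ a′
  Δ-injective′ {a} {a′} eq j = ℤₚ.i-j≡0⇒i≡j (a j) (a′ j)
    (Δ-injective {a ⊟ a′} (λ j → trans (Δ-⊟ a a′ j) (ℤₚ.i≡j⇒i-j≡0 (eq j))) j)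

  -- Residues are represented by integers below `n`, since the weights `T i p / N i` require
  -- division in ℤ.
  θ̂ : Fin m → ℤ
  θ̂ = on-basis (λ v → + (v % n))

  θ : Poly m → ℤ
  θ a = ⟨ a , θ̂ ⟩

  θ-E : ∀ v → θ (E v) ≡ + (v % n)
  θ-E = ⟨E⟩ {λ v → + (v % n)} (record { at-0 = refl ; periodic = λ p → cong +_ (mod⇒%≡ p) })

  n∣% : ∀ v → + n ∣ + (v % n) - + v
  n∣% v = diff (mod-% v)

  n∣θ-Δ : ∀ a → + n ∣ θ (Δ a)
  n∣θ-Δ a = subst (+ n ∣_) (sym (⟨⟩-lc a (δ ∘ suc ∘ toℕ) θ̂)) (∣-sumFin m λ i → ∣n⇒∣m*n (a i) (n∣θδ (suc (toℕ i))))
    where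
    lem : ∀ x y z v → (x - (1ℤ + v)) - (y - v) - (z - 1ℤ) ≡ x - y - z
    lem = solve-∀
    n∣θδ : ∀ v → + n ∣ θ (δ v)
    n∣θδ v = subst (+ n ∣_) (sym (trans (⟨⟩-⊟ (E (suc v) ⊟ E v) (E 1) θ̂)
        (trans (cong (_- θ (E 1)) (⟨⟩-⊟ (E (suc v)) (E v) θ̂))
          (trans (cong₂ _-_ (cong₂ _-_ (θ-E (suc v)) (θ-E v)) (θ-E 1))
            (sym (lem (+ (suc v % n)) (+ (v % n)) (+ (1 % n)) (+ v)))))))
      (∣m∣n⇒∣m-n (∣m∣n⇒∣m-n (n∣% (suc v)) (n∣% v)) (n∣% 1))

  -- The combination `P` of prefixes maps to `a - θ a · E 1`. Since `prefix n` maps to `- n · E 1`,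
  -- subtracting `θ a / n` times it repairs the error.
  Δ-surjective : ∀ a → + n ∣ θ a → ∃ λ a′ → Δ a′ ≗ a
  Δ-surjective a (divides z θa≡zn) = P ⊟ z · prefix n , λ j →
    trans (Δ-⊟ P (z · prefix n) j) (trans (cong₂ _-_ (Δ-P j)
      (trans (Δ-· z (prefix n) j) (cong (z *_) (Δ-prefix n j)))) (final j))
    where
    P = lc a (λ i → prefix (suc (toℕ i)))
    θ≡ : sumFin m (λ i → a i * + suc (toℕ i)) ≡ θ a
    θ≡ = sumFin-cong m λ i → cong (λ t → a i * + t) (sym (ℕ%.m<n⇒m%n≡m (s≤s (toℕ<n i))))
    lem₁ : ∀ a e v x → a * (e - v * x) ≡ a * e + (- x) * (a * v)
    lem₁ = solve-∀
    Δ-P : ∀ j → Δ P j ≡ a j + (- E 1 j) * θ a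
    Δ-P j = trans (Δ-lc a (λ i → prefix (suc (toℕ i))) j)
      (trans (sumFin-cong m λ i → trans (cong (a i *_) (Δ-prefix (suc (toℕ i)) j))
        (lem₁ (a i) (E (suc (toℕ i)) j) (+ suc (toℕ i)) (E 1 j)))
      (trans (sumFin-+ m (λ i → a i * E (suc (toℕ i)) j) (λ i → (- E 1 j) * (a i * + suc (toℕ i))))
        (cong₂ _+_ (E-expand a j) (trans (sumFin-*ˡ m (- E 1 j) _) (cong ((- E 1 j) *_) θ≡)))))
    lem₂ : ∀ a e z n → (a + (- e) * (z * n)) - z * (0ℤ - n * e) ≡ a
    lem₂ = solve-∀
    final : ∀ j → a j + (- E 1 j) * θ a - z * (E n j - + n * E 1 j) ≡ a j
    final j = trans (cong₂ (λ s t → a j + (- E 1 j) * s - z * (t - + n * E 1 j)) θa≡zn (E-n j))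
      (lem₂ (a j) (E 1 j) z (+ n))

-- The structure of S₀

module Sandpile (m d : ℕ) .{{d≢0 : NonZero d}} (N g : ℕ → ℕ)
  (N-zero : N 0 ≡ suc m) (g-gcd : ∀ i → g i ≡ gcd (N i) d) (N-step : ∀ i → N i ≡ N (suc i) ℕ.* g i)
  (k : ℕ) (gk≡1 : g k ≡ 1) (g≢1 : ∀ {i} → i < k → g i ≢ 1) where

  open Sigma m d N g N-zero g-gcd N-step k gk≡1 g≢1 public
  open Difference m public

  private
    n = suc m

  -- In f_v the coefficients sum to zero, so every monomial may be replaced by the corresponding e.
  f : ℕ → Poly m
  f v = + d · E v ⊟ block (d ℕ.* v) d

  f-cong : ∀ {u v} → u ≡ v [mod n ] → f u ≗ f v
  f-cong {u} {v} p j = cong₂ _-_ (cong (+ d *_) (E-cong p j))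
    (range-cong 0 d λ t _ _ → E-cong (mod-+ t (mod-* d p)) j)

  generator : Fin m → Poly m
  generator i = f (suc (toℕ i))

  module 𝓕 = Span generator

  fGens≗ : ∀ i → fGens n d i ≗ elemZ n (generator i)
  fGens≗ i j = sym (begin
    elemZ n (f v) j
      ≡⟨ lc-⊟ (+ d · E v) (block (d ℕ.* v) d) (eGens n) j ⟩
    elemZ n (+ d · E v) j - elemZ n (block (d ℕ.* v) d) j
      ≡⟨ cong₂ _-_ (trans (lc-· (+ d) (E v) (eGens n) j) (cong (+ d *_) (elemZ-E v j)))
           (trans (⟨⟩-range 0 d (λ t → E (d ℕ.* v ℕ.+ t)) (λ i → eGens n i j))
             (range-cong 0 d λ t _ _ → elemZ-E (d ℕ.* v ℕ.+ t) j)) ⟩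
    + d * e n v j - range 0 d (λ t → e n (d ℕ.* v ℕ.+ t) j)
      ≡⟨ cong (λ t → + d * e n v j - t) (trans (sym (range-minus 0 d monos (λ _ → mono n 0 j)))
           (cong₂ _-_ (sym (sumFin-range d monos)) (range-const 0 d (mono n 0 j)))) ⟩
    + d * e n v j - (sumFin d (monos ∘ toℕ) - + d * mono n 0 j)
      ≡⟨ lem (+ d) (mono n v j) (mono n 0 j) (sumFin d (monos ∘ toℕ)) ⟩
    fv n d v j ∎)
    where
    open ≡-Reasoning
    v = suc (toℕ i)
    monos : ℕ → ℤ
    monos t = mono n (d ℕ.* v ℕ.+ t) j
    lem : ∀ d x y s → d * (x - y) - (s - d * y) ≡ d * x - s
    lem = solve-∀

  ε′ : ℕ → Poly m
  ε′ v = + d · E v ⊟ E (d ℕ.* v)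

  ε′≈𝟎 : ∀ v → ε′ v ≈ 𝟎
  ε′≈𝟎 v = InSpan⇒≈𝟎 (span (E-* v))

  Δ-f : ∀ v → Δ (f v) ≗ ε′ (suc v) ⊟ ε′ v
  Δ-f v j = begin
    Δ (f v) j
      ≡⟨ Δ-⊟ (+ d · E v) (block (d ℕ.* v) d) j ⟩
    Δ (+ d · E v) j - Δ (block (d ℕ.* v) d) j
      ≡⟨ cong₂ _-_ (trans (Δ-· (+ d) (E v) j) (cong (+ d *_) (Δ-E v j))) (Δ-block (d ℕ.* v) d j) ⟩
    + d * (E (suc v) j - E v j - E 1 j) - (E (d ℕ.* v ℕ.+ d) j - E (d ℕ.* v) j - + d * E 1 j)
      ≡⟨ lem (+ d) (E (suc v) j) (E v j) (E 1 j) (E (d ℕ.* v ℕ.+ d) j) (E (d ℕ.* v) j) ⟩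
    (+ d * E (suc v) j - E (d ℕ.* v ℕ.+ d) j) - ε′ v j
      ≡⟨ cong (λ t → (+ d * E (suc v) j - E t j) - ε′ v j) (trans (ℕₚ.+-comm (d ℕ.* v) d) (sym (ℕₚ.*-suc d v))) ⟩
    ε′ (suc v) j - ε′ v j ∎
    where
    open ≡-Reasoning
    lem : ∀ d a b c p q → d * (a - b - c) - (p - q - d * c) ≡ (d * a - p) - (d * b - q)
    lem = solve-∀

  Δ-span : ∀ {a} → InSpan generator a → Δ a ≈ 𝟎
  Δ-span {a} (c , eq) = ≈-trans (≗⇒≈ λ j → trans (Δ-cong eq j) (Δ-lc c generator j))
    (≈-trans (lc-≈ c {h = λ _ → 𝟎} λ i → ≈-trans (≗⇒≈ (Δ-f (suc (toℕ i))))
        (≈-trans (⊟-cong (ε′≈𝟎 (suc (suc (toℕ i)))) (ε′≈𝟎 (suc (toℕ i)))) (≗⇒≈ λ _ → refl)))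
      (≗⇒≈ λ j → sumFin-0 m λ i → ℤₚ.*-zeroʳ (c i)))

  -- The preimage of ε_v under `Δ`: the images of f_0, ..., f_(v-1) telescope, and ε_0 = 0.
  f-prefix : ℕ → Poly m
  f-prefix v j = range 0 v (λ w → f w j)

  Δ-f-prefix : ∀ v → Δ (f-prefix v) ≗ ε′ v
  Δ-f-prefix v j = trans (Δ-range 0 v f j) (trans (range-cong 0 v λ w _ _ → Δ-f w j)
    (trans (range-telescope′ 0 v (λ w → ε′ w j)) (trans (cong (λ t → ε′ v j - t) ε′0≡0) (ℤₚ.+-identityʳ (ε′ v j)))))
    where
    ε′0≡0 : ε′ 0 j ≡ 0ℤ
    ε′0≡0 = trans (cong₂ (λ s t → + d * s - t) (E-zero j) (trans (cong (λ t → E t j) (ℕₚ.*-zeroʳ d)) (E-zero j)))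
              (trans (ℤₚ.+-identityʳ (+ d * 0ℤ)) (ℤₚ.*-zeroʳ (+ d)))

  f-sum : f-prefix n ≗ 𝟎
  f-sum = Δ-injective λ j → trans (Δ-f-prefix n j)
    (trans (cong₂ (λ s t → + d * s - t) (E-n j) (trans (E-cong dn≡0 j) (E-zero j)))
      (trans (ℤₚ.+-identityʳ (+ d * 0ℤ)) (ℤₚ.*-zeroʳ (+ d))))
    where
    dn≡0 : d ℕ.* n ≡ 0 [mod n ]
    dn≡0 = mod (divides (+ d) (trans (ℤₚ.+-identityʳ _) (ℤₚ.pos-* d n)))

  -- f_0 is not a generator, but it occurs in every `f-prefix` of positive length. All f_w with
  -- `w < n` sum to zero by `f-sum`, which gives the coefficients -1.
  f-zero∈ : InSpan generator (f 0)
  f-zero∈ = (λ _ → - 1ℤ) , λ j → begin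
    f 0 j                                       ≡⟨ lem (f 0 j) _ ⟩
    (f 0 j + range 1 m (λ w → f w j)) + (- 1ℤ) * range 1 m (λ w → f w j)
      ≡⟨ cong₂ (λ s t → s + (- 1ℤ) * t) (f-sum j)
        (sym (trans (sumFin-range m (λ w → f (suc w) j)) (range-shift 0 m (λ w → f w j)))) ⟩
    0ℤ + (- 1ℤ) * sumFin m (λ i → generator i j) ≡⟨ trans (ℤₚ.+-identityˡ _) (sym (sumFin-*ˡ m (- 1ℤ) _)) ⟩
    lc (λ _ → - 1ℤ) generator j                 ∎
    where
    open ≡-Reasoning
    lem : ∀ x y → x ≡ (x + y) + (- 1ℤ) * y
    lem = solve-∀

  f∈ : ∀ v → f v 𝓕.≈ 𝟎
  f∈ v with residue v
  ... | inj₁ v≡0       = 𝓕.≈-trans (𝓕.≗⇒≈ (f-cong v≡0)) (𝓕.InSpan⇒≈𝟎 f-zero∈)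
  ... | inj₂ (i , v≡i) = 𝓕.≈-trans (𝓕.≗⇒≈ (f-cong v≡i)) (generator≈𝟎 generator i)

  -- A combination of the ε_v is the image of the same combination of the `f-prefix`, and `Δ` is
  -- injective. With `Δ-span` this embeds S into Σ.
  span-Δ : ∀ {a} → Δ a ≈ 𝟎 → InSpan generator a
  span-Δ {a} p with ≈𝟎⇒InSpan p
  ... | c , eq = 𝓕.≈𝟎⇒InSpan (𝓕.≈-trans (𝓕.≗⇒≈ a≗)
      (𝓕.≈-trans (𝓕.lc-≈ c {h = λ _ → 𝟎} prefix∈) (𝓕.≗⇒≈ λ j → sumFin-0 m λ i → ℤₚ.*-zeroʳ (c i))))
    where
    a≗ : a ≗ lc c (λ i → f-prefix (suc (toℕ i)))
    a≗ = Δ-injective′ λ j → trans (eq j) (sym (trans (Δ-lc c _ j) (lc-congʳ c (λ i → Δ-f-prefix (suc (toℕ i))) j)))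
    prefix∈ : ∀ i → f-prefix (suc (toℕ i)) 𝓕.≈ 𝟎
    prefix∈ i = 𝓕.≈-trans (𝓕.range-≈ 0 (suc (toℕ i)) {h = λ _ → 𝟎} f∈)
      (𝓕.≗⇒≈ λ _ → range-0 0 (suc (toℕ i)) λ _ _ _ → refl)

  θ-cong : ∀ {a a′} → a ≈ a′ → + n ∣ θ a - θ a′
  θ-cong = ⟨⟩-≈ θ̂ λ i → subst (+ n ∣_) (sym (eq (suc (toℕ i))))
      (subst (+ n ∣_) (lem (+ d) _ _ _ _ (ℤₚ.pos-* d (suc (toℕ i))))
        (∣m∣n⇒∣m-n (∣n⇒∣m*n (+ d) (n∣% (suc (toℕ i)))) (n∣% (d ℕ.* suc (toℕ i)))))
    where
    eq : ∀ v → θ (ε′ v) ≡ + d * + (v % n) - + (d ℕ.* v % n)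
    eq v = trans (⟨⟩-⊟ (+ d · E v) (E (d ℕ.* v)) θ̂)
      (cong₂ _-_ (trans (⟨⟩-· (+ d) (E v) θ̂) (cong (+ d *_) (θ-E v))) (θ-E (d ℕ.* v)))
    lem : ∀ d x y v w → w ≡ d * v → d * (x - v) - (y - w) ≡ d * x - y
    lem d x y v _ refl = lem′ d x y v
      where
      lem′ : ∀ d x y v → d * (x - v) - (y - d * v) ≡ d * x - y
      lem′ = solve-∀

  θb : ℕ × ℕ → ℤ
  θb x = θ (b x)

  abstract

    -- `θ` is defined on Σ modulo `n`, so `b-torsion` gives that `n` divides
    -- `d ^ (i + 1) * θb (i , u)`; cancelling the power leaves `N (i + 1)`.
    N∣θb : ∀ i u → + N (suc i) ∣ θb (i , u)
    N∣θb i u = n∣d^*⇒ (suc i) (θb (i , u)) (subst (+ n ∣_)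
      (trans (cong (λ t → θ (+ (d ^ suc i) · b (i , u)) - t) (sumFin-0 m λ _ → refl))
        (trans (ℤₚ.+-identityʳ _) (⟨⟩-· (+ (d ^ suc i)) (b (i , u)) θ̂)))
      (θ-cong (b-torsion i u)))

  special-∈ : ∀ {i} → i < k → (i , special i) ∈ I
  special-∈ i<k = Head⇒∈I i<k (special-Head i<k)

  -- The lower lift is `E s` and contributes `s`. For `i + 1 < k` the upper lift is `E 1`, as
  -- `s = N (i + 1) + 1`; for `i + 1 = k` it vanishes, as `d ^ k * N k` is zero modulo `n`.
  θb-special : ∀ {i} → i < k → θb (i , special i) ≡ + N (suc i)
  θb-special {i} i<k = trans (⟨⟩-⊟ (L i s) (L (suc i) s) θ̂)
    (trans (cong (_- θ (L (suc i) s)) θL) (second (suc i ℕ.≟ k)))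
    where
    s = special i
    h = special-Head i<k
    θL : θ (L i s) ≡ + s
    θL = trans (⟨⟩-cong θ̂ (L-leaf i<k (Head.g∤ h))) (trans (cong (θ ∘ E) (ℕ%.m<n⇒m%n≡m (Head.<N h)))
      (trans (θ-E s) (cong +_ (ℕ%.m<n⇒m%n≡m (ℕₚ.<-≤-trans (Head.<N h) (ℕᵈ.∣⇒≤ (N∣n i)))))))
    second : Dec (suc i ≡ k) → + s - θ (L (suc i) s) ≡ + N (suc i)
    second (no i≢k) = trans (cong₂ (λ x y → + x - y) (special-< i+1<k) θL′) (lem (+ M))
      where
      i+1<k = ℕₚ.≤∧≢⇒< i<k i≢k
      M = N (suc i)
      1<M : 1 < M
      1<M = ℕₚ.<-≤-trans (1<g i+1<k) (ℕᵈ.∣⇒≤ (g∣N (suc i)))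
      s≡1 : s ≡ 1 [mod M ]
      s≡1 = subst (_≡ 1 [mod M ]) (sym (special-< i+1<k))
        (mod (divides 1ℤ (trans (lem (+ M)) (sym (ℤₚ.*-identityˡ (+ M))))))
        where
        lem : ∀ x → (1ℤ + x) - 1ℤ ≡ x
        lem = solve-∀
      s%M : s % M ≡ 1
      s%M = trans (mod⇒%≡ s≡1) (ℕ%.m<n⇒m%n≡m 1<M)
      g∤s : ¬ g (suc i) ℕᵈ.∣ s
      g∤s g∣s = g≢1 i+1<k (ℕᵈ.∣1⇒≡1 (∣-mod (g∣N (suc i)) s≡1 g∣s))
      θL′ : θ (L (suc i) s) ≡ 1ℤ
      θL′ = trans (⟨⟩-cong θ̂ (L-leaf i+1<k g∤s)) (trans (cong (θ ∘ E) s%M)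
        (trans (θ-E 1) (cong +_ (ℕ%.m<n⇒m%n≡m (ℕₚ.<-≤-trans 1<M (ℕᵈ.∣⇒≤ (N∣n (suc i))))))))
      lem : ∀ x → (1ℤ + x) - 1ℤ ≡ x
      lem = solve-∀
    second (yes i≡k) = trans (cong₂ (λ x y → + x - y) (special-≡ i≡k) θL′) (ℤₚ.+-identityʳ (+ N (suc i)))
      where
      R = proj₁ (period gk≡1)
      N≡0 : N (suc i) ≡ 0 [mod N k ]
      N≡0 = subst (λ t → N t ≡ 0 [mod N k ]) (sym i≡k)
        (mod (divides 1ℤ (trans (ℤₚ.+-identityʳ _) (sym (ℤₚ.*-identityˡ (+ N k))))))
      d^k*s≡0 : d ^ k ℕ.* s ≡ 0 [mod n ]
      d^k*s≡0 = subst (d ^ k ℕ.* s ≡_[mod n ]) (ℕₚ.*-zeroʳ (d ^ k))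
        (^*-mod k (subst (_≡ 0 [mod N k ]) (sym (special-≡ i≡k)) N≡0))
      θL′ : θ (L (suc i) s) ≡ 0ℤ
      θL′ = trans (⟨⟩-cong θ̂ (L-base (ℕₚ.≤-reflexive (sym i≡k))))
        (trans (⟨⟩-· (+ (d ^ R)) (E (d ^ k ℕ.* s)) θ̂) (trans (cong (+ (d ^ R) *_)
          (trans (θ-E (d ^ k ℕ.* s)) (cong +_ (mod⇒%≡ d^k*s≡0)))) (ℤₚ.*-zeroʳ (+ (d ^ R)))))

  T U : ℕ → (ℕ × ℕ → ℤ) → ℤ
  T i p = sumL I (λ x → 𝟙 (i ℕ.≤? proj₁ x) * (p x * θb x))
  U i p = sumL I (λ x → 𝟙 (i ℕ.≟ proj₁ x) * (p x * θb x))

  T-⊟ : ∀ i p q → T i (λ x → p x - q x) ≡ T i p - T i q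
  T-⊟ i p q = trans (sumL-cong I λ {x} _ → lem (𝟙 (i ℕ.≤? proj₁ x)) (p x) (q x) (θb x))
    (trans (sumL-+ I _ _) (trans (+-congˡ (T i p) (sumL-*ˡ I (- 1ℤ) _)) (lem′ (T i p) (T i q))))
    where
    lem : ∀ a b c e → a * ((b - c) * e) ≡ a * (b * e) + (- 1ℤ) * (a * (c * e))
    lem = solve-∀
    lem′ : ∀ x y → x + (- 1ℤ) * y ≡ x - y
    lem′ = solve-∀

  T-step : ∀ i p → T i p ≡ U i p + T (suc i) p
  T-step i p = trans (sumL-cong I λ {x} _ → trans (cong (_* (p x * θb x)) (split (proj₁ x)))
    (ℤₚ.*-distribʳ-+ (p x * θb x) (𝟙 (i ℕ.≟ proj₁ x)) (𝟙 (suc i ℕ.≤? proj₁ x))))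
    (sumL-+ I _ _)
    where
    split : ∀ j → 𝟙 (i ℕ.≤? j) ≡ 𝟙 (i ℕ.≟ j) + 𝟙 (suc i ℕ.≤? j)
    split j = go (i ℕ.≤? j) (i ℕ.≟ j) (suc i ℕ.≤? j)
      where
      go : (≤? : Dec (i ≤ j)) (≟? : Dec (i ≡ j)) (<? : Dec (i < j)) → 𝟙 ≤? ≡ 𝟙 ≟? + 𝟙 <?
      go _        (yes refl) (yes i<i) = contradiction i<i (ℕₚ.n≮n i)
      go ≤?       (yes refl) (no  _)   = 𝟙-yes ≤? ℕₚ.≤-refl
      go ≤?       (no  _)    (yes i<j) = 𝟙-yes ≤? (ℕₚ.<⇒≤ i<j)
      go ≤?       (no  i≢j)  (no  i≮j) = 𝟙-no ≤? λ i≤j → i≮j (ℕₚ.≤∧≢⇒< i≤j i≢j)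

  T-vanish : ∀ {i} p → k ≤ i → T i p ≡ 0ℤ
  T-vanish {i} p k≤i = sumL-0 I λ {x} x∈ → cong (_* (p x * θb x))
    (𝟙-no (i ℕ.≤? proj₁ x) (ℕₚ.<⇒≱ (ℕₚ.<-≤-trans (∈I⇒< x∈) k≤i)))

  T-zero : ∀ p → T 0 p ≡ θ (comb p)
  T-zero p = sym (trans (⟨⟩-sumL I (λ x → p x · b x) θ̂)
    (sumL-cong I λ {x} _ → trans (⟨⟩-· (p x) (b x) θ̂) (sym (ℤₚ.*-identityˡ _))))

  abstract

    -- At level 0 this is the hypothesis. Passing from `T i` to `T (i + 1)` removes `U i`, which is
    -- divisible by `N (i + 1)`.
    N∣T : ∀ {p} → + n ∣ θ (comb p) → ∀ i → + N i ∣ T i p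
    N∣T {p} n∣ zero = subst₂ _∣_ (cong +_ (sym N-zero)) (sym (T-zero p)) n∣
    N∣T {p} n∣ (suc i) = subst (+ N (suc i) ∣_) (trans (cong (_- U i p) (T-step i p)) (lem (U i p) (T (suc i) p)))
      (∣m∣n⇒∣m-n (∣-trans (∣ᵤ⇒∣ (N-∣-suc i)) (N∣T {p} n∣ i))
        (∣-sumL I {λ x → 𝟙 (i ℕ.≟ proj₁ x) * (p x * θb x)} λ {x} _ → N∣term x))
      where
      lem : ∀ x y → (x + y) - x ≡ y
      lem = solve-∀
      N∣term : ∀ x → + N (suc i) ∣ 𝟙 (i ℕ.≟ proj₁ x) * (p x * θb x)
      N∣term x@(i′ , u) = go (i ℕ.≟ i′)
        where
        go : (i≟i′ : Dec (i ≡ i′)) → + N (suc i) ∣ 𝟙 i≟i′ * (p x * θb x)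
        go (yes refl) = ∣n⇒∣m*n 1ℤ (∣n⇒∣m*n (p x) (N∣θb i u))
        go (no  _)    = divides 0ℤ refl

  -- c replaces the coordinate at each special head by the weight T i p / N i, which is integral on the kernel of θ
  record Adapted (p c : ℕ × ℕ → ℤ) : Set where
    field
      ordinary : ∀ {i u} → (i , u) ∈ I → u ≢ special i → c (i , u) ≡ p (i , u)
      weight   : ∀ {i} → i < k → T i p ≡ c (i , special i) * + N i

  open Adapted

  sandpile-order : ℕ × ℕ → ℕ
  sandpile-order (i , u) = choose (u ℕ.≟ special i) (safeDiv (d ^ suc i) (g i)) (d ^ suc i)

  order-special : ∀ i → sandpile-order (i , special i) ≡ safeDiv (d ^ suc i) (g i)
  order-special i = choose-yes (special i ℕ.≟ special i) refl

  order-ordinary : ∀ {i u} → u ≢ special i → sandpile-order (i , u) ≡ d ^ suc i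
  order-ordinary {i} {u} = choose-no (u ℕ.≟ special i)

  -- The common measure of both coordinate systems: divisibility of `T i p` by `D i` means that the
  -- weight at level `i` is zero modulo its order, and `p * θb` is divisible by `D i` when `p` is
  -- zero modulo `d ^ (i + 1)`.
  D : ℕ → ℤ
  D i = + (d ^ suc i) * + N (suc i)

  D-∣ : ∀ {i j} → i ≤ j → D i ∣ D j
  D-∣ {i} {zero}  z≤n = ∣-refl
  D-∣ {i} {suc j} i≤ with i ℕ.≟ suc j
  ... | yes refl = ∣-refl
  ... | no i≢ = ∣-trans (D-∣ (ℕₚ.≤-pred (ℕₚ.≤∧≢⇒< i≤ i≢)))
    (subst (D j ∣_) (trans (lem (+ (d ^ suc j)) (+ d) (+ N (suc (suc j))))
      (cong (_* + N (suc (suc j))) (sym (pos-^ d (suc j)))))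
      (*-monoʳ-∣ (+ (d ^ suc j)) (⇒N∣d* (suc j) (+ N (suc (suc j))) ∣-refl)))
    where
    lem : ∀ x y z → x * (y * z) ≡ (y * x) * z
    lem = solve-∀

  order-* : ∀ i → + safeDiv (d ^ suc i) (g i) * + g i ≡ + (d ^ suc i)
  order-* i = sym (trans (cong +_ (safeDiv-exact {d ^ suc i} (ℕᵈ.∣m⇒∣m*n (d ^ i) (g∣d i))))
    (ℤₚ.pos-* (safeDiv (d ^ suc i) (g i)) (g i)))

  -- `N i` contains one factor `g i` more than `N (i + 1)`; it is supplied by the weight, which is
  -- why the order of the special coordinate drops by `g i`.
  order-∣-weight : ∀ {i c} → + safeDiv (d ^ suc i) (g i) ∣ c → D i ∣ c * + N i
  order-∣-weight {i} {c} h = subst₂ _∣_ (cong (_* + N (suc i)) (order-* i))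
    (trans (lem c (+ g i) (+ N (suc i))) (cong (c *_) (sym (+N-step i))))
    (*-monoˡ-∣ (+ N (suc i)) (*-monoˡ-∣ (+ g i) h))
    where
    lem : ∀ x y z → (x * y) * z ≡ x * (z * y)
    lem = solve-∀

  weight-∣-order : ∀ {i c} → D i ∣ c * + N i → + safeDiv (d ^ suc i) (g i) ∣ c
  weight-∣-order {i} {c} h = *-cancelʳ-∣ (+ g i) (*-cancelʳ-∣ (+ N (suc i))
    (subst₂ _∣_ (cong (_* + N (suc i)) (sym (order-* i)))
      (sym (trans (lem c (+ g i) (+ N (suc i))) (cong (c *_) (sym (+N-step i))))) h))
    where
    lem : ∀ x y z → (x * y) * z ≡ x * (z * y)
    lem = solve-∀

  D∣pθ : ∀ {i u p} → + (d ^ suc i) ∣ p → D i ∣ p * θb (i , u)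
  D∣pθ {i} {u} {p} h = ∣-trans (*-monoˡ-∣ (+ N (suc i)) h) (*-monoʳ-∣ p (N∣θb i u))

  -- A term of `T i p` from level `j ≥ i` is divisible by `D j`, hence by `D i`.
  adapted-∣ : ∀ {p c} → Adapted p c → (∀ {x} → x ∈ I → + level-order x ∣ p x) →
              ∀ {x} → x ∈ I → + sandpile-order x ∣ c x
  adapted-∣ {p} {c} A h {i , u} x∈ with u ℕ.≟ special i
  ... | no u≢    = subst (+ (d ^ suc i) ∣_) (sym (ordinary A x∈ u≢)) (h x∈)
  ... | yes refl = weight-∣-order (subst (D i ∣_) (weight A (∈I⇒< x∈)) (∣-sumL I λ {x} → D∣term x))
    where
    D∣term : ∀ x → x ∈ I → D i ∣ 𝟙 (i ℕ.≤? proj₁ x) * (p x * θb x)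
    D∣term x@(j , v) x∈ = go (i ℕ.≤? j)
      where
      go : (i≤j? : Dec (i ≤ j)) → D i ∣ 𝟙 i≤j? * (p x * θb x)
      go (yes i≤j) = ∣n⇒∣m*n 1ℤ (∣-trans (D-∣ i≤j) (D∣pθ (h x∈)))
      go (no  _)   = divides 0ℤ refl

  -- The weights make `D i` divide `T i p` and `T (i + 1) p`, hence `U i p`. Its ordinary terms are
  -- divisible by `D i`, so the special term is too; that term is `p * N (i + 1)`, and `N (i + 1)`
  -- cancels.
  ∣-adapted : ∀ {p c} → Adapted p c → (∀ {x} → x ∈ I → + sandpile-order x ∣ c x) →
              ∀ {x} → x ∈ I → + level-order x ∣ p x
  ∣-adapted {p} {c} A h {i , u} x∈ with u ℕ.≟ special i
  ... | no u≢ = subst₂ _∣_ (cong +_ (order-ordinary u≢)) (ordinary A x∈ u≢) (h x∈)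
  ... | yes refl = *-cancelʳ-∣ (+ N (suc i)) (subst (D i ∣_) (cong (p y *_) (θb-special i<k)) D∣pθb)
    where
    y = (i , special i)
    i<k = ∈I⇒< x∈
    D∣T : ∀ {j} → j < k → D j ∣ T j p
    D∣T {j} j<k = subst (D j ∣_) (sym (weight A j<k)) (order-∣-weight
      (subst (λ t → + t ∣ c (j , special j)) (order-special j) (h (special-∈ j<k))))
    D∣T-suc : D i ∣ T (suc i) p
    D∣T-suc with suc i ℕ.≟ k
    ... | yes i≡k = subst (D i ∣_) (sym (T-vanish p (ℕₚ.≤-reflexive (sym i≡k)))) (divides 0ℤ refl)
    ... | no  i≢k = ∣-trans (D-∣ (ℕₚ.n≤1+n i)) (D∣T (ℕₚ.≤∧≢⇒< i<k i≢k))
    D∣U : D i ∣ U i p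
    D∣U = ∣m+n∣n⇒∣m (subst (D i ∣_) (T-step i p) (D∣T i<k)) D∣T-suc
    term : ℕ × ℕ → ℤ
    term x = 𝟙 (i ℕ.≟ proj₁ x) * (p x * θb x)
    D∣rest : ∀ x → x ∈ I → D i ∣ 𝟙 (¬? (x ≟× y)) * term x
    D∣rest x@(j , v) x∈ = go (x ≟× y) (i ℕ.≟ j)
      where
      go : (eq? : Dec (x ≡ y)) (i≟j : Dec (i ≡ j)) → D i ∣ 𝟙 (¬? eq?) * (𝟙 i≟j * (p x * θb x))
      go (yes _)  _          = divides 0ℤ refl
      go (no _)   (no _)     = divides 0ℤ refl
      go (no x≢y) (yes refl) = ∣n⇒∣m*n 1ℤ (∣n⇒∣m*n 1ℤ (D∣pθ (subst₂ _∣_ (cong +_ (order-ordinary v≢))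
          (ordinary A x∈ v≢) (h x∈))))
        where
        v≢ : v ≢ special i
        v≢ refl = x≢y refl
    D∣pθb : D i ∣ p y * θb y
    D∣pθb = subst (D i ∣_) (trans (cong (_* (p y * θb y)) (𝟙-yes (i ℕ.≟ i) refl)) (ℤₚ.*-identityˡ _))
      (∣m+n∣n⇒∣m (subst (D i ∣_) (sumL-extract (index-unique k) x∈ term) D∣U) (∣-sumL I λ {x} → D∣rest x))

  adapted-⊟ : ∀ {p q c c′} → Adapted p c → Adapted q c′ → Adapted (λ x → p x - q x) (λ x → c x - c′ x)
  adapted-⊟ {p} {q} {c} {c′} A B = record
    { ordinary = λ x∈ u≢ → cong₂ _-_ (ordinary A x∈ u≢) (ordinary B x∈ u≢)
    ; weight   = λ {i} i<k → trans (T-⊟ i p q) (trans (cong₂ _-_ (weight A i<k) (weight B i<k))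
                   (lem (c (i , special i)) (c′ (i , special i)) (+ N i)))
    }
    where
    lem : ∀ x y z → x * z - y * z ≡ (x - y) * z
    lem = solve-∀

  adapted-resp : ∀ {p q c} → (∀ {x} → x ∈ I → p x ≡ q x) → Adapted p c → Adapted q c
  adapted-resp p≡q A = record
    { ordinary = λ x∈ u≢ → trans (ordinary A x∈ u≢) (p≡q x∈)
    ; weight   = λ {i} i<k → trans (sumL-cong I λ {x} x∈ → cong (λ t → 𝟙 (i ℕ.≤? proj₁ x) * (t * θb x))
      (sym (p≡q x∈))) (weight A i<k)
    }

  module Unadapt (c : ℕ × ℕ → ℤ) where

    -- The value 0 from level `k` on agrees with `T-vanish` and starts the downward induction in
    -- `T-p`.
    C : ℕ → ℤ
    C i = choose (i ℕ.<? k) (c (i , special i)) 0ℤ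

    C-< : ∀ {i} → i < k → C i ≡ c (i , special i)
    C-< {i} = choose-yes (i ℕ.<? k)

    C-≥ : ∀ {i} → k ≤ i → C i ≡ 0ℤ
    C-≥ {i} k≤i = choose-no (i ℕ.<? k) (ℕₚ.≤⇒≯ k≤i)

    τ : ℕ × ℕ → ℤ
    τ (i , u) = quotient (N∣θb i u)

    rest : ℕ → ℤ
    rest i = sumL I (λ x → 𝟙 (¬? (x ≟× (i , special i))) * (𝟙 (i ℕ.≟ proj₁ x) * (c x * τ x)))

    -- The special value solves `T i p = C i * N i`: this requires `U i p = N (i + 1) * (g i * C i -
    -- C (i + 1))`, to which the ordinary heads contribute `N (i + 1) * rest i` and the special head
    -- `N (i + 1)` times its coordinate.
    p : ℕ × ℕ → ℤ
    p (i , u) = choose (u ℕ.≟ special i) (+ g i * C i - C (suc i) - rest i) (c (i , u))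

    p-special : ∀ i → p (i , special i) ≡ + g i * C i - C (suc i) - rest i
    p-special i = choose-yes (special i ℕ.≟ special i) refl

    p-ordinary : ∀ {i u} → u ≢ special i → p (i , u) ≡ c (i , u)
    p-ordinary {i} {u} = choose-no (u ℕ.≟ special i)

    U-p : ∀ {i} → i < k → U i p ≡ + N (suc i) * (+ g i * C i - C (suc i))
    U-p {i} i<k = begin
      U i p
        ≡⟨ sumL-extract (index-unique k) (special-∈ i<k) term ⟩
      term y + sumL I (λ x → 𝟙 (¬? (x ≟× y)) * term x)
        ≡⟨ cong₂ _+_ (trans (cong (_* (p y * θb y)) (𝟙-yes (i ℕ.≟ i) refl)) (trans (ℤₚ.*-identityˡ _)
             (cong₂ _*_ (p-special i) (θb-special i<k))))
             (trans (sumL-cong I λ {x} _ → other x) (sumL-*ˡ I (+ N (suc i)) _)) ⟩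
      (+ g i * C i - C (suc i) - rest i) * + N (suc i) + + N (suc i) * rest i
        ≡⟨ lem (+ g i * C i - C (suc i)) (rest i) (+ N (suc i)) ⟩
      + N (suc i) * (+ g i * C i - C (suc i)) ∎
      where
      open ≡-Reasoning
      y = (i , special i)
      term : ℕ × ℕ → ℤ
      term x = 𝟙 (i ℕ.≟ proj₁ x) * (p x * θb x)
      lem : ∀ a r M → (a - r) * M + M * r ≡ M * a
      lem = solve-∀
      lem′ : ∀ M c t → 1ℤ * (1ℤ * (c * (t * M))) ≡ M * (1ℤ * (1ℤ * (c * t)))
      lem′ = solve-∀
      other : ∀ x → 𝟙 (¬? (x ≟× y)) * term x
                  ≡ + N (suc i) * (𝟙 (¬? (x ≟× y)) * (𝟙 (i ℕ.≟ proj₁ x) * (c x * τ x)))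
      other x@(j , v) = go (x ≟× y) (i ℕ.≟ j)
        where
        go : (eq? : Dec (x ≡ y)) (i≟j : Dec (i ≡ j)) →
             𝟙 (¬? eq?) * (𝟙 i≟j * (p x * θb x)) ≡ + N (suc i) * (𝟙 (¬? eq?) * (𝟙 i≟j * (c x * τ x)))
        go (yes _)  _          = sym (ℤₚ.*-zeroʳ (+ N (suc i)))
        go (no _)   (no _)     = sym (ℤₚ.*-zeroʳ (+ N (suc i)))
        go (no x≢y) (yes refl) = trans (cong₂ (λ s t → 1ℤ * (1ℤ * (s * t))) (p-ordinary λ { refl → x≢y refl })
            (_∣_.equality (N∣θb i v))) (lem′ (+ N (suc i)) (c x) (τ x))

    T-p : ∀ l i → i ℕ.+ l ≡ k → T i p ≡ C i * + N i
    T-p zero i i≡k = trans (T-vanish p k≤i) (cong (_* + N i) (sym (C-≥ k≤i)))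
      where
      k≤i : k ≤ i
      k≤i = ℕₚ.≤-reflexive (sym (trans (sym (ℕₚ.+-identityʳ i)) i≡k))
    T-p (suc l) i i+l≡k = begin
      T i p                                                               ≡⟨ T-step i p ⟩
      U i p + T (suc i) p
        ≡⟨ cong₂ _+_ (U-p i<k) (T-p l (suc i) (trans (sym (ℕₚ.+-suc i l)) i+l≡k)) ⟩
      + N (suc i) * (+ g i * C i - C (suc i)) + C (suc i) * + N (suc i)
        ≡⟨ lem (+ N (suc i)) (+ g i) (C i) (C (suc i)) ⟩
      C i * (+ N (suc i) * + g i)                                         ≡⟨ cong (C i *_) (+N-step i) ⟨
      C i * + N i                                                         ∎
      where
      open ≡-Reasoning
      i<k : i < k
      i<k = subst (i <_) i+l≡k (ℕₚ.m<m+n i (s≤s z≤n))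
      lem : ∀ M g x y → M * (g * x - y) + y * M ≡ x * (M * g)
      lem = solve-∀

    adapted : Adapted p c
    adapted = record
      { ordinary = λ _ u≢ → sym (p-ordinary u≢)
      ; weight   = λ {i} i<k → trans (T-p (k ∸ i) i (ℕₚ.m+[n∸m]≡n (ℕₚ.<⇒≤ i<k))) (cong (_* + N i) (C-< i<k))
      }

    n∣θ : + n ∣ θ (comb p)
    n∣θ = divides (C 0) (trans (sym (T-zero p)) (trans (T-p k 0 refl) (cong (λ t → C 0 * + t) N-zero)))

  abstract

    unadapt : ∀ (c : ℕ × ℕ → ℤ) → ∃ λ p → Adapted p c × + n ∣ θ (comb p)
    unadapt c = Unadapt.p c , Unadapt.adapted c , Unadapt.n∣θ c

  adapt : ∀ {p} → + n ∣ θ (comb p) → ∃ (Adapted p)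
  adapt {p} n∣ = c , record
    { ordinary = λ {i} {u} _ → choose-no (u ℕ.≟ special i)
    ; weight   = λ {i} _ → trans (_∣_.equality (N∣T {p} n∣ i))
                   (cong (_* + N i) (sym (choose-yes (special i ℕ.≟ special i) refl)))
    }
    where
    c : ℕ × ℕ → ℤ
    c (i , u) = choose (u ℕ.≟ special i) (quotient (N∣T {p} n∣ i)) (p (i , u))

  -- The weight determines the special coordinate since `N i` is nonzero. Hence on `I` the
  -- coordinates of an element do not depend on the proof that it is torsion.
  adapted-unique : ∀ {p c c′} → Adapted p c → Adapted p c′ → ∀ {x} → x ∈ I → c x ≡ c′ x
  adapted-unique {p} {c} {c′} A B {i , u} x∈ with u ℕ.≟ special i
  ... | no u≢    = trans (ordinary A x∈ u≢) (sym (ordinary B x∈ u≢))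
  ... | yes refl = ℤₚ.*-cancelʳ-≡ _ _ (+ N i) (trans (sym (weight A (∈I⇒< x∈))) (weight B (∈I⇒< x∈)))

  coordinates : Poly m → ℕ × ℕ → ℤ
  coordinates a x = ⟨ Δ a , π̂ x ⟩

  Δ-torsion : ∀ {a} → InSpan (fGens n d) (λ j → d^k * elemZ n a j) → d^k · Δ a ≈ 𝟎
  Δ-torsion {a} s = ≈-trans (≗⇒≈ λ j → sym (Δ-· d^k a j))
    (Δ-span (InSpan⇒ {G = fGens n d} {generator} fGens≗ {a = d^k · a} (λ j → sym (lc-· d^k a (eGens n) j)) s))

  -- `Δ a` is congruent to its expansion, `θ` respects the congruence modulo `n`, and it vanishes
  -- modulo `n` on the image of `Δ`.
  n∣θ-coordinates : ∀ {a} → d^k · Δ a ≈ 𝟎 → + n ∣ θ (comb (coordinates a))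
  n∣θ-coordinates {a} tors = ∣m+n∣m⇒∣n {m = θ (Δ a) - θ (comb (coordinates a))}
    (subst (+ n ∣_) (lem (θ (Δ a)) _) (n∣θ-Δ a)) (θ-cong (expand-torsion tors))
    where
    lem : ∀ x y → x ≡ (x - y) + y
    lem = solve-∀

  Torsion : Poly m → Set
  Torsion a = InSpan (fGens n d) (λ j → d^k * elemZ n a j)

  abstract

    adapted-coordinates : ∀ a → Torsion a → ∃ (Adapted (coordinates a))
    adapted-coordinates a s = adapt (n∣θ-coordinates {a} (Δ-torsion {a} s))

  coords : ∀ a → Torsion a → ℕ × ℕ → ℤ
  coords a s = proj₁ (adapted-coordinates a s)

  coords-adapted : ∀ a s → Adapted (coordinates a) (coords a s)
  coords-adapted a s = proj₂ (adapted-coordinates a s)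

  coords-cong : ∀ a s a′ s′ → InSpan (fGens n d) (λ j → elemZ n a j - elemZ n a′ j) →
    ∀ {x} → x ∈ I → + sandpile-order x ∣ coords a s x - coords a′ s′ x
  coords-cong a s a′ s′ r = adapted-∣ (adapted-⊟ (coords-adapted a s) (coords-adapted a′ s′))
    λ {x} x∈ → π-cong {x} {Δ a} {Δ a′} x∈ Δa≈Δa′
    where
    Δa≈Δa′ : Δ a ≈ Δ a′
    Δa≈Δa′ = ⊟≈𝟎 {Δ a} {Δ a′} (≈-trans (≗⇒≈ λ j → sym (Δ-⊟ a a′ j)) (Δ-span (InSpan⇒≈ fGens≗ a a′ r)))

  coords-injective : ∀ a s a′ s′ → (∀ {x} → x ∈ I → + sandpile-order x ∣ coords a s x - coords a′ s′ x) →
    InSpan (fGens n d) (λ j → elemZ n a j - elemZ n a′ j)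
  coords-injective a s a′ s′ h = ≈⇒InSpan fGens≗ a a′ (span-Δ (≈-trans (≗⇒≈ (Δ-⊟ a a′))
    (π-injective {Δ a ⊟ Δ a′} (⊟-torsion {d^k} {Δ a} {Δ a′} (Δ-torsion {a} s) (Δ-torsion {a′} s′))
      λ {x} x∈ → subst (+ level-order x ∣_) (sym (⟨⟩-⊟ (Δ a) (Δ a′) (π̂ x)))
        (∣-adapted (adapted-⊟ (coords-adapted a s) (coords-adapted a′ s′)) h x∈))))

  -- Adaptedness is linear, so the coordinates of the sum minus those of `a′` are adapted to
  -- `coordinates a`; uniqueness finishes, with equality in ℤ.
  coords-hom : ∀ a s a′ s′ s″ {x} → x ∈ I → coords (a ⊞ a′) s″ x ≡ coords a s x + coords a′ s′ x
  coords-hom a s a′ s′ s″ {x} x∈ = trans (lem (coords (a ⊞ a′) s″ x) (coords a′ s′ x)) (cong (_+ coords a′ s′ x)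
    (adapted-unique (adapted-resp diff≡ (adapted-⊟ (coords-adapted (a ⊞ a′) s″) (coords-adapted a′ s′)))
      (coords-adapted a s) x∈))
    where
    lem : ∀ x y → x ≡ (x - y) + y
    lem = solve-∀
    lem′ : ∀ x y → (x + y) - y ≡ x
    lem′ = solve-∀
    diff≡ : ∀ {x} → x ∈ I → coordinates (a ⊞ a′) x - coordinates a′ x ≡ coordinates a x
    diff≡ {x} _ = trans (cong (_- coordinates a′ x) (trans (⟨⟩-cong (π̂ x) (Δ-⊞ a a′)) (⟨⟩-⊞ (Δ a) (Δ a′) (π̂ x))))
      (lem′ (coordinates a x) (coordinates a′ x))

  coords-preimage : ∀ (c p : ℕ × ℕ → ℤ) → Adapted p c → ∀ a → Δ a ≗ comb p →
    Σ (Torsion a) λ s → ∀ {x} → x ∈ I → coords a s x ≡ c x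
  coords-preimage c p A a Δa≗ = s , λ {x} x∈ → adapted-unique (adapted-resp p≡ (coords-adapted a s)) A x∈
    where
    s : Torsion a
    s = InSpan⇐ fGens≗ {a = d^k · a} (λ j → sym (lc-· d^k a (eGens n) j)) (span-Δ
      (≈-trans (≗⇒≈ λ j → trans (Δ-· d^k a j) (cong (d^k *_) (Δa≗ j))) (comb-torsion p)))
    p≡ : ∀ {x} → x ∈ I → coordinates a x ≡ p x
    p≡ {x} x∈ = trans (⟨⟩-cong (π̂ x) Δa≗) (comb-π p x∈)

  abstract

    coords-surjective : ∀ (c : ℕ × ℕ → ℤ) → ∃₂ λ a (s : Torsion a) → ∀ {x} → x ∈ I → coords a s x ≡ c x
    coords-surjective c =
      let p , A , n∣ = unadapt c
          a , Δa≗    = Δ-surjective (comb p) n∣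
      in a , coords-preimage c p A a Δa≗

  S0≅CycFam : Iso (S0 n d k) (CycFam I sandpile-order)
  S0≅CycFam = record
    { to         = λ (a , s) → coords a s
    ; to-cong    = λ {(a , s)} {(a′ , s′)} r x∈ → coords-cong a s a′ s′ r x∈
    ; to-hom     = λ x y {z} z∈ → divides 0ℤ (ℤₚ.i≡j⇒i-j≡0
        (coords-hom (proj₁ x) (proj₂ x) (proj₁ y) (proj₂ y) (proj₂ (SGroup._∙_ (S0 n d k) x y)) {z} z∈))
    ; injective  = λ {(a , s)} {(a′ , s′)} h → coords-injective a s a′ s′ h
    ; surjective = λ c → let a , s , eq = coords-surjective c in (a , s) , λ x∈ → divides 0ℤ (ℤₚ.i≡j⇒i-j≡0 (eq x∈))
    }

-- The lists of moduli and the two isomorphisms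

module _ (m d : ℕ) .{{d≢0 : NonZero d}} (k : ℕ) (is-length : IsDLength (suc m) d k) where

  private
    n = suc m

  ns-step : ∀ i → ns n d i ≡ ns n d (suc i) ℕ.* ds n d i
  ns-step i = safeDiv-exact {{ℕ.≢-nonZero λ g≡0 → ℕ.≢-nonZero⁻¹ d (gcd[m,n]≡0⇒n≡0 (ns n d i) g≡0)}}
    (gcd[m,n]∣m (ns n d i) d)

  open Sandpile m d (ns n d) (ds n d) refl (λ _ → refl) ns-step k (proj₁ is-length) (λ {i} → proj₂ is-length i)

  suc-others : ∀ {i} → i < k → suc (length (others i)) ≡ rk n d i
  suc-others = length-others

  index-order : ∀ (md : ℕ × ℕ → ℕ) (L : ℕ → List ℕ) → L 0 ≡ [] →
    (∀ i → i < k → L (suc i) ≡ L i ++ map (λ u → md (i , u)) (heads i)) → ∀ l → l ≤ k → map md (index l) ≡ L l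
  index-order md L L0 Ls zero    _   = sym L0
  index-order md L L0 Ls (suc l) l<k = trans (map-++ md (index l) (map (l ,_) (heads l)))
    (trans (cong₂ _++_ (index-order md L L0 Ls l (ℕₚ.<⇒≤ l<k)) (sym (map-∘ (heads l)))) (sym (Ls l l<k)))

  sigma-order : map level-order I ≡ sigmaModuli n d k
  sigma-order = index-order level-order (sigmaModuli n d) refl
    (λ i i<k → cong (sigmaModuli n d i ++_) (sym (trans (map-const-on (heads i) (λ _ → refl))
      (cong (λ t → replicate t (d ^ suc i)) (suc-others i<k))))) k ℕₚ.≤-refl

  s-order : map sandpile-order I ≡ sModuli n d k
  s-order = index-order sandpile-order (sModuli n d) refl
    (λ i i<k → cong (sModuli n d i ++_) (sym (cong₂ _∷_ (order-special i)
      (trans (map-const-on (others i) λ u∈ → order-ordinary {i} (others-≢ {i} u∈))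
        (cong (λ t → replicate t (d ^ suc i)) (cong ℕ.pred (suc-others i<k))))))) k ℕₚ.≤-refl

  sigma-iso : Iso (Sigma0 n d k) (CycSum (sigmaModuli n d k))
  sigma-iso = subst (λ L → Iso (Sigma0 n d k) (CycSum L)) sigma-order
    (Iso-trans (λ {x} {y} {z} → CycSum-trans (map level-order I) {x} {y} {z}) Sigma0≅CycFam
      (CycFam≅CycSum level-order I (index-unique k)))

  s-iso : Iso (S0 n d k) (CycSum (sModuli n d k))
  s-iso = subst (λ L → Iso (S0 n d k) (CycSum L)) s-order
    (Iso-trans (λ {x} {y} {z} → CycSum-trans (map sandpile-order I) {x} {y} {z}) S0≅CycFam
      (CycFam≅CycSum sandpile-order I (index-unique k)))

theorem4p7 : (n d : ℕ) .{{_ : NonZero n}} → 2 ≤ d → (k : ℕ) → IsDLength n d k →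
    Iso (Sigma0 n d k) (CycSum (sigmaModuli n d k)) × Iso (S0 n d k) (CycSum (sModuli n d k))
theorem4p7 zero    d {{()}} _ _ _
theorem4p7 (suc m) (suc d) _ k is-length = sigma-iso m (suc d) k is-length , s-iso m (suc d) k is-length
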